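{- Let $p>3$ be a prime, and let $a$ be a $p$-adic integer. (i) If $m$ is a positive integer with $a\equiv m\pmod{p^2}$, then $$\sum_{k=0}^{p-1}\binom{ -a}k\binom{a-1}kH_k^{(2)}\equiv 2\sum_{\substack{0<k<m\\ p\nmid k}}\frac{(-1)^{m-k}}{k^2}\equiv-E_{p^2-p-2}(a)\pmod{p^2}$$ and $$(2a-1)\sum_{k=0}^{p-1}\binom{ -a}k\binom{a-1}k\frac{H_k^{(2)}}{2k+1}\equiv-2\sum_{\substack{0<k<m\\ p\nmid k}}\frac1{k^2}\equiv(2-2p)B_{p^2-p-1}(a)\pmod{p^2}.$$ (ii) We always have $$\sum_{k=0}^{p-1}\binom{ -a}k\binom{a-1}kH_k^{(2)}\equiv -E_{p-3}(a)\pmod p$$ and $$(2a-1)\sum_{k=0}^{p-1}\binom{ -a}k\binom{a-1}k\frac{H_k^{(2)}}{2k+1}\equiv B_{p-2}(a)\pmod p.$$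
   Context: For $n\in\mathbb N=\{0,1,2,\ldots\}$, $H_n^{(2)}=\sum_{0<k\le n}\frac1{k^2}$ is the second-order harmonic number (so $H_0^{(2)}=0$). $B_0,B_1,\ldots$ are the Bernoulli numbers (with $B_1=-\frac12$) and $B_n(x)=\sum_{k=0}^n\binom nkB_kx^{n-k}$ is the Bernoulli polynomial of degree $n$. $E_0,E_1,\ldots$ are the Euler numbers and $E_n(x)=\sum_{k=0}^n\binom nk\frac{E_k}{2^k}\left(x-\frac12\right)^{n-k}$ is the Euler polynomial of degree $n$. $\binom{x}{k}=\frac{x(x-1)\cdots(x-k+1)}{k!}$ is the generalized binomial coefficient. Congruences modulo $p^j$ are in the ring $\mathbb Z_p$ of $p$-adic integers. (Since $H_{(p-1)/2}^{(2)}\equiv0\pmod p$, the number $H_k^{(2)}/(2k+1)$ is a $p$-adic integer for every $k=0,1,\ldots,p-1$.) Empty sums are $0$. -}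

module Defs where

open import Algebra.Bundles using (CommutativeRing; Semiring)
open import Data.Bool.Base using (if_then_else_)
open import Data.Fin.Base using (Fin; toℕ)
open import Data.Fin.Properties using (toℕ<n)
open import Data.Integer.Base as ℤ using (ℤ; +_; 0ℤ; 1ℤ; -1ℤ)
import Data.Integer.Properties as ℤ
open import Data.Nat.Base as ℕ using (ℕ; zero; suc; _∸_; _≤_; _<_; _⊔_; _!; NonZero)
open import Data.Nat.Combinatorics using (_C_)
open import Data.Nat.Divisibility using (_∣_; _∤_; _∣?_; divides; ∣-trans; ∣1⇒≡1; ∣⇒≤; m∣m*n)
open import Data.Nat.Induction using (<-rec; <-wellFounded)
open import Data.Nat.Primality using (Prime; euclidsLemma; ¬prime[1]; prime⇒nonTrivial)
import Data.Nat.Properties as ℕ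
open import Data.Product.Base using (∃; _×_; _,_; proj₁; proj₂)
open import Data.Rational.Base as ℚ using (ℚ; 0ℚ; 1ℚ; _/_; ↥_; ↧_; ↧ₙ_)
import Data.Rational.Properties as ℚ
open import Data.Rational.Solver using (module +-*-Solver)
import Data.Rational.Unnormalised.Base as ℚᵘ
import Data.Rational.Unnormalised.Properties as ℚᵘ
open import Data.Sum.Base using (inj₁; inj₂)
open import Level using (0ℓ)
open import Relation.Binary.PropositionalEquality
open import Relation.Nullary.Decidable using (does; yes; no)
open import Relation.Nullary.Negation.Core using (contradiction)
open import Relation.Unary using (Pred; _∈_)

import Algebra.Definitions.RawSemiring as RawSemiringOps
import Algebra.Properties.CommutativeMonoid.Sum as Sum
import Algebra.Properties.Semiring.Exp as Exp
import Induction.WellFounded as WF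

private
  module ℚ+ = Sum ℚ.+-0-commutativeMonoid
  module ℤ+ = Sum ℤ.+-0-commutativeMonoid
  module ℚ^ = Exp (CommutativeRing.semiring ℚ.+-*-commutativeRing)

-- The sum of f k over 0 < k ≤ n.
sumPos : (n : ℕ) → ((k : ℕ) .{{_ : NonZero k}} → ℚ) → ℚ
sumPos n f = ℚ+.sum {n} (λ i → f (suc (toℕ i)))

1/sq : (k : ℕ) .{{_ : NonZero k}} → ℚ
1/sq k = (1ℤ / k) ℚ.* (1ℤ / k)

H⁽²⁾ : ℕ → ℚ
H⁽²⁾ n = sumPos n 1/sq

-- The sum of c k / k² over 0 < k < m with p ∤ k, for m > 0.
sumPrimeTo : (p m : ℕ) → (ℕ → ℤ) → ℚ
sumPrimeTo p m c = sumPos (m ∸ 1) (λ k → if does (p ∣? k) then 0ℚ else (c k / 1) ℚ.* 1/sq k)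

-- B₀ = 1, and for n ≥ 1 the relation Σ_{k≤n} C(n+1,k) B_k = 0 solved for B_n.
bernoulliStep : ∀ n → (∀ {k} → k < n → ℚ) → ℚ
bernoulliStep zero      B = 1ℚ
bernoulliStep n@(suc _) B =
  ℚ.- ((1ℤ / suc n) ℚ.* ℚ+.sum {n} (λ i → (+ (suc n C toℕ i) / 1) ℚ.* B (toℕ<n i)))

bernoulli : ℕ → ℚ
bernoulli = <-rec (λ _ → ℚ) bernoulliStep

bernoulli-unfold : ∀ n → bernoulli n ≡ bernoulliStep n (λ {k} _ → bernoulli k)
bernoulli-unfold n = unfold-wfRec {n}
  where
  ext : ∀ n {B B′ : ∀ {k} → k < n → ℚ} → (∀ {k} (k<n : k < n) → B k<n ≡ B′ k<n) →
        bernoulliStep n B ≡ bernoulliStep n B′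
  ext zero      B≡B′ = refl
  ext n@(suc _) B≡B′ = cong (λ s → ℚ.- ((1ℤ / suc n) ℚ.* s))
    (ℚ+.sum-cong-≗ {n} (λ i → cong ((+ (suc n C toℕ i) / 1) ℚ.*_) (B≡B′ (toℕ<n i))))
  open WF.FixPoint <-wellFounded (λ _ → ℚ) bernoulliStep ext

-- E₀ = 1, and for n ≥ 1 the relation Σ_{k≤n, 2∣n-k} C(n,k) E_k = 0 solved for E_n.
eulerStep : ∀ n → (∀ {k} → k < n → ℤ) → ℤ
eulerStep zero      E = 1ℤ
eulerStep n@(suc _) E = ℤ.- ℤ+.sum {n} (λ i →
  if does (2 ∣? (n ∸ toℕ i)) then + (n C toℕ i) ℤ.* E (toℕ<n i) else 0ℤ)

euler : ℕ → ℤ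
euler = <-rec (λ _ → ℤ) eulerStep

euler-unfold : ∀ n → euler n ≡ eulerStep n (λ {k} _ → euler k)
euler-unfold n = unfold-wfRec {n}
  where
  ext : ∀ n {E E′ : ∀ {k} → k < n → ℤ} → (∀ {k} (k<n : k < n) → E k<n ≡ E′ k<n) →
        eulerStep n E ≡ eulerStep n E′
  ext zero      E≡E′ = refl
  ext n@(suc _) E≡E′ = cong ℤ.-_ (ℤ+.sum-cong-≗ {n} (λ i →
    cong (λ e → if does (2 ∣? (n ∸ toℕ i)) then + (n C toℕ i) ℤ.* e else 0ℤ) (E≡E′ (toℕ<n i))))
  open WF.FixPoint <-wellFounded (λ _ → ℤ) eulerStep ext

module PAdic (p : ℕ) (pr : Prime p) where

  -- Rationals whose reduced denominator is prime to p, i.e. the local ring ℤ₍ₚ₎.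
  ℤ₍ₚ₎ : Pred ℚ 0ℓ
  ℤ₍ₚ₎ q = p ∤ ↧ₙ q

  p^ : ℕ → ℚ
  p^ n = (+ p / 1) ℚ^.^ n

  -- The fractional ideal pⁿℤ₍ₚ₎, i.e. the ball |q|ₚ ≤ p⁻ⁿ in ℚ.
  Ball : ℕ → Pred ℚ 0ℓ
  Ball n q = ∃ λ z → z ∈ ℤ₍ₚ₎ × q ≡ p^ n ℚ.* z

  ↧∣ : ∀ {q d g} → ↧ q ℤ.* g ≡ + d → ↧ₙ q ∣ d
  ↧∣ {q} {d} {g} eq = subst (↧ₙ q ∣_)
    (trans (sym (ℤ.abs-* (↧ q) g)) (cong ℤ.∣_∣ eq)) (m∣m*n ℤ.∣ g ∣)

  ↧/∣ : ∀ i n .{{_ : NonZero n}} → ↧ₙ (i / n) ∣ n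
  ↧/∣ i n = ↧∣ {i / n} (ℚ.↧-/ i n)

  p∤1 : p ∤ 1
  p∤1 p∣1 = ¬prime[1] (subst Prime (∣1⇒≡1 p∣1) pr)

  p∤* : ∀ {m n} → p ∤ m → p ∤ n → p ∤ m ℕ.* n
  p∤* {m} {n} p∤m p∤n p∣mn with euclidsLemma m n pr p∣mn
  ... | inj₁ p∣m = p∤m p∣m
  ... | inj₂ p∣n = p∤n p∣n

  int-ℤ : ∀ i → (i / 1) ∈ ℤ₍ₚ₎
  int-ℤ i p∣ = p∤1 (∣-trans p∣ (↧/∣ i 1))

  int-+ : ∀ {x y} → x ∈ ℤ₍ₚ₎ → y ∈ ℤ₍ₚ₎ → x ℚ.+ y ∈ ℤ₍ₚ₎
  int-+ {x@record{}} {y@record{}} hx hy p∣ = p∤* hx hy (∣-trans p∣ (↧/∣ (↥ x ℤ.* ↧ y ℤ.+ ↥ y ℤ.* ↧ x) (↧ₙ x ℕ.* ↧ₙ y)))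

  int-* : ∀ {x y} → x ∈ ℤ₍ₚ₎ → y ∈ ℤ₍ₚ₎ → x ℚ.* y ∈ ℤ₍ₚ₎
  int-* {x@record{}} {y@record{}} hx hy p∣ = p∤* hx hy (∣-trans p∣ (↧/∣ (↥ x ℤ.* ↥ y) (↧ₙ x ℕ.* ↧ₙ y)))

  int-neg : ∀ {x} → x ∈ ℤ₍ₚ₎ → ℚ.- x ∈ ℤ₍ₚ₎
  int-neg {x} hx p∣ = hx (subst (p ∣_) (cong ℤ.∣_∣ (ℚ.↧-neg x)) p∣)

  int-p^ : ∀ n → p^ n ∈ ℤ₍ₚ₎
  int-p^ zero    = int-ℤ 1ℤ
  int-p^ (suc n) = int-* {+ p / 1} {p^ n} (int-ℤ (+ p)) (int-p^ n)

  ball-0 : ∀ n → Ball n 0ℚ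
  ball-0 n = 0ℚ , int-ℤ 0ℤ , sym (ℚ.*-zeroʳ (p^ n))

  ball-+ : ∀ n {x y} → Ball n x → Ball n y → Ball n (x ℚ.+ y)
  ball-+ n (z , hz , refl) (w , hw , refl) =
    z ℚ.+ w , int-+ {z} {w} hz hw , sym (ℚ.*-distribˡ-+ (p^ n) z w)

  ball-neg : ∀ n {x} → Ball n x → Ball n (ℚ.- x)
  ball-neg n (z , hz , refl) = ℚ.- z , int-neg {z} hz , ℚ.neg-distribʳ-* (p^ n) z

  ball-int : ∀ {x} → Ball 0 x → x ∈ ℤ₍ₚ₎
  ball-int (z , hz , refl) = subst ℤ₍ₚ₎ (sym (ℚ.*-identityˡ z)) hz

  -- |x| ≤ p⁻⁽ⁿ⁺ᵉ⁾ and |y| ≤ pᵉ give |xy| ≤ p⁻ⁿ.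
  ball-* : ∀ n e {x y} → Ball (n ℕ.+ e) x → p^ e ℚ.* y ∈ ℤ₍ₚ₎ → Ball n (x ℚ.* y)
  ball-* n e {_} {y} (z , hz , refl) hy =
    z ℚ.* (p^ e ℚ.* y) , int-* {z} {p^ e ℚ.* y} hz hy ,
    trans (cong (λ t → t ℚ.* z ℚ.* y) (ℚ^.^-homo-* (+ p / 1) n e))
          (solve 4 (λ a b c d → a :* b :* c :* d := a :* (c :* (b :* d))) refl (p^ n) (p^ e) z y)
    where open +-*-Solver

  ball-*ˡ : ∀ n e {x y} → p^ e ℚ.* x ∈ ℤ₍ₚ₎ → Ball (n ℕ.+ e) y → Ball n (x ℚ.* y)
  ball-*ˡ n e {x} {y} hx hy = subst (Ball n) (ℚ.*-comm y x) (ball-* n e {y} {x} hy hx)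

  p*num/pd : ∀ q d .{{_ : NonZero d}} → ↧ₙ q ≡ d ℕ.* p → (+ p / 1) ℚ.* q ≡ ↥ q / d
  p*num/pd q@record{} d@(suc _) eq = ℚ.toℚᵘ-injective (begin
    ℚ.toℚᵘ ((+ p / 1) ℚ.* q)              ≈⟨ ℚ.toℚᵘ-homo-* (+ p / 1) q ⟩
    ℚ.toℚᵘ (+ p / 1) ℚᵘ.* ℚ.toℚᵘ q        ≈⟨ ℚᵘ.*-cong {u = ℚ.toℚᵘ q} (ℚ.toℚᵘ-fromℚᵘ (ℚᵘ.mkℚᵘ (+ p) 0)) ℚᵘ.≃-refl ⟩
    ℚᵘ.mkℚᵘ (+ p) 0 ℚᵘ.* ℚ.toℚᵘ q         ≈⟨ ℚᵘ.*≡* cross ⟩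
    ℚᵘ.mkℚᵘ (↥ q) (ℕ.pred d)              ≈⟨ ℚᵘ.≃-sym (ℚ.toℚᵘ-fromℚᵘ (ℚᵘ.mkℚᵘ (↥ q) (ℕ.pred d))) ⟩
    ℚ.toℚᵘ (↥ q / d)                      ∎)
    where
    open ℚᵘ.≃-Reasoning
    cross : (+ p ℤ.* ↥ q) ℤ.* + d ≡ ↥ q ℤ.* + (1 ℕ.* ↧ₙ q)
    cross = trans (cong (ℤ._* + d) (ℤ.*-comm (+ p) (↥ q)))
      (trans (ℤ.*-assoc (↥ q) (+ p) (+ d))
      (cong (↥ q ℤ.*_) (trans (sym (ℤ.pos-* p d))
        (cong +_ (trans (ℕ.*-comm p d) (trans (sym eq) (sym (ℕ.*-identityˡ (↧ₙ q)))))))))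

  clear : ∀ d q → ↧ₙ q ≡ d → ∃ λ e → p^ e ℚ.* q ∈ ℤ₍ₚ₎
  clear = <-rec _ step
    where
    step : ∀ d → (∀ {d′} → d′ < d → ∀ q → ↧ₙ q ≡ d′ → ∃ λ e → p^ e ℚ.* q ∈ ℤ₍ₚ₎) →
           ∀ q → ↧ₙ q ≡ d → ∃ λ e → p^ e ℚ.* q ∈ ℤ₍ₚ₎
    step _ rec q@record{} refl with p ∣? ↧ₙ q
    ... | no p∤d = 0 , subst ℤ₍ₚ₎ (sym (ℚ.*-identityˡ q)) p∤d
    ... | yes (divides d@(suc _) eq)
      with e , he ← rec (ℕ.≤-<-trans (∣⇒≤ (↧/∣ (↥ q) d))
                          (subst (d <_) (sym eq)
                            (ℕ.m<m*n d p (ℕ.nonTrivial⇒n>1 p {{prime⇒nonTrivial pr}}))))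
                        (↥ q / d) refl
      = suc e , subst ℤ₍ₚ₎ (begin
          p^ e ℚ.* (↥ q / d)             ≡⟨ cong (p^ e ℚ.*_) (p*num/pd q d eq) ⟨
          p^ e ℚ.* ((+ p / 1) ℚ.* q)     ≡⟨ solve 3 (λ a b c → b :* (a :* c) := a :* b :* c)
                                              refl (+ p / 1) (p^ e) q ⟩
          p^ (suc e) ℚ.* q               ∎) he
      where
      open +-*-Solver
      open ≡-Reasoning

  -- ℚₚ is the completion of ℚ for |·|ₚ: Cauchy sequences of rationals, up to
  -- the equality _≈_ below.
  record ℚₚ : Set where
    constructor mkℚₚ
    field
      seq    : ℕ → ℚ
      cauchy : ∀ n → ∃ λ N → ∀ i j → N ≤ i → N ≤ j → Ball n (seq i ℚ.- seq j)
  open ℚₚ public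

  infix 4 _≈ₚ_
  _≈ₚ_ : ℚₚ → ℚₚ → Set
  x ≈ₚ y = ∀ n → ∃ λ N → ∀ i → N ≤ i → Ball n (seq x i ℚ.- seq y i)

  private
    bounded : ∀ x → ∃ λ e → ∃ λ N → ∀ i → N ≤ i → p^ e ℚ.* seq x i ∈ ℤ₍ₚ₎
    bounded x with N , hN ← cauchy x 0 with e , he ← clear _ (seq x N) refl =
      e , N , λ i N≤i → subst ℤ₍ₚ₎
        (solve 3 (λ a b c → a :* b :+ a :* (c :- b) := a :* c) refl (p^ e) (seq x N) (seq x i))
        (int-+ {p^ e ℚ.* seq x N} {p^ e ℚ.* (seq x i ℚ.- seq x N)} he
          (int-* {p^ e} {seq x i ℚ.- seq x N} (int-p^ e) (ball-int (hN i N N≤i ℕ.≤-refl))))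
      where open +-*-Solver

    ⊔ˡ : ∀ {M N i} → M ⊔ N ≤ i → M ≤ i
    ⊔ˡ {M} {N} = ℕ.m⊔n≤o⇒m≤o M N

    ⊔ʳ : ∀ {M N i} → M ⊔ N ≤ i → N ≤ i
    ⊔ʳ {M} {N} = ℕ.m⊔n≤o⇒n≤o M N

  ι : ℚ → ℚₚ
  ι q = mkℚₚ (λ _ → q) λ n → 0 , λ _ _ _ _ → subst (Ball n) (sym (ℚ.+-inverseʳ q)) (ball-0 n)

  private
    _+ₚ_ : ℚₚ → ℚₚ → ℚₚ
    x +ₚ y = mkℚₚ (λ i → seq x i ℚ.+ seq y i) λ n →
      let M , hM = cauchy x n
          N , hN = cauchy y n
      in M ⊔ N , λ i j hi hj → subst (Ball n)
        (solve 4 (λ a b c d → (a :- b) :+ (c :- d) := (a :+ c) :- (b :+ d)) refl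
          (seq x i) (seq x j) (seq y i) (seq y j))
        (ball-+ n (hM i j (⊔ˡ hi) (⊔ˡ hj)) (hN i j (⊔ʳ {M} hi) (⊔ʳ {M} hj)))
      where open +-*-Solver

    -ₚ_ : ℚₚ → ℚₚ
    -ₚ x = mkℚₚ (λ i → ℚ.- seq x i) λ n →
      let M , hM = cauchy x n
      in M , λ i j hi hj → subst (Ball n)
        (solve 2 (λ a b → :- (a :- b) := (:- a) :- (:- b)) refl (seq x i) (seq x j))
        (ball-neg n (hM i j hi hj))
      where open +-*-Solver

    _*ₚ_ : ℚₚ → ℚₚ → ℚₚ
    x *ₚ y = mkℚₚ (λ i → seq x i ℚ.* seq y i) λ n →
      let e , K , hK = bounded x
          f , L , hL = bounded y
          M , hM = cauchy x (n ℕ.+ f)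
          N , hN = cauchy y (n ℕ.+ e)
      in (K ⊔ L) ⊔ (M ⊔ N) , λ i j hi hj → subst (Ball n)
        (solve 4 (λ a b c d → (a :- b) :* c :+ b :* (c :- d) := a :* c :- b :* d) refl
          (seq x i) (seq x j) (seq y i) (seq y j))
        (ball-+ n
          (ball-* n f (hM i j (⊔ˡ (⊔ʳ {K ⊔ L} hi)) (⊔ˡ (⊔ʳ {K ⊔ L} hj))) (hL i (⊔ʳ {K} (⊔ˡ hi))))
          (ball-*ˡ n e (hK j (⊔ˡ (⊔ˡ hj))) (hN i j (⊔ʳ {M} (⊔ʳ {K ⊔ L} hi)) (⊔ʳ {M} (⊔ʳ {K ⊔ L} hj)))))
      where open +-*-Solver

    ≗⇒≈ : ∀ {x y} → (∀ i → seq x i ≡ seq y i) → x ≈ₚ y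
    ≗⇒≈ {x} {y} eq n = 0 , λ i _ → subst (Ball n)
      (sym (trans (cong (ℚ._- seq y i) (eq i)) (ℚ.+-inverseʳ (seq y i)))) (ball-0 n)

    ≈-sym : ∀ {x y} → x ≈ₚ y → y ≈ₚ x
    ≈-sym {x} {y} x≈y n = let N , hN = x≈y n in N , λ i hi → subst (Ball n)
      (solve 2 (λ a b → :- (a :- b) := b :- a) refl (seq x i) (seq y i)) (ball-neg n (hN i hi))
      where open +-*-Solver

    ≈-trans : ∀ {x y z} → x ≈ₚ y → y ≈ₚ z → x ≈ₚ z
    ≈-trans {x} {y} {z} x≈y y≈z n =
      let M , hM = x≈y n
          N , hN = y≈z n
      in M ⊔ N , λ i hi → subst (Ball n)
        (solve 3 (λ a b c → (a :- b) :+ (b :- c) := a :- c) refl (seq x i) (seq y i) (seq z i))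
        (ball-+ n (hM i (⊔ˡ hi)) (hN i (⊔ʳ {M} hi)))
      where open +-*-Solver

    +-cong : ∀ {x y u v} → x ≈ₚ y → u ≈ₚ v → (x +ₚ u) ≈ₚ (y +ₚ v)
    +-cong {x} {y} {u} {v} x≈y u≈v n =
      let M , hM = x≈y n
          N , hN = u≈v n
      in M ⊔ N , λ i hi → subst (Ball n)
        (solve 4 (λ a b c d → (a :- b) :+ (c :- d) := (a :+ c) :- (b :+ d)) refl
          (seq x i) (seq y i) (seq u i) (seq v i))
        (ball-+ n (hM i (⊔ˡ hi)) (hN i (⊔ʳ {M} hi)))
      where open +-*-Solver

    neg-cong : ∀ {x y} → x ≈ₚ y → (-ₚ x) ≈ₚ (-ₚ y)
    neg-cong {x} {y} x≈y n = let N , hN = x≈y n in N , λ i hi → subst (Ball n)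
      (solve 2 (λ a b → :- (a :- b) := (:- a) :- (:- b)) refl (seq x i) (seq y i))
      (ball-neg n (hN i hi))
      where open +-*-Solver

    *-cong : ∀ {x y u v} → x ≈ₚ y → u ≈ₚ v → (x *ₚ u) ≈ₚ (y *ₚ v)
    *-cong {x} {y} {u} {v} x≈y u≈v n =
      let e , K , hK = bounded y
          f , L , hL = bounded u
          M , hM = x≈y (n ℕ.+ f)
          N , hN = u≈v (n ℕ.+ e)
      in (K ⊔ L) ⊔ (M ⊔ N) , λ i hi → subst (Ball n)
        (solve 4 (λ a b c d → (a :- b) :* c :+ b :* (c :- d) := a :* c :- b :* d) refl
          (seq x i) (seq y i) (seq u i) (seq v i))
        (ball-+ n
          (ball-* n f (hM i (⊔ˡ (⊔ʳ {K ⊔ L} hi))) (hL i (⊔ʳ {K} (⊔ˡ hi))))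
          (ball-*ˡ n e (hK i (⊔ˡ (⊔ˡ hi))) (hN i (⊔ʳ {M} (⊔ʳ {K ⊔ L} hi)))))
      where open +-*-Solver

  ℚₚ-commutativeRing : CommutativeRing 0ℓ 0ℓ
  ℚₚ-commutativeRing = record
    { Carrier = ℚₚ
    ; _≈_     = _≈ₚ_
    ; _+_     = _+ₚ_
    ; _*_     = _*ₚ_
    ; -_      = -ₚ_
    ; 0#      = ι 0ℚ
    ; 1#      = ι 1ℚ
    ; isCommutativeRing = record
      { isRing = record
        { +-isAbelianGroup = record
          { isGroup = record
            { isMonoid = record
              { isSemigroup = record
                { isMagma = record
                  { isEquivalence = record
                    { refl  = λ {x} → ≗⇒≈ {x} {x} (λ _ → refl)
                    ; sym   = λ {x} {y} → ≈-sym {x} {y}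
                    ; trans = λ {x} {y} {z} → ≈-trans {x} {y} {z} }
                  ; ∙-cong = λ {x} {y} {u} {v} → +-cong {x} {y} {u} {v} }
                ; assoc = λ x y z → ≗⇒≈ {(x +ₚ y) +ₚ z} {x +ₚ (y +ₚ z)}
                    (λ i → ℚ.+-assoc (seq x i) (seq y i) (seq z i)) }
              ; identity = (λ x → ≗⇒≈ {ι 0ℚ +ₚ x} {x} (λ i → ℚ.+-identityˡ (seq x i)))
                         , (λ x → ≗⇒≈ {x +ₚ ι 0ℚ} {x} (λ i → ℚ.+-identityʳ (seq x i))) }
            ; inverse = (λ x → ≗⇒≈ {(-ₚ x) +ₚ x} {ι 0ℚ} (λ i → ℚ.+-inverseˡ (seq x i)))
                      , (λ x → ≗⇒≈ {x +ₚ (-ₚ x)} {ι 0ℚ} (λ i → ℚ.+-inverseʳ (seq x i)))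
            ; ⁻¹-cong = λ {x} {y} → neg-cong {x} {y} }
          ; comm = λ x y → ≗⇒≈ {x +ₚ y} {y +ₚ x} (λ i → ℚ.+-comm (seq x i) (seq y i)) }
        ; *-cong = λ {x} {y} {u} {v} → *-cong {x} {y} {u} {v}
        ; *-assoc = λ x y z → ≗⇒≈ {(x *ₚ y) *ₚ z} {x *ₚ (y *ₚ z)}
            (λ i → ℚ.*-assoc (seq x i) (seq y i) (seq z i))
        ; *-identity = (λ x → ≗⇒≈ {ι 1ℚ *ₚ x} {x} (λ i → ℚ.*-identityˡ (seq x i)))
                     , (λ x → ≗⇒≈ {x *ₚ ι 1ℚ} {x} (λ i → ℚ.*-identityʳ (seq x i)))
        ; distrib = (λ x y z → ≗⇒≈ {x *ₚ (y +ₚ z)} {(x *ₚ y) +ₚ (x *ₚ z)}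
                      (λ i → ℚ.*-distribˡ-+ (seq x i) (seq y i) (seq z i)))
                  , (λ x y z → ≗⇒≈ {(y +ₚ z) *ₚ x} {(y *ₚ x) +ₚ (z *ₚ x)}
                      (λ i → ℚ.*-distribʳ-+ (seq x i) (seq y i) (seq z i))) }
      ; *-comm = λ x y → ≗⇒≈ {x *ₚ y} {y *ₚ x} (λ i → ℚ.*-comm (seq x i) (seq y i)) }
    }

  open CommutativeRing ℚₚ-commutativeRing public using (_≈_; _+_; _*_; -_; _-_; 0#; 1#)
  open RawSemiringOps (Semiring.rawSemiring (CommutativeRing.semiring ℚₚ-commutativeRing)) public
    using (sum; product; _^_)

  -- The unit ball |x|ₚ ≤ 1 of ℚₚ.  It is closed, so the bound only has to hold eventually.
  ℤₚ : Pred ℚₚ 0ℓ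
  ℤₚ x = ∃ λ N → ∀ i → N ≤ i → seq x i ∈ ℤ₍ₚ₎

  -- Congruence modulo pⁿ in the ring ℤₚ: both sides are p-adic integers and
  -- their difference lies in the ideal pⁿℤₚ.
  infix 4 _≡_[modp^_]
  _≡_[modp^_] : ℚₚ → ℚₚ → ℕ → Set
  x ≡ y [modp^ n ] = x ∈ ℤₚ × y ∈ ℤₚ × ∃ λ z → z ∈ ℤₚ × x - y ≈ ι (p^ n) * z

  fromℤ : ℤ → ℚₚ
  fromℤ i = ι (i / 1)

  -- x (x - 1) ⋯ (x - k + 1) / k!
  binom : ℚₚ → ℕ → ℚₚ
  binom x k = product {k} (λ i → x - fromℤ (+ toℕ i)) * ι ((1ℤ / k !) {{k ℕ.!≢0}})

  bernoulliPoly : ℕ → ℚₚ → ℚₚ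
  bernoulliPoly n x = sum {suc n} λ i → let k = toℕ i in
    fromℤ (+ (n C k)) * ι (bernoulli k) * x ^ (n ∸ k)

  eulerPoly : ℕ → ℚₚ → ℚₚ
  eulerPoly n x = sum {suc n} λ i → let k = toℕ i in
    fromℤ (+ (n C k)) * ι ((euler k / 2 ℕ.^ k) {{ℕ.m^n≢0 2 k}}) * (x - ι ℚ.½) ^ (n ∸ k)

{-# OPTIONS --safe #-}

-- Write u k a = C(-a,k) C(a-1,k) and G k a = ∏_{0<j≤k} (1 - a²/j²), and let Φ(a) and Ψ(a) be the two sums
-- over k < p, the second one multiplied by 2a - 1.  Since
--   u (k+1) (a+1) + u (k+1) a                   = 2 (G (k+1) a - G k a),
--   (2a+1) u (k+1) (a+1) - (2a-1) u (k+1) a     = 2 (G (k+1) a - G k a) (2k+3),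
-- both Φ(a+1) + Φ(a) and Ψ(a+1) - Ψ(a) equal the sum over k < p-1 of 2 (G (k+1) a - G k a) H⁽²⁾ (k+1).  For
-- integers a this is ≡ 0 mod p² if p ∣ a, and otherwise ≡ -2/a² by Abel summation, because p² ∣ G (p-1) a.
-- Induction on m gives Φ(m) and Ψ(m) as sums over k < m.  With n + 2 = φ(pˢ), 1/k² may be replaced
-- by kⁿ modulo pˢ, and the sums become values of the Euler polynomial of degree n and the Bernoulli polynomial of
-- degree n+1.  All sides are p-adically continuous in a, so the integers a > 0 suffice.

module Submission where

open import Algebra.Bundles using (CommutativeRing)
open import Data.Bool.Base using (if_then_else_; true; false)
open import Data.Fin.Base using (Fin; toℕ; zero; suc)
open import Data.Integer.Base as ℤ using (ℤ; +_; -[1+_]; 0ℤ; 1ℤ; -1ℤ)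
import Data.Integer.Properties as ℤ
open import Data.Nat.Base as ℕ using (ℕ; zero; suc; _∸_; _<_; _≤_; _⊔_; _!; NonZero)
open import Data.Nat.Combinatorics
  using (_C_; nC1≡n; nCn≡1; k>n⇒nCk≡0; nCk≡nC[n∸k]; nCk≡n!/k![n-k]!; k![n∸k]!∣n!; nCk+nC[k+1]≡[n+1]C[k+1])
open import Data.Nat.Divisibility
import Data.Nat.DivMod as ℕ
open import Data.Nat.Induction using (<-rec)
open import Data.Nat.Primality using (Prime; prime⇒nonTrivial; prime⇒nonZero; prime⇒irreducible; euclidsLemma)
import Data.Nat.Properties as ℕ
open import Data.Product.Base using (∃; _×_; _,_; proj₁; proj₂)
open import Data.Rational.Base as ℚ using (ℚ; 0ℚ; 1ℚ; ½; _/_; ↥_; ↧ₙ_)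
import Data.Rational.Properties as ℚ
open import Data.Rational.Solver using (module +-*-Solver)
import Data.Rational.Unnormalised.Base as ℚᵘ
import Data.Rational.Unnormalised.Properties as ℚᵘ
open import Data.Sum.Base using (_⊎_; inj₁; inj₂)
open import Function.Base using (_∘_)
open import Level using (0ℓ)
open import Relation.Binary.Bundles using (Setoid)
open import Relation.Binary.Definitions using (tri<; tri≈; tri>)
open import Relation.Binary.PropositionalEquality
open import Relation.Nullary.Decidable using (does; toSum; yes; no; dec-true; dec-false)
open import Relation.Nullary.Negation.Core using (contradiction)
open import Relation.Unary using (_∈_)
import Algebra.Properties.CommutativeMonoid.Sum as Sum
import Algebra.Properties.Semiring.Exp as Exp
import Relation.Binary.Reasoning.Setoid as SetoidReasoning
open import Defs

-- The operations of ℚₚ act termwise on sequences, so at index i the two sums are `Φ p` and `Ψ p`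
-- evaluated at the rational `seq a i`. All congruences are therefore proved for p-integral
-- rationals and hold for all late i. The weight 2a - 1 is chosen for the difference equation: the
-- factor 2k + 3 that it produces is the denominator belonging to `H⁽²⁾ (suc k)`, so both sums have
-- the same increment `ΔΦ`. A difference equation needs a start value. At a = 1 both sums vanish
-- because C(0,k) = 0 for k > 0, and the polynomials vanish because n is even and positive. Two
-- denominators obstruct continuity in a. The one with 2k + 1 = p is cancelled by `H⁽²⁾ k`, which is
-- divisible by p there. The coefficients of the Bernoulli polynomial may contain 1/p, so a fixed
-- power of p is lost and the approximating integer has to be taken correspondingly closer. The step
-- of the Bernoulli polynomial carries the factor n + 1 and that of `Ψ` the factor -2, so its
-- coefficient is c with c (n + 1) ≡ -2: this is 1 modulo p for n + 1 = p - 2, and 2 - 2p modulo p²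
-- for n + 1 = p² - p - 1.

module Rationals where

  open import Data.Rational.Base using (_+_; _*_; -_; _-_)
  open Exp (CommutativeRing.semiring ℚ.+-*-commutativeRing) public using (_^_; ^-homo-*; ^-assocʳ)
  open Sum ℚ.+-0-commutativeMonoid public using (sum)
  open +-*-Solver
  module ℤ+ = Sum ℤ.+-0-commutativeMonoid
  module ℚ* = Sum ℚ.*-1-commutativeMonoid

  -- Finite sums and arithmetic of rational numbers

  Σ< : ℕ → (ℕ → ℚ) → ℚ
  Σ< n f = sum {n} (f ∘ toℕ)

  Σ<-cong : ∀ n {f g} → (∀ k → k < n → f k ≡ g k) → Σ< n f ≡ Σ< n g
  Σ<-cong zero    h = refl
  Σ<-cong (suc n) h = cong₂ _+_ (h 0 ℕ.z<s) (Σ<-cong n (λ k k<n → h (suc k) (ℕ.s<s k<n)))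

  Σ<-snoc : ∀ n f → Σ< (suc n) f ≡ Σ< n f + f n
  Σ<-snoc zero    f = trans (ℚ.+-identityʳ (f 0)) (sym (ℚ.+-identityˡ (f 0)))
  Σ<-snoc (suc n) f = trans (cong (λ z → f 0 + z) (Σ<-snoc n (f ∘ suc)))
                            (sym (ℚ.+-assoc (f 0) (Σ< n (f ∘ suc)) (f (suc n))))

  Σ<-+ : ∀ n f g → Σ< n (λ k → f k + g k) ≡ Σ< n f + Σ< n g
  Σ<-+ zero    f g = refl
  Σ<-+ (suc n) f g = trans (cong (λ z → f 0 + g 0 + z) (Σ<-+ n (f ∘ suc) (g ∘ suc)))
    (solve 4 (λ a b c d → (a :+ b) :+ (c :+ d) := (a :+ c) :+ (b :+ d)) refl
      (f 0) (g 0) (Σ< n (f ∘ suc)) (Σ< n (g ∘ suc)))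

  Σ<-*ˡ : ∀ c n f → Σ< n (λ k → c * f k) ≡ c * Σ< n f
  Σ<-*ˡ c zero    f = sym (ℚ.*-zeroʳ c)
  Σ<-*ˡ c (suc n) f = trans (cong (λ z → c * f 0 + z) (Σ<-*ˡ c n (f ∘ suc))) (sym (ℚ.*-distribˡ-+ c (f 0) _))

  Σ<-reverse : ∀ n f → Σ< n (λ k → f (n ∸ suc k)) ≡ Σ< n f
  Σ<-reverse zero    f = refl
  Σ<-reverse (suc n) f = trans (cong (λ z → f n + z) (Σ<-reverse n f))
    (trans (ℚ.+-comm (f n) _) (sym (Σ<-snoc n f)))

  Σ<-++ : ∀ m n f → Σ< (m ℕ.+ n) f ≡ Σ< m f + Σ< n (λ k → f (m ℕ.+ k))
  Σ<-++ zero    n f = sym (ℚ.+-identityˡ _)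
  Σ<-++ (suc m) n f = trans (cong (λ z → f 0 + z) (Σ<-++ m n (f ∘ suc))) (sym (ℚ.+-assoc (f 0) _ _))

  toℚᵘ-/1 : ∀ i → ℚ.toℚᵘ (i / 1) ℚᵘ.≃ ℚᵘ.mkℚᵘ i 0
  toℚᵘ-/1 i = ℚ.toℚᵘ-fromℚᵘ (ℚᵘ.mkℚᵘ i 0)

  /1-+ : ∀ i j → (i ℤ.+ j) / 1 ≡ i / 1 + j / 1
  /1-+ i j = ℚ.toℚᵘ-injective (begin
    ℚ.toℚᵘ ((i ℤ.+ j) / 1)                   ≈⟨ toℚᵘ-/1 (i ℤ.+ j) ⟩
    ℚᵘ.mkℚᵘ (i ℤ.+ j) 0
      ≈⟨ ℚᵘ.*≡* (cong (ℤ._* 1ℤ) (sym (cong₂ ℤ._+_ (ℤ.*-identityʳ i) (ℤ.*-identityʳ j)))) ⟩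
    ℚᵘ.mkℚᵘ i 0 ℚᵘ.+ ℚᵘ.mkℚᵘ j 0             ≈⟨ ℚᵘ.+-cong (toℚᵘ-/1 i) (toℚᵘ-/1 j) ⟨
    ℚ.toℚᵘ (i / 1) ℚᵘ.+ ℚ.toℚᵘ (j / 1)       ≈⟨ ℚ.toℚᵘ-homo-+ (i / 1) (j / 1) ⟨
    ℚ.toℚᵘ (i / 1 + j / 1)                   ∎)
    where open ℚᵘ.≃-Reasoning

  /1-* : ∀ i j → (i ℤ.* j) / 1 ≡ (i / 1) * (j / 1)
  /1-* i j = ℚ.toℚᵘ-injective (begin
    ℚ.toℚᵘ ((i ℤ.* j) / 1)                   ≈⟨ toℚᵘ-/1 (i ℤ.* j) ⟩
    ℚᵘ.mkℚᵘ i 0 ℚᵘ.* ℚᵘ.mkℚᵘ j 0             ≈⟨ ℚᵘ.*-cong (toℚᵘ-/1 i) (toℚᵘ-/1 j) ⟨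
    ℚ.toℚᵘ (i / 1) ℚᵘ.* ℚ.toℚᵘ (j / 1)       ≈⟨ ℚ.toℚᵘ-homo-* (i / 1) (j / 1) ⟨
    ℚ.toℚᵘ ((i / 1) * (j / 1))               ∎)
    where open ℚᵘ.≃-Reasoning

  /1-neg : ∀ i → (ℤ.- i) / 1 ≡ - (i / 1)
  /1-neg i = trans (solve 2 (λ x y → y := (x :+ y) :- x) refl (i / 1) ((ℤ.- i) / 1))
    (trans (cong (_- (i / 1)) (trans (sym (/1-+ i (ℤ.- i))) (cong (_/ 1) (ℤ.+-inverseʳ i))))
           (ℚ.+-identityˡ _))

  /-*-cancel : ∀ i n .{{_ : NonZero n}} → (i / n) * (+ n / 1) ≡ i / 1
  /-*-cancel i n@(suc n-1) = ℚ.toℚᵘ-injective (begin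
    ℚ.toℚᵘ ((i / n) * (+ n / 1))             ≈⟨ ℚ.toℚᵘ-homo-* (i / n) (+ n / 1) ⟩
    ℚ.toℚᵘ (i / n) ℚᵘ.* ℚ.toℚᵘ (+ n / 1)     ≈⟨ ℚᵘ.*-cong (ℚ.toℚᵘ-fromℚᵘ (ℚᵘ.mkℚᵘ i n-1)) (toℚᵘ-/1 (+ n)) ⟩
    ℚᵘ.mkℚᵘ i n-1 ℚᵘ.* ℚᵘ.mkℚᵘ (+ n) 0
      ≈⟨ ℚᵘ.*≡* (trans (ℤ.*-identityʳ _) (cong (λ k → i ℤ.* + k) (sym (ℕ.*-identityʳ n)))) ⟩
    ℚᵘ.mkℚᵘ i 0                              ≈⟨ toℚᵘ-/1 i ⟨
    ℚ.toℚᵘ (i / 1)                           ∎)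
    where open ℚᵘ.≃-Reasoning

  nat : ℕ → ℚ
  nat n = + n / 1

  nat-+ : ∀ m n → nat (m ℕ.+ n) ≡ nat m + nat n
  nat-+ m n = /1-+ (+ m) (+ n)

  nat-* : ∀ m n → nat (m ℕ.* n) ≡ nat m * nat n
  nat-* m n = trans (cong (_/ 1) (ℤ.pos-* m n)) (/1-* (+ m) (+ n))

  nat-suc : ∀ n → nat (suc n) ≡ nat n + 1ℚ
  nat-suc n = trans (nat-+ 1 n) (ℚ.+-comm 1ℚ (nat n))

  nat-∸ : ∀ {m n} → n ≤ m → nat (m ∸ n) ≡ nat m - nat n
  nat-∸ {m} {n} n≤m = trans (solve 2 (λ x y → x := (x :+ y) :- y) refl (nat (m ∸ n)) (nat n))
    (cong (_- nat n) (trans (sym (nat-+ (m ∸ n) n)) (cong nat (ℕ.m∸n+n≡m n≤m))))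

  nat-^ : ∀ m n → nat (m ℕ.^ n) ≡ nat m ^ n
  nat-^ m zero    = refl
  nat-^ m (suc n) = trans (nat-* m (m ℕ.^ n)) (cong (nat m *_) (nat-^ m n))

  inv : ∀ k .{{_ : NonZero k}} → ℚ
  inv k = 1ℤ / k

  inv-* : ∀ k .{{_ : NonZero k}} → inv k * nat k ≡ 1ℚ
  inv-* k = /-*-cancel 1ℤ k

  nat-cancelˡ : ∀ k .{{_ : NonZero k}} {x y} → nat k * x ≡ nat k * y → x ≡ y
  nat-cancelˡ k {x} {y} eq = begin
    x                    ≡⟨ ℚ.*-identityˡ x ⟨
    1ℚ * x               ≡⟨ cong (_* x) (inv-* k) ⟨
    inv k * nat k * x    ≡⟨ ℚ.*-assoc (inv k) (nat k) x ⟩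
    inv k * (nat k * x)  ≡⟨ cong (inv k *_) eq ⟩
    inv k * (nat k * y)  ≡⟨ ℚ.*-assoc (inv k) (nat k) y ⟨
    inv k * nat k * y    ≡⟨ cong (_* y) (inv-* k) ⟩
    1ℚ * y               ≡⟨ ℚ.*-identityˡ y ⟩
    y                    ∎
    where open ≡-Reasoning

  1^ : ∀ n → 1ℚ ^ n ≡ 1ℚ
  1^ zero    = refl
  1^ (suc n) = trans (ℚ.*-identityˡ _) (1^ n)

  ^-distrib-* : ∀ x y n → (x * y) ^ n ≡ x ^ n * y ^ n
  ^-distrib-* x y zero    = refl
  ^-distrib-* x y (suc n) = trans (cong (x * y *_) (^-distrib-* x y n))
    (solve 4 (λ a b c d → (a :* b) :* (c :* d) := (a :* c) :* (b :* d)) refl x y (x ^ n) (y ^ n))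

  -- Binomial convolution

  -- (f ⋆ g) n = Σ C(n,k) f k g (n-k), defined through the Leibniz rule for the shift of sequences, which
  -- makes associativity a plain induction.

  infixl 7 _⋆_
  infixl 6 _⊕_

  _⋆_ : (ℕ → ℚ) → (ℕ → ℚ) → ℕ → ℚ
  (f ⋆ g) zero    = f 0 * g 0
  (f ⋆ g) (suc n) = (f ∘ suc ⋆ g) n + (f ⋆ g ∘ suc) n

  _⊕_ : (ℕ → ℚ) → (ℕ → ℚ) → ℕ → ℚ
  (f ⊕ g) n = f n + g n

  -- The sequences with exponential generating functions 1 and t. In this dictionary `⋆` is the
  -- product and `x ^_` is exp(xt).
  δ₀ δ₁ : ℕ → ℚ
  δ₀ zero    = 1ℚ
  δ₀ (suc _) = 0ℚ
  δ₁ zero    = 0ℚ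
  δ₁ (suc n) = δ₀ n

  ⋆-cong : ∀ {f f′ g g′} → f ≗ f′ → g ≗ g′ → f ⋆ g ≗ f′ ⋆ g′
  ⋆-cong p q zero    = cong₂ _*_ (p 0) (q 0)
  ⋆-cong p q (suc n) = cong₂ _+_ (⋆-cong (p ∘ suc) q n) (⋆-cong p (q ∘ suc) n)

  ⋆-comm : ∀ f g → f ⋆ g ≗ g ⋆ f
  ⋆-comm f g zero    = ℚ.*-comm (f 0) (g 0)
  ⋆-comm f g (suc n) = trans (cong₂ _+_ (⋆-comm (f ∘ suc) g n) (⋆-comm f (g ∘ suc) n))
    (ℚ.+-comm ((g ⋆ f ∘ suc) n) ((g ∘ suc ⋆ f) n))

  ⋆-distribʳ : ∀ h f g → (f ⊕ g) ⋆ h ≗ (f ⋆ h) ⊕ (g ⋆ h)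
  ⋆-distribʳ h f g zero    = ℚ.*-distribʳ-+ (h 0) (f 0) (g 0)
  ⋆-distribʳ h f g (suc n) = trans
    (cong₂ _+_ (⋆-distribʳ h (f ∘ suc) (g ∘ suc) n) (⋆-distribʳ (h ∘ suc) f g n))
    (solve 4 (λ a b c d → (a :+ b) :+ (c :+ d) := (a :+ c) :+ (b :+ d)) refl
      ((f ∘ suc ⋆ h) n) ((g ∘ suc ⋆ h) n) ((f ⋆ h ∘ suc) n) ((g ⋆ h ∘ suc) n))

  ⋆-distribˡ : ∀ h f g → h ⋆ (f ⊕ g) ≗ (h ⋆ f) ⊕ (h ⋆ g)
  ⋆-distribˡ h f g n = trans (⋆-comm h (f ⊕ g) n)
    (trans (⋆-distribʳ h f g n) (cong₂ _+_ (⋆-comm f h n) (⋆-comm g h n)))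

  ⋆-assoc : ∀ f g h → (f ⋆ g) ⋆ h ≗ f ⋆ (g ⋆ h)
  ⋆-assoc f g h zero    = ℚ.*-assoc (f 0) (g 0) (h 0)
  ⋆-assoc f g h (suc n) = begin
    (((f ∘ suc ⋆ g) ⊕ (f ⋆ g ∘ suc)) ⋆ h) n + ((f ⋆ g) ⋆ h ∘ suc) n
      ≡⟨ cong₂ _+_ (⋆-distribʳ h (f ∘ suc ⋆ g) (f ⋆ g ∘ suc) n) (⋆-assoc f g (h ∘ suc) n) ⟩
    (((f ∘ suc ⋆ g) ⋆ h) n + ((f ⋆ g ∘ suc) ⋆ h) n) + (f ⋆ (g ⋆ h ∘ suc)) n
      ≡⟨ cong (_+ (f ⋆ (g ⋆ h ∘ suc)) n) (cong₂ _+_ (⋆-assoc (f ∘ suc) g h n) (⋆-assoc f (g ∘ suc) h n)) ⟩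
    ((f ∘ suc ⋆ (g ⋆ h)) n + (f ⋆ (g ∘ suc ⋆ h)) n) + (f ⋆ (g ⋆ h ∘ suc)) n
      ≡⟨ ℚ.+-assoc ((f ∘ suc ⋆ (g ⋆ h)) n) ((f ⋆ (g ∘ suc ⋆ h)) n) ((f ⋆ (g ⋆ h ∘ suc)) n) ⟩
    (f ∘ suc ⋆ (g ⋆ h)) n + ((f ⋆ (g ∘ suc ⋆ h)) n + (f ⋆ (g ⋆ h ∘ suc)) n)
      ≡⟨ cong (λ z → (f ∘ suc ⋆ (g ⋆ h)) n + z) (⋆-distribˡ f (g ∘ suc ⋆ h) (g ⋆ h ∘ suc) n) ⟨
    (f ∘ suc ⋆ (g ⋆ h)) n + (f ⋆ ((g ∘ suc ⋆ h) ⊕ (g ⋆ h ∘ suc))) n ∎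
    where open ≡-Reasoning

  ⋆-scaleˡ : ∀ c f g → (λ n → c * f n) ⋆ g ≗ (λ n → c * (f ⋆ g) n)
  ⋆-scaleˡ c f g zero    = ℚ.*-assoc c (f 0) (g 0)
  ⋆-scaleˡ c f g (suc n) = trans (cong₂ _+_ (⋆-scaleˡ c (f ∘ suc) g n) (⋆-scaleˡ c f (g ∘ suc) n))
    (sym (ℚ.*-distribˡ-+ c _ _))

  ⋆-scaleʳ : ∀ c f g → f ⋆ (λ n → c * g n) ≗ (λ n → c * (f ⋆ g) n)
  ⋆-scaleʳ c f g n = trans (⋆-comm f _ n) (trans (⋆-scaleˡ c g f n) (cong (c *_) (⋆-comm g f n)))

  -- The substitution t ↦ ct respects products of generating functions.
  ⋆-twist : ∀ c f g n → ((λ k → c ^ k * f k) ⋆ (λ k → c ^ k * g k)) n ≡ c ^ n * (f ⋆ g) n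
  ⋆-twist c f g zero    = solve 2 (λ a b → con 1ℚ :* a :* (con 1ℚ :* b) := con 1ℚ :* (a :* b)) refl (f 0) (g 0)
  ⋆-twist c f g (suc n) = begin
    ((λ k → c * c ^ k * f (suc k)) ⋆ (λ k → c ^ k * g k)) n + ((λ k → c ^ k * f k) ⋆ (λ k → c * c ^ k * g (suc k))) n
      ≡⟨ cong₂ _+_ (⋆-cong (λ k → ℚ.*-assoc c (c ^ k) (f (suc k))) (λ _ → refl) n)
                   (⋆-cong {f = λ k → c ^ k * f k} (λ _ → refl) (λ k → ℚ.*-assoc c (c ^ k) (g (suc k))) n) ⟩
    ((λ k → c * (c ^ k * f (suc k))) ⋆ (λ k → c ^ k * g k)) n + ((λ k → c ^ k * f k) ⋆
        (λ k → c * (c ^ k * g (suc k)))) n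
      ≡⟨ cong₂ _+_ (⋆-scaleˡ c (λ k → c ^ k * f (suc k)) (λ k → c ^ k * g k) n)
                   (⋆-scaleʳ c (λ k → c ^ k * f k) (λ k → c ^ k * g (suc k)) n) ⟩
    c * ((λ k → c ^ k * f (suc k)) ⋆ (λ k → c ^ k * g k)) n + c * ((λ k → c ^ k * f k) ⋆ (λ k → c ^ k * g (suc k))) n
      ≡⟨ cong₂ (λ x y → c * x + c * y) (⋆-twist c (f ∘ suc) g n) (⋆-twist c f (g ∘ suc) n) ⟩
    c * (c ^ n * (f ∘ suc ⋆ g) n) + c * (c ^ n * (f ⋆ g ∘ suc) n)
      ≡⟨ solve 4 (λ x y a b → x :* (y :* a) :+ x :* (y :* b) := x :* y :* (a :+ b)) refl
           c (c ^ n) ((f ∘ suc ⋆ g) n) ((f ⋆ g ∘ suc) n) ⟩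
    c * c ^ n * ((f ∘ suc ⋆ g) n + (f ⋆ g ∘ suc) n) ∎
    where open ≡-Reasoning

  ⋆-vanishing : ∀ n {f} → (∀ k → k < n → f k ≡ 0ℚ) → ∀ g → (f ⋆ g) n ≡ f n * g 0
  ⋆-vanishing zero    h g = refl
  ⋆-vanishing (suc n) {f} h g = begin
    (f ∘ suc ⋆ g) n + (f ⋆ g ∘ suc) n
      ≡⟨ cong₂ _+_ (⋆-vanishing n (λ k k<n → h (suc k) (ℕ.s<s k<n)) g)
                   (⋆-vanishing n (λ k k<n → h k (ℕ.m<n⇒m<1+n k<n)) (g ∘ suc)) ⟩
    f (suc n) * g 0 + f n * g 1  ≡⟨ cong (λ z → f (suc n) * g 0 + z * g 1) (h n (ℕ.n<1+n n)) ⟩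
    f (suc n) * g 0 + 0ℚ * g 1   ≡⟨ solve 2 (λ a b → a :+ con 0ℚ :* b := a) refl (f (suc n) * g 0) (g 1) ⟩
    f (suc n) * g 0              ∎
    where open ≡-Reasoning

  -- Only the indices n and n+1 of `f` survive, with coefficients C(n+1,n) = n+1 and 1. It is used
  -- where the information about `f n` sits one degree higher, as in an equation f · (exp(t) - 1) =
  -- 0.
  ⋆-vanishing-suc : ∀ n {f} → (∀ k → k < n → f k ≡ 0ℚ) → ∀ g →
                    (f ⋆ g) (suc n) ≡ nat (suc n) * (f n * g 1) + f (suc n) * g 0
  ⋆-vanishing-suc zero    {f} h g = solve 2 (λ a b → a :+ b := con 1ℚ :* b :+ a) refl (f 1 * g 0) (f 0 * g 1)
  ⋆-vanishing-suc (suc n) {f} h g = begin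
    (f ∘ suc ⋆ g) (suc n) + (f ⋆ g ∘ suc) (suc n)
      ≡⟨ cong₂ _+_ (⋆-vanishing-suc n (λ k k<n → h (suc k) (ℕ.s<s k<n)) g) (⋆-vanishing (suc n) h (g ∘ suc)) ⟩
    nat (suc n) * (f (suc n) * g 1) + f (2 ℕ.+ n) * g 0 + f (suc n) * g 1
      ≡⟨ solve 3 (λ a b c → a :* b :+ c :+ b := (a :+ con 1ℚ) :* b :+ c) refl
           (nat (suc n)) (f (suc n) * g 1) (f (2 ℕ.+ n) * g 0) ⟩
    (nat (suc n) + 1ℚ) * (f (suc n) * g 1) + f (2 ℕ.+ n) * g 0
      ≡⟨ cong (λ z → z * (f (suc n) * g 1) + f (2 ℕ.+ n) * g 0) (nat-suc (suc n)) ⟨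
    nat (2 ℕ.+ n) * (f (suc n) * g 1) + f (2 ℕ.+ n) * g 0 ∎
    where open ≡-Reasoning

  ⋆-zeroˡ : ∀ g → (λ _ → 0ℚ) ⋆ g ≗ (λ _ → 0ℚ)
  ⋆-zeroˡ g n = trans (⋆-vanishing n (λ _ _ → refl) g) (ℚ.*-zeroˡ (g 0))

  ⋆-identityˡ : ∀ g → δ₀ ⋆ g ≗ g
  ⋆-identityˡ g zero    = ℚ.*-identityˡ (g 0)
  ⋆-identityˡ g (suc n) = trans (cong₂ _+_ (⋆-zeroˡ g n) (⋆-identityˡ (g ∘ suc) n)) (ℚ.+-identityˡ (g (suc n)))

  ⋆-identityʳ : ∀ f → f ⋆ δ₀ ≗ f
  ⋆-identityʳ f n = trans (⋆-comm f δ₀ n) (⋆-identityˡ f n)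

  δ₁-⋆ : ∀ g n → (δ₁ ⋆ g) (suc n) ≡ nat (suc n) * g n
  δ₁-⋆ g zero    = solve 2 (λ a b → con 1ℚ :* a :+ con 0ℚ :* b := con 1ℚ :* a) refl (g 0) (g 1)
  δ₁-⋆ g (suc n) = begin
    (δ₀ ⋆ g) (suc n) + (δ₁ ⋆ g ∘ suc) (suc n)  ≡⟨ cong₂ _+_ (⋆-identityˡ g (suc n)) (δ₁-⋆ (g ∘ suc) n) ⟩
    g (suc n) + nat (suc n) * g (suc n)
      ≡⟨ solve 2 (λ a b → a :+ b :* a := (b :+ con 1ℚ) :* a) refl (g (suc n)) (nat (suc n)) ⟩
    (nat (suc n) + 1ℚ) * g (suc n)             ≡⟨ cong (_* g (suc n)) (nat-suc (suc n)) ⟨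
    nat (2 ℕ.+ n) * g (suc n)                  ∎
    where open ≡-Reasoning

  -- The binomial theorem as exp(xt) exp(yt) = exp((x+y)t). The Leibniz form of `⋆` reproduces
  -- itself, so no coefficient has to be handled.
  ^-⋆ : ∀ x y → (x ^_) ⋆ (y ^_) ≗ ((x + y) ^_)
  ^-⋆ x y zero    = refl
  ^-⋆ x y (suc n) = begin
    ((λ k → x * x ^ k) ⋆ (y ^_)) n + ((x ^_) ⋆ (λ k → y * y ^ k)) n
      ≡⟨ cong₂ _+_ (⋆-scaleˡ x (x ^_) (y ^_) n) (⋆-scaleʳ y (x ^_) (y ^_) n) ⟩
    x * ((x ^_) ⋆ (y ^_)) n + y * ((x ^_) ⋆ (y ^_)) n
      ≡⟨ ℚ.*-distribʳ-+ (((x ^_) ⋆ (y ^_)) n) x y ⟨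
    (x + y) * ((x ^_) ⋆ (y ^_)) n
      ≡⟨ cong ((x + y) *_) (^-⋆ x y n) ⟩
    (x + y) * (x + y) ^ n ∎
    where open ≡-Reasoning

  0^ : (0ℚ ^_) ≗ δ₀
  0^ zero    = refl
  0^ (suc n) = ℚ.*-zeroˡ (0ℚ ^ n)

  nC0≡1 : ∀ n → n C 0 ≡ 1
  nC0≡1 n = trans (nCk≡nC[n∸k] {0} {n} ℕ.z≤n) (nCn≡1 n)

  -- Pascal's rule is the Leibniz rule. This links `⋆` to the explicit sums by which Bernoulli and
  -- Euler numbers and polynomials are defined.
  ⋆-binomial : ∀ f g n → (f ⋆ g) n ≡ Σ< (suc n) (λ k → nat (n C k) * (f k * g (n ∸ k)))
  ⋆-binomial f g zero    = solve 1 (λ a → a := con 1ℚ :* a :+ con 0ℚ) refl (f 0 * g 0)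
  ⋆-binomial f g (suc n) = begin
    (f ∘ suc ⋆ g) n + (f ⋆ g ∘ suc) n
      ≡⟨ cong₂ _+_ (⋆-binomial (f ∘ suc) g n) (⋆-binomial f (g ∘ suc) n) ⟩
    S + Σ< (suc n) (λ k → nat (n C k) * (f k * g (suc (n ∸ k))))
      ≡⟨ cong (λ z → S + z) (Σ<-cong (suc n) {λ k → nat (n C k) * (f k * g (suc (n ∸ k)))} {R}
           (λ k k≤n → cong (λ j → nat (n C k) * (f k * g j)) (sym (ℕ.+-∸-assoc 1 (ℕ.s≤s⁻¹ k≤n))))) ⟩
    S + Σ< (suc n) R
      ≡⟨ cong (λ z → S + z) (ℚ.+-identityʳ (Σ< (suc n) R)) ⟨
    S + (Σ< (suc n) R + 0ℚ)
      -- The extra term has coefficient C(n,n+1) = 0. It completes the range so that the sum can be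
      -- peeled at k = 0 and aligned with `S`.
      ≡⟨ cong (λ z → S + (Σ< (suc n) R + z)) (trans (cong (λ c → nat c * (f (suc n) * g (n ∸ n)))
           (k>n⇒nCk≡0 (ℕ.n<1+n n))) (ℚ.*-zeroˡ (f (suc n) * g (n ∸ n)))) ⟨
    S + (Σ< (suc n) R + R (suc n))
      ≡⟨ cong (λ z → S + z) (Σ<-snoc (suc n) R) ⟨
    S + (R 0 + Σ< (suc n) (R ∘ suc))
      ≡⟨ solve 3 (λ a b c → a :+ (b :+ c) := b :+ (a :+ c)) refl S (R 0) (Σ< (suc n) (R ∘ suc)) ⟩
    R 0 + (S + Σ< (suc n) (R ∘ suc))
      ≡⟨ cong₂ _+_ (cong (λ c → nat c * (f 0 * g (suc n))) (trans (nC0≡1 n) (sym (nC0≡1 (suc n)))))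
           (trans (sym (Σ<-+ (suc n) L (R ∘ suc))) (Σ<-cong (suc n) {λ k → L k + R (suc k)} (λ k _ → pascal k))) ⟩
    nat (suc n C 0) * (f 0 * g (suc n)) + Σ< (suc n) (λ k → nat (suc n C suc k) * (f (suc k) * g (n ∸ k))) ∎
    where
    open ≡-Reasoning
    L R : ℕ → ℚ
    R k = nat (n C k) * (f k * g (suc n ∸ k))
    L k = nat (n C k) * (f (suc k) * g (n ∸ k))
    S = Σ< (suc n) L
    pascal : ∀ k → nat (n C k) * (f (suc k) * g (n ∸ k)) + R (suc k) ≡ nat (suc n C suc k) * (f (suc k) * g (n ∸ k))
    pascal k = trans (sym (ℚ.*-distribʳ-+ (f (suc k) * g (n ∸ k)) (nat (n C k)) (nat (n C suc k))))
      (cong (_* (f (suc k) * g (n ∸ k)))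
        (trans (sym (nat-+ (n C k) (n C suc k))) (cong nat (nCk+nC[k+1]≡[n+1]C[k+1] n k))))

  -- Bernoulli and Euler polynomials

  2ℚ : ℚ
  2ℚ = nat 2

  vanishes : ∀ (d : ℕ → ℚ) → (∀ n → (∀ k → k < n → d k ≡ 0ℚ) → d n ≡ 0ℚ) → ∀ n → d n ≡ 0ℚ
  vanishes d step = <-rec (λ n → d n ≡ 0ℚ) (λ n rec → step n (λ k k<n → rec k<n))

  -- With B(t) the generating function of the Bernoulli numbers, this is B(t) exp(t) = B(t) + t. In
  -- degree N ≥ 2 the recursion that defines `bernoulli (N - 1)` makes all terms below the top one
  -- cancel; degree 1 is the exception and gives t.
  bernoulli-⋆ : ∀ n → (bernoulli ⋆ (1ℚ ^_)) n ≡ bernoulli n + δ₁ n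
  bernoulli-⋆ zero = solve 1 (λ b → b :* con 1ℚ := b :+ con 0ℚ) refl (bernoulli 0)
  bernoulli-⋆ (suc zero) = trans
    (cong (λ b → bernoulli 1 * 1ℚ + b * (1ℚ * 1ℚ)) (bernoulli-unfold 0))
    (solve 1 (λ b → b :* con 1ℚ :+ con 1ℚ :* (con 1ℚ :* con 1ℚ) := b :+ con 1ℚ) refl (bernoulli 1))
  bernoulli-⋆ (suc (suc n)) = begin
    (bernoulli ⋆ (1ℚ ^_)) N
      ≡⟨ ⋆-binomial bernoulli (1ℚ ^_) N ⟩
    Σ< (suc N) (λ k → nat (N C k) * (bernoulli k * 1ℚ ^ (N ∸ k)))
      ≡⟨ Σ<-cong (suc N) {g = T}
           (λ k _ → cong (nat (N C k) *_)
               (trans (cong (bernoulli k *_) (1^ (N ∸ k))) (ℚ.*-identityʳ (bernoulli k)))) ⟩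
    Σ< (suc N) T
      ≡⟨ trans (Σ<-snoc N T) (cong (_+ T N) (Σ<-snoc (suc n) T)) ⟩
    Σ< (suc n) T + T (suc n) + T N
      ≡⟨ cong₂ (λ x y → S + nat x * bernoulli (suc n) + nat y * bernoulli N) C-last (nCn≡1 N) ⟩
    S + nat N * bernoulli (suc n) + 1ℚ * bernoulli N
      ≡⟨ cong (λ b → S + nat N * b + 1ℚ * bernoulli N) (bernoulli-unfold (suc n)) ⟩
    S + nat N * (- (inv N * S)) + 1ℚ * bernoulli N
      ≡⟨ solve 4 (λ s m i b → s :+ m :* (:- (i :* s)) :+ con 1ℚ :* b := s :- (i :* m) :* s :+ b) refl
           S (nat N) (inv N) (bernoulli N) ⟩
    S - inv N * nat N * S + bernoulli N
      ≡⟨ cong (λ z → S - z * S + bernoulli N) (inv-* N) ⟩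
    S - 1ℚ * S + bernoulli N
      ≡⟨ solve 2 (λ s b → s :- con 1ℚ :* s :+ b := b :+ con 0ℚ) refl S (bernoulli N) ⟩
    bernoulli N + 0ℚ ∎
    where
    open ≡-Reasoning
    N = suc (suc n)
    T : ℕ → ℚ
    T k = nat (N C k) * bernoulli k
    S = Σ< (suc n) T
    C-last : N C suc n ≡ N
    C-last = trans (nCk≡nC[n∸k] {suc n} {N} (ℕ.n≤1+n (suc n)))
      (trans (cong (N C_) (trans (ℕ.+-∸-assoc 1 {suc n} ℕ.≤-refl) (cong suc (ℕ.n∸n≡0 (suc n))))) (nC1≡n N))

  -1ℚ : ℚ
  -1ℚ = - 1ℚ

  -1^*1^ : ∀ k → -1ℚ ^ k * 1ℚ ^ k ≡ -1ℚ ^ k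
  -1^*1^ k = trans (cong (-1ℚ ^ k *_) (1^ k)) (ℚ.*-identityʳ (-1ℚ ^ k))

  -- This is B(-t) = B(t) + t. Substituting -t in `bernoulli-⋆` gives B(-t) exp(-t) = B(-t) - t, so
  -- γ = B(-t) - t satisfies γ exp(t) = γ + t, the same equation as B. The difference d then
  -- satisfies d · (exp(t) - 1) = 0. As exp(t) - 1 begins with t, its coefficient in degree k+1
  -- yields (k+1) d k = 0 once the lower d vanish.
  bernoulli-reflect : ∀ n → -1ℚ ^ n * bernoulli n ≡ bernoulli n + δ₁ n
  bernoulli-reflect n = trans
    (solve 3 (λ a b c → a := (a :- b :+ con -1ℚ :* c) :+ (c :+ b)) refl (σβ n) (δ₁ n) (bernoulli n))
    (trans (cong (_+ (bernoulli n + δ₁ n)) (vanishes d step n)) (ℚ.+-identityˡ _))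
    where
    open ≡-Reasoning
    σβ γ d : ℕ → ℚ
    σβ k = -1ℚ ^ k * bernoulli k
    γ k = σβ k - δ₁ k
    d k = γ k + -1ℚ * bernoulli k
    -δ₁ : ∀ k → -1ℚ ^ k * δ₁ k ≡ - δ₁ k
    -δ₁ zero          = refl
    -δ₁ (suc zero)    = refl
    -δ₁ (suc (suc k)) = ℚ.*-zeroʳ (-1ℚ ^ suc (suc k))
    γ≡ : ∀ k → γ k ≡ (σβ ⋆ (-1ℚ ^_)) k
    γ≡ k = begin
      σβ k - δ₁ k                            ≡⟨ cong (λ z → σβ k + z) (-δ₁ k) ⟨
      σβ k + -1ℚ ^ k * δ₁ k                  ≡⟨ ℚ.*-distribˡ-+ (-1ℚ ^ k) (bernoulli k) (δ₁ k) ⟨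
      -1ℚ ^ k * (bernoulli k + δ₁ k)         ≡⟨ cong (-1ℚ ^ k *_) (bernoulli-⋆ k) ⟨
      -1ℚ ^ k * (bernoulli ⋆ (1ℚ ^_)) k      ≡⟨ ⋆-twist -1ℚ bernoulli (1ℚ ^_) k ⟨
      (σβ ⋆ (λ j → -1ℚ ^ j * 1ℚ ^ j)) k      ≡⟨ ⋆-cong {σβ} (λ _ → refl) -1^*1^ k ⟩
      (σβ ⋆ (-1ℚ ^_)) k ∎
    γ⋆ : ∀ k → (γ ⋆ (1ℚ ^_)) k ≡ σβ k
    γ⋆ k = begin
      (γ ⋆ (1ℚ ^_)) k                        ≡⟨ ⋆-cong γ≡ (λ _ → refl) k ⟩
      ((σβ ⋆ (-1ℚ ^_)) ⋆ (1ℚ ^_)) k          ≡⟨ ⋆-assoc σβ (-1ℚ ^_) (1ℚ ^_) k ⟩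
      (σβ ⋆ ((-1ℚ ^_) ⋆ (1ℚ ^_))) k          ≡⟨ ⋆-cong {σβ} (λ _ → refl) (λ j → trans (^-⋆ -1ℚ 1ℚ j) (0^ j)) k ⟩
      (σβ ⋆ δ₀) k                            ≡⟨ ⋆-identityʳ σβ k ⟩
      σβ k ∎
    d⋆ : ∀ k → (d ⋆ (1ℚ ^_)) k ≡ d k
    d⋆ k = begin
      (d ⋆ (1ℚ ^_)) k
        ≡⟨ ⋆-distribʳ (1ℚ ^_) γ (λ j → -1ℚ * bernoulli j) k ⟩
      (γ ⋆ (1ℚ ^_)) k + ((λ j → -1ℚ * bernoulli j) ⋆ (1ℚ ^_)) k
        ≡⟨ cong₂ _+_ (γ⋆ k) (trans (⋆-scaleˡ -1ℚ bernoulli (1ℚ ^_) k) (cong (-1ℚ *_) (bernoulli-⋆ k))) ⟩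
      σβ k + -1ℚ * (bernoulli k + δ₁ k)
        ≡⟨ solve 3 (λ a b c → a :+ con -1ℚ :* (c :+ b) := a :- b :+ con -1ℚ :* c) refl (σβ k) (δ₁ k) (bernoulli k) ⟩
      d k ∎
    step : ∀ k → (∀ j → j < k → d j ≡ 0ℚ) → d k ≡ 0ℚ
    step k below = nat-cancelˡ (suc k) (begin
      nat (suc k) * d k
        ≡⟨ solve 3 (λ m x y → m :* x := m :* (x :* (con 1ℚ :* con 1ℚ)) :+ y :* con 1ℚ :- y) refl (nat (suc k)) (d k)
             (d (suc k)) ⟩
      nat (suc k) * (d k * 1ℚ ^ 1) + d (suc k) * 1ℚ - d (suc k)
        ≡⟨ cong (_- d (suc k)) (⋆-vanishing-suc k below (1ℚ ^_)) ⟨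
      (d ⋆ (1ℚ ^_)) (suc k) - d (suc k)
        ≡⟨ cong (_- d (suc k)) (d⋆ (suc k)) ⟩
      d (suc k) - d (suc k)
        ≡⟨ solve 2 (λ x m → x :- x := m :* con 0ℚ) refl (d (suc k)) (nat (suc k)) ⟩
      nat (suc k) * 0ℚ ∎)

  -- Even exponents are recognised by (-1)ⁿ = 1.

  bernoulli-odd : ∀ n → 0 < n → -1ℚ ^ n ≡ 1ℚ → bernoulli (suc n) ≡ 0ℚ
  bernoulli-odd n@(suc _) _ even = nat-cancelˡ 2 (begin
    2ℚ * b                              ≡⟨ solve 1 (λ x → con 2ℚ :* x := x :+ con 0ℚ :+ x) refl b ⟩
    b + 0ℚ + b                          ≡⟨ cong (_+ b) (bernoulli-reflect (suc n)) ⟨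
    -1ℚ * -1ℚ ^ n * b + b               ≡⟨ cong (λ s → -1ℚ * s * b + b) even ⟩
    -1ℚ * 1ℚ * b + b                    ≡⟨ solve 1 (λ x → con -1ℚ :* con 1ℚ :* x :+ x := con 2ℚ :* con 0ℚ) refl b ⟩
    2ℚ * 0ℚ                             ∎)
    where
    open ≡-Reasoning
    b = bernoulli (suc n)

  bernoulliPolyℚ : ℕ → ℚ → ℚ
  bernoulliPolyℚ n x = (bernoulli ⋆ (x ^_)) n

  bernoulliPolyℚ-0 : ∀ n → bernoulliPolyℚ n 0ℚ ≡ bernoulli n
  bernoulliPolyℚ-0 n = trans (⋆-cong {bernoulli} (λ _ → refl) 0^ n) (⋆-identityʳ bernoulli n)

  -- B(t) exp((x+1)t) = (B(t) + t) exp(xt), and multiplication by t is `δ₁-⋆`.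
  bernoulliPolyℚ-step : ∀ n x → bernoulliPolyℚ (suc n) (x + 1ℚ) ≡ bernoulliPolyℚ (suc n) x + nat (suc n) * x ^ n
  bernoulliPolyℚ-step n x = begin
    (bernoulli ⋆ ((x + 1ℚ) ^_)) N
      ≡⟨ ⋆-cong {bernoulli} (λ _ → refl) (λ j → trans (cong (_^ j) (ℚ.+-comm x 1ℚ)) (sym (^-⋆ 1ℚ x j))) N ⟩
    (bernoulli ⋆ ((1ℚ ^_) ⋆ (x ^_))) N        ≡⟨ ⋆-assoc bernoulli (1ℚ ^_) (x ^_) N ⟨
    ((bernoulli ⋆ (1ℚ ^_)) ⋆ (x ^_)) N        ≡⟨ ⋆-cong {g = x ^_} bernoulli-⋆ (λ _ → refl) N ⟩
    ((bernoulli ⊕ δ₁) ⋆ (x ^_)) N             ≡⟨ ⋆-distribʳ (x ^_) bernoulli δ₁ N ⟩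
    bernoulliPolyℚ N x + (δ₁ ⋆ (x ^_)) N                  ≡⟨ cong (λ z → bernoulliPolyℚ N x + z) (δ₁-⋆ (x ^_) n) ⟩
    bernoulliPolyℚ N x + nat N * x ^ n                    ∎
    where
    open ≡-Reasoning
    N = suc n

  parity : ∀ j → (-1ℚ ^ j ≡ 1ℚ × 2 ∣ j) ⊎ (-1ℚ ^ j ≡ -1ℚ × 2 ∤ j)
  parity zero       = inj₁ (refl , 2 ∣0)
  parity (suc zero) = inj₂ (refl , λ 2∣1 → case (∣1⇒≡1 2∣1))
    where case : 2 ≢ 1
          case ()
  parity (suc (suc j)) with parity j
  ... | inj₁ (eq , h) = inj₁ (cong (λ z → -1ℚ * (-1ℚ * z)) eq , ∣m∣n⇒∣m+n ∣-refl h)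
  ... | inj₂ (eq , h) = inj₂ (cong (λ z → -1ℚ * (-1ℚ * z)) eq , λ h′ → h (∣m+n∣m⇒∣n h′ ∣-refl))

  -- Turns the parity test in the recursion of the Euler numbers into the coefficients of exp(t) +
  -- exp(-t).
  1^+-1^ : ∀ j → 1ℚ ^ j + -1ℚ ^ j ≡ (if does (2 ∣? j) then 2ℚ else 0ℚ)
  1^+-1^ j with parity j
  ... | inj₁ (eq , h) = trans (cong₂ _+_ (1^ j) eq) (cong (if_then 2ℚ else 0ℚ) (sym (dec-true (2 ∣? j) h)))
  ... | inj₂ (eq , h) = trans (cong₂ _+_ (1^ j) eq) (cong (if_then 2ℚ else 0ℚ) (sym (dec-false (2 ∣? j) h)))

  /1-sum : ∀ n (t : ℕ → ℤ) → ℤ+.sum {n} (t ∘ toℕ) / 1 ≡ Σ< n (λ k → t k / 1)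
  /1-sum zero    t = refl
  /1-sum (suc n) t = trans (/1-+ (t 0) (ℤ+.sum {n} (t ∘ suc ∘ toℕ))) (cong (λ z → t 0 / 1 + z) (/1-sum n (t ∘ suc)))

  eulerℚ : ℕ → ℚ
  eulerℚ n = euler n / 1

  -- The recursion of the Euler numbers says that their generating function times cosh(t) is 1; both
  -- sides are doubled here.
  eulerℚ-⋆ : ∀ n → (eulerℚ ⋆ ((1ℚ ^_) ⊕ (-1ℚ ^_))) n ≡ 2ℚ * δ₀ n
  eulerℚ-⋆ zero = cong (λ e → (e / 1) * 2ℚ) (euler-unfold 0)
  eulerℚ-⋆ n@(suc _) = begin
    (eulerℚ ⋆ ((1ℚ ^_) ⊕ (-1ℚ ^_))) n
      ≡⟨ ⋆-binomial eulerℚ ((1ℚ ^_) ⊕ (-1ℚ ^_)) n ⟩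
    Σ< (suc n) U
      ≡⟨ Σ<-snoc n U ⟩
    Σ< n U + nat (n C n) * (eulerℚ n * (1ℚ ^ (n ∸ n) + -1ℚ ^ (n ∸ n)))
      ≡⟨ cong₂ _+_ (trans (Σ<-cong n (λ k _ → U≡ k)) (Σ<-*ˡ 2ℚ n (λ k → T k / 1)))
           (cong₂ (λ c j → nat c * (eulerℚ n * (1ℚ ^ j + -1ℚ ^ j))) (nCn≡1 n) (ℕ.n∸n≡0 n)) ⟩
    2ℚ * Σ< n (λ k → T k / 1) + 1ℚ * (eulerℚ n * 2ℚ)
      ≡⟨ cong (λ s → 2ℚ * s + 1ℚ * (eulerℚ n * 2ℚ)) (/1-sum n T) ⟨
    2ℚ * s + 1ℚ * (eulerℚ n * 2ℚ)
      ≡⟨ cong (λ e → 2ℚ * s + 1ℚ * (e * 2ℚ)) (trans (cong (_/ 1) (euler-unfold n)) (/1-neg (ℤ+.sum {n} (T ∘ toℕ)))) ⟩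
    2ℚ * s + 1ℚ * ((- s) * 2ℚ)
      ≡⟨ solve 1 (λ s → con 2ℚ :* s :+ con 1ℚ :* ((:- s) :* con 2ℚ) := con 0ℚ) refl s ⟩
    0ℚ ∎
    where
    open ≡-Reasoning
    U : ℕ → ℚ
    U k = nat (n C k) * (eulerℚ k * (1ℚ ^ (n ∸ k) + -1ℚ ^ (n ∸ k)))
    T : ℕ → ℤ
    T k = if does (2 ∣? (n ∸ k)) then + (n C k) ℤ.* euler k else 0ℤ
    s = ℤ+.sum {n} (T ∘ toℕ) / 1
    U≡ : ∀ k → U k ≡ 2ℚ * (T k / 1)
    U≡ k rewrite 1^+-1^ (n ∸ k) with does (2 ∣? (n ∸ k))
    ... | true  = trans (solve 2 (λ a b → a :* (b :* con 2ℚ) := con 2ℚ :* (a :* b)) refl (nat (n C k)) (eulerℚ k))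
                    (cong (2ℚ *_) (sym (/1-* (+ (n C k)) (euler k))))
    ... | false = solve 2 (λ a b → a :* (b :* con 0ℚ) := con 2ℚ :* con 0ℚ) refl (nat (n C k)) (eulerℚ k)

  -- The generating function is 1/cosh(t/2). These are the coefficients of the Euler polynomials in
  -- powers of x - 1/2.
  ε : ℕ → ℚ
  ε k = ½ ^ k * eulerℚ k

  ε≡ : ∀ k → (euler k / 2 ℕ.^ k) {{ℕ.m^n≢0 2 k}} ≡ ε k
  ε≡ k = nat-cancelˡ (2 ℕ.^ k) {{ℕ.m^n≢0 2 k}} (begin
    nat (2 ℕ.^ k) * q             ≡⟨ ℚ.*-comm (nat (2 ℕ.^ k)) q ⟩
    q * nat (2 ℕ.^ k)             ≡⟨ /-*-cancel (euler k) (2 ℕ.^ k) {{ℕ.m^n≢0 2 k}} ⟩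
    eulerℚ k                           ≡⟨ ℚ.*-identityˡ (eulerℚ k) ⟨
    1ℚ * eulerℚ k                      ≡⟨ cong (_* eulerℚ k) (1^ k) ⟨
    (2ℚ * ½) ^ k * eulerℚ k            ≡⟨ cong (_* eulerℚ k) (^-distrib-* 2ℚ ½ k) ⟩
    2ℚ ^ k * ½ ^ k * eulerℚ k          ≡⟨ cong (λ z → z * ½ ^ k * eulerℚ k) (nat-^ 2 k) ⟨
    nat (2 ℕ.^ k) * ½ ^ k * eulerℚ k   ≡⟨ ℚ.*-assoc (nat (2 ℕ.^ k)) (½ ^ k) (eulerℚ k) ⟩
    nat (2 ℕ.^ k) * ε k           ∎)
    where
    open ≡-Reasoning
    q = (euler k / 2 ℕ.^ k) {{ℕ.m^n≢0 2 k}}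

  -½ : ℚ
  -½ = - ½

  2cosh½ : ℕ → ℚ
  2cosh½ = (½ ^_) ⊕ (-½ ^_)

  c^*δ₀ : ∀ c n → c ^ n * (2ℚ * δ₀ n) ≡ 2ℚ * δ₀ n
  c^*δ₀ c zero    = refl
  c^*δ₀ c (suc n) = ℚ.*-zeroʳ (c ^ suc n)

  ε-⋆ : ∀ n → (ε ⋆ 2cosh½) n ≡ 2ℚ * δ₀ n
  ε-⋆ n = begin
    (ε ⋆ 2cosh½) n                                             ≡⟨ ⋆-cong {ε} (λ _ → refl) w≡ n ⟩
    (ε ⋆ (λ k → ½ ^ k * (1ℚ ^ k + -1ℚ ^ k))) n            ≡⟨ ⋆-twist ½ eulerℚ ((1ℚ ^_) ⊕ (-1ℚ ^_)) n ⟩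
    ½ ^ n * (eulerℚ ⋆ ((1ℚ ^_) ⊕ (-1ℚ ^_))) n                  ≡⟨ cong (½ ^ n *_) (eulerℚ-⋆ n) ⟩
    ½ ^ n * (2ℚ * δ₀ n)                                   ≡⟨ c^*δ₀ ½ n ⟩
    2ℚ * δ₀ n                                             ∎
    where
    open ≡-Reasoning
    w≡ : ∀ k → 2cosh½ k ≡ ½ ^ k * (1ℚ ^ k + -1ℚ ^ k)
    w≡ k = trans (cong₂ _+_ (^-distrib-* ½ 1ℚ k) (^-distrib-* ½ -1ℚ k))
        (sym (ℚ.*-distribˡ-+ (½ ^ k) (1ℚ ^ k) (-1ℚ ^ k)))

  -- The inverse of an even function is even: the sequence and its reflection have the same product
  -- with `2cosh½`, whose constant term 2 can be cancelled degree by degree.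
  ε-reflect : ∀ n → -1ℚ ^ n * ε n ≡ ε n
  ε-reflect n = trans (solve 2 (λ a b → a := (a :+ con -1ℚ :* b) :+ b) refl (σε n) (ε n))
    (trans (cong (_+ ε n) (vanishes d step n)) (ℚ.+-identityˡ (ε n)))
    where
    open ≡-Reasoning
    σε d : ℕ → ℚ
    σε k = -1ℚ ^ k * ε k
    d k = σε k + -1ℚ * ε k
    w-even : ∀ k → 2cosh½ k ≡ -1ℚ ^ k * 2cosh½ k
    w-even k = trans (ℚ.+-comm (½ ^ k) (-½ ^ k))
      (trans (cong₂ _+_ (^-distrib-* -1ℚ ½ k) (^-distrib-* -1ℚ -½ k))
          (sym (ℚ.*-distribˡ-+ (-1ℚ ^ k) (½ ^ k) (-½ ^ k))))
    d⋆ : ∀ k → (d ⋆ 2cosh½) k ≡ 0ℚ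
    d⋆ k = begin
      (d ⋆ 2cosh½) k
        ≡⟨ ⋆-distribʳ 2cosh½ σε (λ j → -1ℚ * ε j) k ⟩
      (σε ⋆ 2cosh½) k + ((λ j → -1ℚ * ε j) ⋆ 2cosh½) k
        ≡⟨ cong₂ _+_ (trans (⋆-cong {σε} (λ _ → refl) w-even k)
             (trans (⋆-twist -1ℚ ε 2cosh½ k) (trans (cong (-1ℚ ^ k *_) (ε-⋆ k)) (c^*δ₀ -1ℚ k))))
             (trans (⋆-scaleˡ -1ℚ ε 2cosh½ k) (cong (-1ℚ *_) (ε-⋆ k))) ⟩
      2ℚ * δ₀ k + -1ℚ * (2ℚ * δ₀ k)
        ≡⟨ solve 1 (λ x → x :+ con -1ℚ :* x := con 0ℚ) refl (2ℚ * δ₀ k) ⟩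
      0ℚ ∎
    step : ∀ k → (∀ j → j < k → d j ≡ 0ℚ) → d k ≡ 0ℚ
    step k below = nat-cancelˡ 2 (begin
      2ℚ * d k      ≡⟨ ℚ.*-comm 2ℚ (d k) ⟩
      d k * 2ℚ      ≡⟨ ⋆-vanishing k below 2cosh½ ⟨
      (d ⋆ 2cosh½) k     ≡⟨ d⋆ k ⟩
      2ℚ * 0ℚ       ∎)

  eulerPolyℚ : ℕ → ℚ → ℚ
  eulerPolyℚ n x = (ε ⋆ ((x - ½) ^_)) n

  -- exp((x + 1/2)t) + exp((x - 1/2)t) = 2 cosh(t/2) exp(xt), and `ε` cancels the cosh.
  eulerPolyℚ-step : ∀ n x → eulerPolyℚ n (x + 1ℚ) + eulerPolyℚ n x ≡ 2ℚ * x ^ n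
  eulerPolyℚ-step n x = begin
    (ε ⋆ ((x + 1ℚ - ½) ^_)) n + (ε ⋆ ((x - ½) ^_)) n
      ≡⟨ cong₂ _+_ (⋆-cong {ε} (λ _ → refl)
           (λ k → trans (cong (_^ k) (solve 1 (λ x → x :+ con 1ℚ :- con ½ := con ½ :+ x) refl x)) (sym (^-⋆ ½ x k)))
               n)
                   (⋆-cong {ε} (λ _ → refl) (λ k → trans (cong (_^ k) (ℚ.+-comm x -½)) (sym (^-⋆ -½ x k))) n) ⟩
    (ε ⋆ ((½ ^_) ⋆ (x ^_))) n + (ε ⋆ ((-½ ^_) ⋆ (x ^_))) n
      ≡⟨ ⋆-distribˡ ε ((½ ^_) ⋆ (x ^_)) ((-½ ^_) ⋆ (x ^_)) n ⟨
    (ε ⋆ (((½ ^_) ⋆ (x ^_)) ⊕ ((-½ ^_) ⋆ (x ^_)))) n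
      ≡⟨ ⋆-cong {ε} (λ _ → refl) (⋆-distribʳ (x ^_) (½ ^_) (-½ ^_)) n ⟨
    (ε ⋆ (2cosh½ ⋆ (x ^_))) n
      ≡⟨ ⋆-assoc ε 2cosh½ (x ^_) n ⟨
    ((ε ⋆ 2cosh½) ⋆ (x ^_)) n
      ≡⟨ ⋆-cong {g = x ^_} ε-⋆ (λ _ → refl) n ⟩
    ((λ k → 2ℚ * δ₀ k) ⋆ (x ^_)) n
      ≡⟨ ⋆-scaleˡ 2ℚ δ₀ (x ^_) n ⟩
    2ℚ * (δ₀ ⋆ (x ^_)) n
      ≡⟨ cong (2ℚ *_) (⋆-identityˡ (x ^_) n) ⟩
    2ℚ * x ^ n ∎
    where open ≡-Reasoning

  -- For even n the reflection x ↦ 1 - x gives E_n(1) = E_n(0), which is `mirror`; the difference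
  -- equation at 0 gives E_n(1) + E_n(0) = 0 for n > 0.
  eulerPolyℚ-0 : ∀ n → 0 < n → -1ℚ ^ n ≡ 1ℚ → eulerPolyℚ n 0ℚ ≡ 0ℚ
  eulerPolyℚ-0 n@(suc _) _ even = nat-cancelˡ 2 (begin
    2ℚ * e                            ≡⟨ solve 1 (λ x → con 2ℚ :* x := x :+ x) refl e ⟩
    e + e                             ≡⟨ cong (_+ e) mirror ⟨
    (ε ⋆ (½ ^_)) n + e                ≡⟨ ⋆-distribˡ ε (½ ^_) (-½ ^_) n ⟨
    (ε ⋆ 2cosh½) n                         ≡⟨ ε-⋆ n ⟩
    2ℚ * 0ℚ                           ∎)
    where
    open ≡-Reasoning
    e = eulerPolyℚ n 0ℚ
    mirror : (ε ⋆ (½ ^_)) n ≡ e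
    mirror = begin
      (ε ⋆ (½ ^_)) n                                             ≡⟨ ℚ.*-identityˡ ((ε ⋆ (½ ^_)) n) ⟨
      1ℚ * (ε ⋆ (½ ^_)) n                                        ≡⟨ cong (_* (ε ⋆ (½ ^_)) n) even ⟨
      -1ℚ ^ n * (ε ⋆ (½ ^_)) n                                   ≡⟨ ⋆-twist -1ℚ ε (½ ^_) n ⟨
      ((λ k → -1ℚ ^ k * ε k) ⋆ (λ k → -1ℚ ^ k * ½ ^ k)) n
        ≡⟨ ⋆-cong ε-reflect (λ k → sym (^-distrib-* -1ℚ ½ k)) n ⟩
      e ∎

  -- The two sums as functions of a rational argument

  binomℚ : ℚ → ℕ → ℚ
  binomℚ x k = ℚ*.sum {k} (λ i → x - nat (toℕ i)) * inv (k !) {{k ℕ.!≢0}}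

  product-snoc : ∀ n f → ℚ*.sum {suc n} (f ∘ toℕ) ≡ ℚ*.sum {n} (f ∘ toℕ) * f n
  product-snoc zero    f = trans (ℚ.*-identityʳ (f 0)) (sym (ℚ.*-identityˡ (f 0)))
  product-snoc (suc n) f = trans (cong (f 0 *_) (product-snoc n (f ∘ suc)))
    (sym (ℚ.*-assoc (f 0) (ℚ*.sum {n} (f ∘ suc ∘ toℕ)) (f (suc n))))

  inv-*-homo : ∀ m n .{{_ : NonZero m}} .{{_ : NonZero n}} .{{_ : NonZero (m ℕ.* n)}} → inv (m ℕ.* n) ≡ inv m * inv n
  inv-*-homo m n = nat-cancelˡ (m ℕ.* n) (begin
    nat (m ℕ.* n) * inv (m ℕ.* n)      ≡⟨ trans (ℚ.*-comm (nat (m ℕ.* n)) _) (inv-* (m ℕ.* n)) ⟩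
    1ℚ * 1ℚ                            ≡⟨ cong₂ _*_ (inv-* m) (inv-* n) ⟨
    inv m * nat m * (inv n * nat n)
      ≡⟨ solve 4 (λ a b c d → a :* b :* (c :* d) := (b :* d) :* (a :* c)) refl (inv m) (nat m) (inv n) (nat n) ⟩
    nat m * nat n * (inv m * inv n)    ≡⟨ cong (_* (inv m * inv n)) (nat-* m n) ⟨
    nat (m ℕ.* n) * (inv m * inv n)    ∎)
    where open ≡-Reasoning

  binomℚ-suc : ∀ x k → binomℚ x (suc k) ≡ binomℚ x k * (x - nat k) * inv (suc k)
  binomℚ-suc x k = trans
      (cong₂ _*_ (product-snoc k (λ j → x - nat j)) (inv-*-homo (suc k) (k !) {{_}} {{k ℕ.!≢0}} {{suc k ℕ.!≢0}}))
    (solve 4 (λ a b c d → a :* b :* (c :* d) := a :* d :* b :* c) refl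
      (ℚ*.sum {k} (λ i → x - nat (toℕ i))) (x - nat k) (inv (suc k)) (inv (k !) {{k ℕ.!≢0}}))

  u : ℕ → ℚ → ℚ
  u k a = binomℚ (- a) k * binomℚ (a - 1ℚ) k

  1/k² : ℕ → ℚ
  1/k² k = inv (suc k) * inv (suc k)

  1/k²-* : ∀ k → 1/k² k * (nat (suc k) * nat (suc k)) ≡ 1ℚ
  1/k²-* k = trans (solve 2 (λ i n → i :* i :* (n :* n) := i :* n :* (i :* n)) refl (inv (suc k)) (nat (suc k)))
    (cong₂ _*_ (inv-* (suc k)) (inv-* (suc k)))

  u-suc : ∀ k a → u (suc k) a ≡ u k a * ((- a - nat k) * (a - 1ℚ - nat k)) * 1/k² k
  u-suc k a = trans (cong₂ _*_ (binomℚ-suc (- a) k) (binomℚ-suc (a - 1ℚ) k))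
    (solve 5 (λ x y s t i → (x :* s :* i) :* (y :* t :* i) := x :* y :* (s :* t) :* (i :* i)) refl
      (binomℚ (- a) k) (binomℚ (a - 1ℚ) k) (- a - nat k) (a - 1ℚ - nat k) (inv (suc k)))

  -- G k a = ∏_{0<j≤k} (1 - a²/j²), the common factor of u (k+1) a and u (k+1) (a+1).
  G : ℕ → ℚ → ℚ
  G zero    a = 1ℚ
  G (suc k) a = G k a * (1ℚ - a * a * 1/k² k)

  -- In the numerator of the two binomials the factors -a - j and a - j pair to j² - a² for 0 < j ≤
  -- k. The unpaired ones are -a and a - (k+1). In `u-G+1` the same pairing leaves a and -(a + k +
  -- 1).
  u-G : ∀ k a → u (suc k) a ≡ G k a * (- a * (a - nat (suc k))) * 1/k² k
  u-G zero a = trans (u-suc 0 a)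
    (solve 2 (λ a i → con 1ℚ :* ((:- a :- con 0ℚ) :* (a :- con 1ℚ :- con 0ℚ)) :* i := con 1ℚ
        :* (:- a :* (a :- con 1ℚ)) :* i) refl a (1/k² 0))
  u-G (suc k) a = begin
    u (2 ℕ.+ k) a
      ≡⟨ u-suc (suc k) a ⟩
    u (suc k) a * ((- a - n) * (a - 1ℚ - n)) * j
      ≡⟨ cong (λ z → z * ((- a - n) * (a - 1ℚ - n)) * j) (u-G k a) ⟩
    G k a * (- a * (a - n)) * i * ((- a - n) * (a - 1ℚ - n)) * j
      -- The 1 in the new factor of `G` is carried as i n², which makes this a polynomial identity;
      -- `1/k²-*` then restores it.
      ≡⟨ solve 5 (λ a n i j g → g :* (:- a :* (a :- n)) :* i :* ((:- a :- n) :* (a :- con 1ℚ :- n)) :* j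
                  := g :* (i :* (n :* n) :- a :* a :* i) :* (:- a :* (a :- (n :+ con 1ℚ))) :* j) refl a n i j
                      (G k a) ⟩
    G k a * (i * (n * n) - a * a * i) * (- a * (a - (n + 1ℚ))) * j
      ≡⟨ cong₂ (λ o m → G k a * (o - a * a * i) * (- a * (a - m)) * j) (1/k²-* k) (sym (nat-suc (suc k))) ⟩
    G (suc k) a * (- a * (a - nat (2 ℕ.+ k))) * j ∎
    where
    open ≡-Reasoning
    n = nat (suc k)
    i = 1/k² k
    j = 1/k² (suc k)

  u-G+1 : ∀ k a → u (suc k) (a + 1ℚ) ≡ G k a * (- a * (a + nat (suc k))) * 1/k² k
  u-G+1 zero a = trans (u-suc 0 (a + 1ℚ))
    (solve 2 (λ a i → con 1ℚ :* ((:- (a :+ con 1ℚ) :- con 0ℚ) :* (a :+ con 1ℚ :- con 1ℚ :- con 0ℚ)) :* i := con 1ℚ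
        :* (:- a :* (a :+ con 1ℚ)) :* i) refl a (1/k² 0))
  u-G+1 (suc k) a = begin
    u (2 ℕ.+ k) (a + 1ℚ)
      ≡⟨ u-suc (suc k) (a + 1ℚ) ⟩
    u (suc k) (a + 1ℚ) * ((- (a + 1ℚ) - n) * (a + 1ℚ - 1ℚ - n)) * j
      ≡⟨ cong (λ z → z * ((- (a + 1ℚ) - n) * (a + 1ℚ - 1ℚ - n)) * j) (u-G+1 k a) ⟩
    G k a * (- a * (a + n)) * i * ((- (a + 1ℚ) - n) * (a + 1ℚ - 1ℚ - n)) * j
      ≡⟨ solve 5 (λ a n i j g → g :* (:- a :* (a :+ n)) :* i
           :* ((:- (a :+ con 1ℚ) :- n) :* (a :+ con 1ℚ :- con 1ℚ :- n)) :* j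
                  := g :* (i :* (n :* n) :- a :* a :* i) :* (:- a :* (a :+ (n :+ con 1ℚ))) :* j) refl a n i j
                      (G k a) ⟩
    G k a * (i * (n * n) - a * a * i) * (- a * (a + (n + 1ℚ))) * j
      ≡⟨ cong₂ (λ o m → G k a * (o - a * a * i) * (- a * (a + m)) * j) (1/k²-* k) (sym (nat-suc (suc k))) ⟩
    G (suc k) a * (- a * (a + nat (2 ℕ.+ k))) * j ∎
    where
    open ≡-Reasoning
    n = nat (suc k)
    i = 1/k² k
    j = 1/k² (suc k)

  ΔG : ℕ → ℚ → ℚ
  ΔG k a = 2ℚ * (G (suc k) a - G k a)

  u+u : ∀ k a → u (suc k) (a + 1ℚ) + u (suc k) a ≡ ΔG k a
  u+u k a = trans (cong₂ _+_ (u-G+1 k a) (u-G k a))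
    (solve 4 (λ a n i g → g :* (:- a :* (a :+ n)) :* i :+ g :* (:- a :* (a :- n)) :* i
                := con 2ℚ :* (g :* (con 1ℚ :- a :* a :* i) :- g)) refl a (nat (suc k)) (1/k² k) (G k a))

  -- The odd number on the right cancels against the denominator in the summand of `Ψ` with index
  -- k+1.
  u-u : ∀ k a → (2ℚ * (a + 1ℚ) - 1ℚ) * u (suc k) (a + 1ℚ) - (2ℚ * a - 1ℚ) * u (suc k) a
                ≡ ΔG k a * nat (suc (2 ℕ.* suc k))
  u-u k a = begin
    (2ℚ * (a + 1ℚ) - 1ℚ) * u (suc k) (a + 1ℚ) - (2ℚ * a - 1ℚ) * u (suc k) a
      ≡⟨ cong₂ (λ x y → (2ℚ * (a + 1ℚ) - 1ℚ) * x - (2ℚ * a - 1ℚ) * y) (u-G+1 k a) (u-G k a) ⟩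
    (2ℚ * (a + 1ℚ) - 1ℚ) * (g * (- a * (a + n)) * i) - (2ℚ * a - 1ℚ) * (g * (- a * (a - n)) * i)
      ≡⟨ solve 4 (λ a n i g → (con 2ℚ :* (a :+ con 1ℚ) :- con 1ℚ) :* (g :* (:- a :* (a :+ n)) :* i)
           :- (con 2ℚ :* a :- con 1ℚ) :* (g :* (:- a :* (a :- n)) :* i)
                := con 2ℚ :* (g :* (con 1ℚ :- a :* a :* i) :- g) :* (con 2ℚ :* n :+ con 1ℚ)) refl a n i g ⟩
    ΔG k a * (2ℚ * n + 1ℚ)
      ≡⟨ cong (ΔG k a *_) (trans (nat-suc (2 ℕ.* suc k)) (cong (_+ 1ℚ) (nat-* 2 (suc k)))) ⟨
    ΔG k a * nat (suc (2 ℕ.* suc k)) ∎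
    where
    open ≡-Reasoning
    n = nat (suc k)
    i = 1/k² k
    g = G k a

  Φ Ψ : ℕ → ℚ → ℚ
  Φ n a = Σ< n (λ k → u k a * H⁽²⁾ k)
  Ψ n a = (2ℚ * a - 1ℚ) * Σ< n (λ k → u k a * (H⁽²⁾ k * inv (suc (2 ℕ.* k))))

  ΔΦ : ℕ → ℚ → ℚ
  ΔΦ n a = Σ< n (λ k → ΔG k a * H⁽²⁾ (suc k))

  Φ+Φ : ∀ n a → Φ (suc n) (a + 1ℚ) + Φ (suc n) a ≡ ΔΦ n a
  Φ+Φ n a = begin
    Φ (suc n) (a + 1ℚ) + Φ (suc n) a
      ≡⟨ Σ<-+ (suc n) (λ k → u k (a + 1ℚ) * H⁽²⁾ k) (λ k → u k a * H⁽²⁾ k) ⟨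
    -- The terms with k = 0 vanish because `H⁽²⁾ 0` is 0, which is why the increment is a sum over
    -- one index fewer.
    (1ℚ * 0ℚ + 1ℚ * 0ℚ) + Σ< n (λ k → u (suc k) (a + 1ℚ) * H⁽²⁾ (suc k) + u (suc k) a * H⁽²⁾ (suc k))
      ≡⟨ ℚ.+-identityˡ _ ⟩
    Σ< n (λ k → u (suc k) (a + 1ℚ) * H⁽²⁾ (suc k) + u (suc k) a * H⁽²⁾ (suc k))
      ≡⟨ Σ<-cong n (λ k _ → trans (sym (ℚ.*-distribʳ-+ (H⁽²⁾ (suc k)) (u (suc k) (a + 1ℚ)) (u (suc k) a)))
                                   (cong (_* H⁽²⁾ (suc k)) (u+u k a))) ⟩
    ΔΦ n a ∎
    where open ≡-Reasoning

  Ψ-Ψ : ∀ n a → Ψ (suc n) (a + 1ℚ) ≡ Ψ (suc n) a + ΔΦ n a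
  Ψ-Ψ n a = begin
    c′ * Σ< (suc n) (λ k → u k (a + 1ℚ) * R k)
      ≡⟨ Σ<-*ˡ c′ (suc n) (λ k → u k (a + 1ℚ) * R k) ⟨
    c′ * (1ℚ * 0ℚ) + Σ< n (λ k → c′ * (u (suc k) (a + 1ℚ) * R (suc k)))
      ≡⟨ cong₂ _+_ (trans (ℚ.*-zeroʳ c′) (sym (ℚ.*-zeroʳ c))) (Σ<-cong n (λ k _ → term k)) ⟩
    c * (1ℚ * 0ℚ) + Σ< n (λ k → c * (u (suc k) a * R (suc k)) + ΔG k a * H⁽²⁾ (suc k))
      ≡⟨ cong (λ z → c * (1ℚ * 0ℚ) + z) (Σ<-+ n (λ k → c * (u (suc k) a * R (suc k))) (λ k → ΔG k a * H⁽²⁾ (suc k))) ⟩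
    c * (1ℚ * 0ℚ) + (Σ< n (λ k → c * (u (suc k) a * R (suc k))) + ΔΦ n a)
      ≡⟨ ℚ.+-assoc (c * (1ℚ * 0ℚ)) (Σ< n (λ k → c * (u (suc k) a * R (suc k)))) (ΔΦ n a) ⟨
    Σ< (suc n) (λ k → c * (u k a * R k)) + ΔΦ n a
      ≡⟨ cong (_+ ΔΦ n a) (Σ<-*ˡ c (suc n) (λ k → u k a * R k)) ⟩
    Ψ (suc n) a + ΔΦ n a ∎
    where
    open ≡-Reasoning
    c c′ : ℚ
    c  = 2ℚ * a - 1ℚ
    c′ = 2ℚ * (a + 1ℚ) - 1ℚ
    R : ℕ → ℚ
    R k = H⁽²⁾ k * inv (suc (2 ℕ.* k))
    term : ∀ k → c′ * (u (suc k) (a + 1ℚ) * R (suc k)) ≡ c * (u (suc k) a * R (suc k)) + ΔG k a * H⁽²⁾ (suc k)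
    term k = begin
      c′ * (v′ * (H * i))
        ≡⟨ solve 6 (λ c c′ v v′ y i → c′ :* (v′ :* (y :* i)) := c :* (v :* (y :* i)) :+ (c′ :* v′ :- c :* v)
             :* (y :* i)) refl c c′ v v′ H i ⟩
      c * (v * (H * i)) + (c′ * v′ - c * v) * (H * i)
        ≡⟨ cong (λ z → c * (v * (H * i)) + z * (H * i)) (u-u k a) ⟩
      c * (v * (H * i)) + ΔG k a * o * (H * i)
        ≡⟨ cong (λ z → c * (v * (H * i)) + z) (solve 4 (λ e n y i → e :* n :* (y :* i) := e :* y :* (i :* n)) refl
             (ΔG k a) o H i) ⟩
      c * (v * (H * i)) + ΔG k a * H * (i * o)
        ≡⟨ cong (λ z → c * (v * (H * i)) + ΔG k a * H * z) (inv-* (suc (2 ℕ.* suc k))) ⟩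
      c * (v * (H * i)) + ΔG k a * H * 1ℚ        ≡⟨ cong (λ z → c * (v * (H * i)) + z) (ℚ.*-identityʳ (ΔG k a * H)) ⟩
      c * (v * (H * i)) + ΔG k a * H             ∎
      where
      v = u (suc k) a
      v′ = u (suc k) (a + 1ℚ)
      H = H⁽²⁾ (suc k)
      i = inv (suc (2 ℕ.* suc k))
      o = nat (suc (2 ℕ.* suc k))

  H-suc : ∀ n → H⁽²⁾ (suc n) ≡ H⁽²⁾ n + 1/k² n
  H-suc n = Σ<-snoc n 1/k²

  -- Abel summation, using G (n+1) - G n = - a² G n / (n+1)².
  ΔΦ-abel : ∀ n a → a * a * ΔΦ n a ≡ 2ℚ * (a * a * H⁽²⁾ n * G n a + G n a - 1ℚ)
  ΔΦ-abel zero    a = solve 1 (λ a → a :* a :* con 0ℚ := con 2ℚ :* (a :* a :* con 0ℚ :* con 1ℚ :+ con 1ℚ :- con 1ℚ))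
      refl a
  ΔΦ-abel (suc n) a = begin
    a * a * ΔΦ (suc n) a
      ≡⟨ cong (a * a *_) (Σ<-snoc n (λ k → ΔG k a * H⁽²⁾ (suc k))) ⟩
    a * a * (ΔΦ n a + ΔG n a * H⁽²⁾ (suc n))
      ≡⟨ ℚ.*-distribˡ-+ (a * a) (ΔΦ n a) (ΔG n a * H⁽²⁾ (suc n)) ⟩
    a * a * ΔΦ n a + a * a * (ΔG n a * H⁽²⁾ (suc n))
      ≡⟨ cong₂ (λ x y → x + a * a * (ΔG n a * y)) (ΔΦ-abel n a) (H-suc n) ⟩
    2ℚ * (a * a * H * g + g - 1ℚ) + a * a * (ΔG n a * (H + i))
      ≡⟨ solve 4 (λ a g y i → con 2ℚ :* (a :* a :* y :* g :+ g :- con 1ℚ) :+ a :* a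
           :* (con 2ℚ :* (g :* (con 1ℚ :- a :* a :* i) :- g) :* (y :+ i))
           := con 2ℚ :* (a :* a :* (y :+ i) :* (g :* (con 1ℚ :- a :* a :* i)) :+ g :* (con 1ℚ :- a :* a :* i)
               :- con 1ℚ)) refl a g H i ⟩
    2ℚ * (a * a * (H + i) * G (suc n) a + G (suc n) a - 1ℚ)
      ≡⟨ cong (λ y → 2ℚ * (a * a * y * G (suc n) a + G (suc n) a - 1ℚ)) (H-suc n) ⟨
    2ℚ * (a * a * H⁽²⁾ (suc n) * G (suc n) a + G (suc n) a - 1ℚ) ∎
    where
    open ≡-Reasoning
    g = G n a
    H = H⁽²⁾ n
    i = 1/k² n

  -- C(0,k+1) = 0. In terms of `G` it is the factor a in `u-G+1` at a = 0. This starts the induction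
  -- on positive integers.
  u-1 : ∀ k → u (suc k) 1ℚ ≡ 0ℚ
  u-1 k = trans (u-G+1 k 0ℚ) (solve 3 (λ g n i → g :* (con 0ℚ :* (con 0ℚ :+ n)) :* i := con 0ℚ) refl (G k 0ℚ)
      (nat (suc k)) (1/k² k))

  Σ-u-1 : ∀ n (R : ℕ → ℚ) → R 0 ≡ 0ℚ → Σ< n (λ k → u k 1ℚ * R k) ≡ 0ℚ
  Σ-u-1 zero    R R0 = refl
  Σ-u-1 (suc n) R R0 = cong₂ _+_ (cong (1ℚ *_) R0)
    (trans (Σ<-cong n (λ k _ → trans (cong (_* R (suc k)) (u-1 k))
                                 (trans (ℚ.*-zeroˡ (R (suc k))) (sym (ℚ.*-zeroˡ 0ℚ)))))
      (trans (Σ<-*ˡ 0ℚ n (λ _ → 0ℚ)) (ℚ.*-zeroˡ (Σ< n (λ _ → 0ℚ)))))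

  Φ-1 : ∀ n → Φ n 1ℚ ≡ 0ℚ
  Φ-1 n = Σ-u-1 n H⁽²⁾ refl

  Ψ-1 : ∀ n → Ψ n 1ℚ ≡ 0ℚ
  Ψ-1 n = cong (λ z → (2ℚ * 1ℚ - 1ℚ) * z) (Σ-u-1 n (λ k → H⁽²⁾ k * inv (suc (2 ℕ.* k))) refl)

-- Congruences between rational numbers modulo powers of p

module Congruence (p : ℕ) (pr : Prime p) where

  open Rationals
  open import Data.Rational.Base using (_+_; _*_; -_; _-_)
  open +-*-Solver

  open PAdic p pr using (ℤ₍ₚ₎; Ball; p^; int-ℤ; int-*; int-p^; ball-0; ball-+; ball-neg; ball-int; ball-*ˡ; ↧/∣; p∤1;
      p∤*; clear) public

  instance
    p≢0 : NonZero p
    p≢0 = prime⇒nonZero pr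

  -- Records, so that the rationals can be inferred from the type.
  record _∈p^_ (x : ℚ) (n : ℕ) : Set where
    constructor ball
    field unball : Ball n x
  open _∈p^_ public

  Int : ℚ → Set
  Int x = x ∈p^ 0

  infix 4 _∈p^_ _≅_[_]
  record _≅_[_] (x y : ℚ) (n : ℕ) : Set where
    constructor diff
    field undiff : x - y ∈p^ n
  open _≅_[_] public

  int : ∀ {x} → ℤ₍ₚ₎ x → Int x
  int {x} h = ball (x , h , sym (ℚ.*-identityˡ x))

  unint : ∀ {x} → Int x → ℤ₍ₚ₎ x
  unint (ball h) = ball-int h

  int-/1 : ∀ i → Int (i / 1)
  int-/1 i = int (int-ℤ i)

  int-nat : ∀ n → Int (nat n)
  int-nat n = int-/1 (+ n)

  int-inv : ∀ k .{{_ : NonZero k}} → p ∤ k → Int (inv k)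
  int-inv k p∤k = int (λ h → p∤k (∣-trans h (↧/∣ 1ℤ k)))

  ∈p^-0 : ∀ n → 0ℚ ∈p^ n
  ∈p^-0 n = ball (ball-0 n)

  ∈p^-+ : ∀ {n x y} → x ∈p^ n → y ∈p^ n → x + y ∈p^ n
  ∈p^-+ {n} (ball h) (ball k) = ball (ball-+ n h k)

  ∈p^-neg : ∀ {n x} → x ∈p^ n → - x ∈p^ n
  ∈p^-neg {n} (ball h) = ball (ball-neg n h)

  ∈p^-* : ∀ {m n x y} → x ∈p^ m → y ∈p^ n → x * y ∈p^ (m ℕ.+ n)
  ∈p^-* {m} {n} (ball (z , hz , refl)) (ball (w , hw , refl)) = ball (z * w , int-* {z} {w} hz hw ,
    trans (solve 4 (λ a b c d → (a :* c) :* (b :* d) := a :* b :* (c :* d)) refl (p^ m) (p^ n) z w)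
          (cong (_* (z * w)) (sym (^-homo-* (nat p) m n))))

  ∈p^-*ˡ : ∀ {n x y} → Int x → y ∈p^ n → x * y ∈p^ n
  ∈p^-*ˡ = ∈p^-*

  ∈p^-*ʳ : ∀ {n x y} → x ∈p^ n → Int y → x * y ∈p^ n
  ∈p^-*ʳ {n} {x} {y} h k = subst (_∈p^ n) (ℚ.*-comm y x) (∈p^-*ˡ k h)

  ∈p^-weaken : ∀ {m n x} → m ≤ n → x ∈p^ n → x ∈p^ m
  ∈p^-weaken {m} {n} m≤n (ball (z , hz , refl)) = subst (_∈p^ m) eq
    (∈p^-*ʳ {m} {p^ m} (ball (1ℚ , int-ℤ 1ℤ , sym (ℚ.*-identityʳ (p^ m))))
      (int (int-* {p^ (n ∸ m)} {z} (int-p^ (n ∸ m)) hz)))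
    where
    eq : p^ m * (p^ (n ∸ m) * z) ≡ p^ n * z
    eq = trans (sym (ℚ.*-assoc (p^ m) (p^ (n ∸ m)) z))
      (cong (_* z) (trans (sym (^-homo-* (nat p) m (n ∸ m))) (cong p^ (ℕ.m+[n∸m]≡n m≤n))))

  ∈p^-Σ : ∀ {s} n f → (∀ k → k < n → f k ∈p^ s) → Σ< n f ∈p^ s
  ∈p^-Σ {s} zero f h = ∈p^-0 s
  ∈p^-Σ (suc n) f h = ∈p^-+ (h 0 ℕ.z<s) (∈p^-Σ n (f ∘ suc) (λ k k<n → h (suc k) (ℕ.s<s k<n)))

  ∈p^-^ : ∀ {s x} n → x ∈p^ s → x ^ n ∈p^ (n ℕ.* s)
  ∈p^-^ zero    h = int-nat 1
  ∈p^-^ (suc n) h = ∈p^-* h (∈p^-^ n h)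

  int-^ : ∀ {x} n → Int x → Int (x ^ n)
  int-^ {x} n h = subst (x ^ n ∈p^_) (ℕ.*-zeroʳ n) (∈p^-^ n h)

  p^∈p^ : ∀ n → p^ n ∈p^ n
  p^∈p^ n = ball (1ℚ , int-ℤ 1ℤ , sym (ℚ.*-identityʳ (p^ n)))

  p∈p^1 : nat p ∈p^ 1
  p∈p^1 = subst (_∈p^ 1) (ℚ.*-identityʳ (nat p)) (p^∈p^ 1)

  ∣⇒∈p^1 : ∀ {k} → p ∣ k → nat k ∈p^ 1
  ∣⇒∈p^1 (divides q refl) = subst (_∈p^ 1) (sym (nat-* q p)) (∈p^-*ˡ (int-nat q) p∈p^1)

  ≅-refl : ∀ {n x} → x ≅ x [ n ]
  ≅-refl {n} {x} = diff (subst (_∈p^ n) (sym (ℚ.+-inverseʳ x)) (∈p^-0 n))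

  ≅-reflexive : ∀ {n x y} → x ≡ y → x ≅ y [ n ]
  ≅-reflexive refl = ≅-refl

  ≅-sym : ∀ {n x y} → x ≅ y [ n ] → y ≅ x [ n ]
  ≅-sym {n} {x} {y} (diff h) = diff (subst (_∈p^ n) (solve 2 (λ x y → :- (x :- y) := y :- x) refl x y) (∈p^-neg h))

  ≅-trans : ∀ {n x y z} → x ≅ y [ n ] → y ≅ z [ n ] → x ≅ z [ n ]
  ≅-trans {n} {x} {y} {z} (diff h) (diff k) = diff (subst (_∈p^ n)
    (solve 3 (λ x y z → (x :- y) :+ (y :- z) := x :- z) refl x y z) (∈p^-+ h k))

  ≅-setoid : ℕ → Setoid 0ℓ 0ℓ
  ≅-setoid n = record
    { Carrier = ℚ ; _≈_ = _≅_[ n ]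
    ; isEquivalence = record { refl = ≅-refl ; sym = ≅-sym ; trans = ≅-trans } }

  module ≅-Reasoning n = SetoidReasoning (≅-setoid n)

  ≅-weaken : ∀ {m n x y} → m ≤ n → x ≅ y [ n ] → x ≅ y [ m ]
  ≅-weaken m≤n (diff h) = diff (∈p^-weaken m≤n h)

  ≅-+ : ∀ {n x y z w} → x ≅ y [ n ] → z ≅ w [ n ] → x + z ≅ y + w [ n ]
  ≅-+ {n} {x} {y} {z} {w} (diff h) (diff k) = diff (subst (_∈p^ n)
    (solve 4 (λ x y z w → (x :- y) :+ (z :- w) := (x :+ z) :- (y :+ w)) refl x y z w) (∈p^-+ h k))

  ≅-neg : ∀ {n x y} → x ≅ y [ n ] → - x ≅ - y [ n ]
  ≅-neg {n} {x} {y} (diff h) = diff (subst (_∈p^ n)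
    (solve 2 (λ x y → :- (x :- y) := (:- x) :- (:- y)) refl x y) (∈p^-neg h))

  ≅-+ˡ : ∀ {n x y} c → x ≅ y [ n ] → c + x ≅ c + y [ n ]
  ≅-+ˡ c = ≅-+ (≅-refl {x = c})

  ≅-+ʳ : ∀ {n x y} c → x ≅ y [ n ] → x + c ≅ y + c [ n ]
  ≅-+ʳ c h = ≅-+ h (≅-refl {x = c})

  ≅-- : ∀ {n x y z w} → x ≅ y [ n ] → z ≅ w [ n ] → x - z ≅ y - w [ n ]
  ≅-- h k = ≅-+ h (≅-neg k)

  ≅-*ˡ : ∀ {n c x y} → Int c → x ≅ y [ n ] → c * x ≅ c * y [ n ]
  ≅-*ˡ {n} {c} {x} {y} hc (diff h) = diff (subst (_∈p^ n)
    (solve 3 (λ c x y → c :* (x :- y) := c :* x :- c :* y) refl c x y) (∈p^-*ˡ hc h))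

  ≅-*ʳ : ∀ {n c x y} → Int c → x ≅ y [ n ] → x * c ≅ y * c [ n ]
  ≅-*ʳ {n} {c} {x} {y} hc (diff h) = diff (subst (_∈p^ n)
    (solve 3 (λ c x y → (x :- y) :* c := x :* c :- y :* c) refl c x y) (∈p^-*ʳ h hc))

  ≅-* : ∀ {n x y z w} → Int y → Int z → x ≅ y [ n ] → z ≅ w [ n ] → x * z ≅ y * w [ n ]
  ≅-* hy hz h k = ≅-trans (≅-*ʳ hz h) (≅-*ˡ hy k)

  ≅-Σ : ∀ {s} n f g → (∀ k → k < n → f k ≅ g k [ s ]) → Σ< n f ≅ Σ< n g [ s ]
  ≅-Σ zero    f g h = ≅-refl
  ≅-Σ (suc n) f g h = ≅-+ (h 0 ℕ.z<s) (≅-Σ n (f ∘ suc) (g ∘ suc) (λ k k<n → h (suc k) (ℕ.s<s k<n)))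

  ≅-^ : ∀ {s x y} n → Int x → Int y → x ≅ y [ s ] → x ^ n ≅ y ^ n [ s ]
  ≅-^ zero    hx hy h = ≅-refl
  ≅-^ (suc n) hx hy h = ≅-* hy (int-^ n hx) h (≅-^ n hx hy h)

  ≅⇒int : ∀ {s x y} → x ≅ y [ s ] → Int y → Int x
  ≅⇒int {s} {x} {y} (diff h) k = subst Int (solve 2 (λ x y → (x :- y) :+ y := x) refl x y)
    (∈p^-+ (∈p^-weaken ℕ.z≤n h) k)

  ∈p^⇒≅0 : ∀ {n x} → x ∈p^ n → x ≅ 0ℚ [ n ]
  ∈p^⇒≅0 {n} {x} h = diff (subst (_∈p^ n) (sym (ℚ.+-identityʳ x)) h)

  ≅0⇒∈p^ : ∀ {n x} → x ≅ 0ℚ [ n ] → x ∈p^ n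
  ≅0⇒∈p^ {n} {x} (diff h) = subst (_∈p^ n) (ℚ.+-identityʳ x) h

  -- The theorems of Fermat and Euler, and approximation by positive integers

  p∤< : ∀ {k} .{{_ : NonZero k}} → k < p → p ∤ k
  p∤< {k} k<p p∣k = ℕ.<⇒≱ k<p (∣⇒≤ p∣k)

  p∤! : ∀ k → k < p → p ∤ k !
  p∤! zero    _   = p∤1
  p∤! (suc k) k<p = p∤* (p∤< k<p) (p∤! k (ℕ.<-trans (ℕ.n<1+n k) k<p))

  -- p divides p! = C(p,k) k! (p-k)! but neither of the two factorials.
  p∣C : ∀ k → 0 < k → k < p → p ∣ p C k
  p∣C k 0<k k<p with euclidsLemma (p C k) (k ! ℕ.* (p ∸ k) !) pr (subst (p ∣_) (sym C*≡p!) (p∣n! p))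
    where
    p∣n! : ∀ n .{{_ : NonZero n}} → n ∣ n !
    p∣n! (suc n) = m∣m*n (n !)
    instance
      _ = k ℕ.!* (p ∸ k) !≢0
    C*≡p! : (p C k) ℕ.* (k ! ℕ.* (p ∸ k) !) ≡ p !
    C*≡p! = trans (cong (ℕ._* (k ! ℕ.* (p ∸ k) !)) (nCk≡n!/k![n-k]! (ℕ.<⇒≤ k<p)))
      (ℕ.m/n*n≡m (k![n∸k]!∣n! (ℕ.<⇒≤ k<p)))
  ... | inj₁ h = h
  ... | inj₂ h = contradiction h (p∤* (p∤! k k<p) (p∤! (p ∸ k) (ℕ.∸-monoʳ-< 0<k (ℕ.<⇒≤ k<p))))

  fermat : ∀ k → nat k ^ p ≅ nat k [ 1 ]
  fermat zero    = ≅-reflexive (trans (0^ p) (δ₀-p p))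
    where
    δ₀-p : ∀ n .{{_ : NonZero n}} → δ₀ n ≡ 0ℚ
    δ₀-p (suc n) = refl
  fermat (suc k) = begin
    nat (suc k) ^ p                                ≡⟨ cong (_^ p) (nat-suc k) ⟩
    (x + 1ℚ) ^ p                                   ≡⟨ ^-⋆ x 1ℚ p ⟨
    ((x ^_) ⋆ (1ℚ ^_)) p                           ≡⟨ ⋆-binomial (x ^_) (1ℚ ^_) p ⟩
    Σ< (suc p) T                                   ≡⟨ Σ<-snoc p T ⟩
    Σ< p T + T p                                   ≡⟨ cong (λ z → Σ< z T + T p) (ℕ.suc-pred p) ⟨
    T 0 + Σ< (ℕ.pred p) (T ∘ suc) + T p
      ≈⟨ ≅-+ʳ (T p) (≅-+ˡ (T 0) (∈p^⇒≅0 (∈p^-Σ (ℕ.pred p) (T ∘ suc) middle))) ⟩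
    T 0 + 0ℚ + T p                                 ≡⟨ cong₂ (λ z w → z + 0ℚ + w) T0 Tp ⟩
    1ℚ + 0ℚ + x ^ p                                ≈⟨ ≅-+ˡ (1ℚ + 0ℚ) (fermat k) ⟩
    1ℚ + 0ℚ + x                                    ≡⟨ solve 1 (λ x → con 1ℚ :+ con 0ℚ :+ x := x :+ con 1ℚ) refl x ⟩
    x + 1ℚ                                         ≡⟨ nat-suc k ⟨
    nat (suc k)                                    ∎
    where
    open ≅-Reasoning 1
    x = nat k
    T : ℕ → ℚ
    T j = nat (p C j) * (x ^ j * 1ℚ ^ (p ∸ j))
    middle : ∀ j → j < ℕ.pred p → T (suc j) ∈p^ 1
    middle j j<q = ∈p^-*ʳ (∣⇒∈p^1 (p∣C (suc j) ℕ.z<s (subst (suc j <_) (ℕ.suc-pred p) (ℕ.s<s j<q))))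
      (∈p^-* (int-^ (suc j) (int-nat k)) (int-^ (p ∸ suc j) (int-nat 1)))
    T0 : T 0 ≡ 1ℚ
    T0 = trans (cong (λ c → nat c * (1ℚ * 1ℚ ^ p)) (nC0≡1 p)) (cong (λ z → 1ℚ * (1ℚ * z)) (1^ p))
    Tp : T p ≡ x ^ p
    Tp = trans (cong₂ (λ c z → nat c * (x ^ p * z)) (nCn≡1 p) (1^ (p ∸ p)))
      (solve 1 (λ z → con 1ℚ :* (z :* con 1ℚ) := z) refl (x ^ p))

  fermat-unit : ∀ k → p ∤ k → nat k ^ (p ∸ 1) ≅ 1ℚ [ 1 ]
  fermat-unit zero      p∤k = contradiction (p ∣0) p∤k
  fermat-unit k@(suc _) p∤k = begin
    y                             ≡⟨ ℚ.*-identityˡ y ⟨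
    1ℚ * y                        ≡⟨ cong (_* y) (inv-* k) ⟨
    inv k * nat k * y             ≡⟨ ℚ.*-assoc (inv k) (nat k) y ⟩
    inv k * (nat k * y)
      ≡⟨ cong (λ n → inv k * nat k ^ n) (trans (ℕ.+-comm 1 (p ∸ 1)) (ℕ.m∸n+n≡m (ℕ.>-nonZero⁻¹ p))) ⟩
    inv k * nat k ^ p             ≈⟨ ≅-*ˡ (int-inv k p∤k) (fermat k) ⟩
    inv k * nat k                 ≡⟨ inv-* k ⟩
    1ℚ                            ∎
    where
    open ≅-Reasoning 1
    y = nat k ^ (p ∸ 1)

  geometric : ∀ x n → x ^ n - 1ℚ ≡ (x - 1ℚ) * Σ< n (x ^_)
  geometric x zero    = sym (ℚ.*-zeroʳ (x - 1ℚ))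
  geometric x (suc n) = begin
    x * x ^ n - 1ℚ
      ≡⟨ solve 2 (λ x y → x :* y :- con 1ℚ := (x :- con 1ℚ) :* y :+ (y :- con 1ℚ)) refl x (x ^ n) ⟩
    (x - 1ℚ) * x ^ n + (x ^ n - 1ℚ)             ≡⟨ cong (λ z → (x - 1ℚ) * x ^ n + z) (geometric x n) ⟩
    (x - 1ℚ) * x ^ n + (x - 1ℚ) * Σ< n (x ^_)
      ≡⟨ solve 3 (λ a b c → a :* b :+ a :* c := a :* (c :+ b)) refl (x - 1ℚ) (x ^ n) (Σ< n (x ^_)) ⟩
    (x - 1ℚ) * (Σ< n (x ^_) + x ^ n)            ≡⟨ cong ((x - 1ℚ) *_) (Σ<-snoc n (x ^_)) ⟨
    (x - 1ℚ) * Σ< (suc n) (x ^_)                ∎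
    where open ≡-Reasoning

  -- x^p - 1 is x - 1 times a sum of p powers of x. Each power is 1 modulo p, so the sum is ≡ p ≡ 0
  -- and supplies one more factor p.
  lift-exponent : ∀ {x} s → Int x → x ≅ 1ℚ [ suc s ] → x ^ p ≅ 1ℚ [ suc (suc s) ]
  lift-exponent {x} s hx h = diff (subst₂ _∈p^_ (sym (geometric x p)) (ℕ.+-comm (suc s) 1)
    (∈p^-* (undiff h) (≅0⇒∈p^ total)))
    where
    open ≅-Reasoning 1
    Σ1≡ : ∀ n → Σ< n (1ℚ ^_) ≡ nat n
    Σ1≡ zero    = refl
    Σ1≡ (suc n) = trans (Σ<-snoc n (1ℚ ^_)) (trans (cong₂ _+_ (Σ1≡ n) (1^ n)) (sym (nat-suc n)))
    total : Σ< p (x ^_) ≅ 0ℚ [ 1 ]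
    total = begin
      Σ< p (x ^_)   ≈⟨ ≅-Σ p (x ^_) (1ℚ ^_) (λ k _ → ≅-^ k hx (int-nat 1) (≅-weaken (ℕ.s≤s ℕ.z≤n) h)) ⟩
      Σ< p (1ℚ ^_)  ≡⟨ Σ1≡ p ⟩
      nat p         ≈⟨ ∈p^⇒≅0 p∈p^1 ⟩
      0ℚ            ∎

  -- Euler's theorem modulo p^(s+1): it starts from Fermat, and each further factor p in the
  -- exponent is one use of `lift-exponent`.
  totient : ∀ s k → p ∤ k → nat k ^ ((p ∸ 1) ℕ.* p ℕ.^ s) ≅ 1ℚ [ suc s ]
  totient zero    k p∤k = subst (λ e → nat k ^ e ≅ 1ℚ [ 1 ]) (sym (ℕ.*-identityʳ (p ∸ 1))) (fermat-unit k p∤k)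
  totient (suc s) k p∤k = subst (λ y → y ≅ 1ℚ [ suc (suc s) ])
    (trans (^-assocʳ (nat k) ((p ∸ 1) ℕ.* p ℕ.^ s) p)
      (cong (nat k ^_) (trans (ℕ.*-assoc (p ∸ 1) (p ℕ.^ s) p) (cong ((p ∸ 1) ℕ.*_) (ℕ.*-comm (p ℕ.^ s) p)))))
    (lift-exponent s (int-^ ((p ∸ 1) ℕ.* p ℕ.^ s) (int-nat k)) (totient s k p∤k))

  -- With d the denominator of r and e the totient, r ≡ r d^e, which is the integer ↥r · d^(e-1). A
  -- negative integer is made nonnegative by replacing -1 with q - 1, where q = p^(s+1), and adding
  -- q makes it positive. Positivity matters because the induction on integers begins at 1.
  approx : ∀ r → Int r → ∀ s → ∃ λ m → r ≅ nat (suc m) [ suc s ]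
  approx r hr s = let m , h = /1-approx z in ℕ.pred (m ℕ.+ p ℕ.^ suc s) , (begin
    r                       ≡⟨ ℚ.*-identityʳ r ⟨
    r * 1ℚ                  ≈⟨ ≅-*ˡ hr (totient s d (unint hr)) ⟨
    r * nat d ^ e           ≡⟨ cong (λ n → r * nat d ^ n) (ℕ.suc-pred e {{e≢0}}) ⟨
    r * (nat d * y)         ≡⟨ ℚ.*-assoc r (nat d) y ⟨
    r * nat d * y           ≡⟨ cong (_* y) r*d ⟩
    (↥ r / 1) * y
      ≡⟨ trans (/1-* (↥ r) (+ (d ℕ.^ ℕ.pred e))) (cong (λ w → (↥ r / 1) * w) (nat-^ d (ℕ.pred e))) ⟨
    z / 1                   ≈⟨ h ⟩
    nat m                   ≡⟨ ℚ.+-identityʳ (nat m) ⟨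
    nat m + 0ℚ              ≈⟨ ≅-+ˡ (nat m) (∈p^⇒≅0 q∈) ⟨
    nat m + nat q           ≡⟨ nat-+ m q ⟨
    nat (m ℕ.+ q)
      ≡⟨ cong nat (ℕ.suc-pred (m ℕ.+ q) {{ℕ.>-nonZero (ℕ.<-≤-trans (ℕ.m^n>0 p (suc s)) (ℕ.m≤n+m q m))}}) ⟨
    nat (suc (ℕ.pred (m ℕ.+ q))) ∎)
    where
    open ≅-Reasoning (suc s)
    q = p ℕ.^ suc s
    q∈ : nat q ∈p^ suc s
    q∈ = subst (_∈p^ suc s) (sym (nat-^ p (suc s))) (p^∈p^ (suc s))
    d = ↧ₙ r
    e = (p ∸ 1) ℕ.* p ℕ.^ s
    e≢0 : NonZero e
    e≢0 = ℕ.m*n≢0 (p ∸ 1) (p ℕ.^ s) {{ℕ.>-nonZero (ℕ.m<n⇒0<n∸m (ℕ.nonTrivial⇒n>1 p {{prime⇒nonTrivial pr}}))}}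
        {{ℕ.m^n≢0 p s}}
    y = nat d ^ ℕ.pred e
    z = ↥ r ℤ.* + (d ℕ.^ ℕ.pred e)
    r*d : r * nat d ≡ ↥ r / 1
    r*d = trans (cong (_* nat d) (sym (ℚ.↥p/↧p≡p r))) (/-*-cancel (↥ r) d)
    /1-approx : ∀ i → ∃ λ m → i / 1 ≅ nat m [ suc s ]
    /1-approx (+ n)      = n , ≅-refl
    /1-approx (-[1+ n ]) = suc n ℕ.* (q ∸ 1) , (begin
      -[1+ n ] / 1               ≡⟨ /1-neg (+ suc n) ⟩
      - nat (suc n)              ≡⟨ solve 1 (λ x → :- x := x :* (con 0ℚ :- con 1ℚ)) refl (nat (suc n)) ⟩
      nat (suc n) * (0ℚ - 1ℚ)    ≈⟨ ≅-*ˡ (int-nat (suc n)) (≅-+ʳ (- 1ℚ) (∈p^⇒≅0 q∈)) ⟨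
      nat (suc n) * (nat q - 1ℚ) ≡⟨ cong (nat (suc n) *_) (nat-∸ (ℕ.m^n>0 p (suc s))) ⟨
      nat (suc n) * nat (q ∸ 1)  ≡⟨ nat-* (suc n) (q ∸ 1) ⟨
      nat (suc n ℕ.* (q ∸ 1))    ∎)

  -- The coefficients `c k` need not be p-integral. For each one `clear` finds e with p^e · c k
  -- integral, so that a congruence of the powers modulo p^(s+e) is enough; N is the maximum over
  -- the finitely many k.
  ⋆-^-continuous : ∀ (c : ℕ → ℚ) n s → ∃ λ N → ∀ {r r′} → Int r → Int r′ → r ≅ r′ [ N ] →
                   (c ⋆ (r ^_)) n ≅ (c ⋆ (r′ ^_)) n [ s ]
  ⋆-^-continuous c n s = let N , h = terms (suc n) in N , λ {r} {r′} hr hr′ r≅r′ →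
    subst₂ (_≅_[ s ]) (sym (⋆-binomial c (r ^_) n)) (sym (⋆-binomial c (r′ ^_) n))
      (≅-Σ (suc n) (T r) (T r′) (λ k k<n → ≅-*ˡ (int-nat (n C k)) (h k k<n hr hr′ r≅r′)))
    where
    T : ℚ → ℕ → ℚ
    T r k = nat (n C k) * (c k * r ^ (n ∸ k))
    terms : ∀ m → ∃ λ N → ∀ k → k < m → ∀ {r r′} → Int r → Int r′ → r ≅ r′ [ N ] →
            c k * r ^ (n ∸ k) ≅ c k * r′ ^ (n ∸ k) [ s ]
    terms zero = 0 , λ k ()
    terms (suc m) with N , h ← terms m | e , hc ← clear _ (c m) refl = N ⊔ (s ℕ.+ e) , close
      where
      close : ∀ k → k < suc m → ∀ {r r′} → Int r → Int r′ → r ≅ r′ [ N ⊔ (s ℕ.+ e) ] →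
              c k * r ^ (n ∸ k) ≅ c k * r′ ^ (n ∸ k) [ s ]
      close k k<1+m {r} {r′} hr hr′ r≅r′ with ℕ.m<1+n⇒m<n∨m≡n k<1+m
      ... | inj₁ k<m  = h k k<m hr hr′ (≅-weaken (ℕ.m≤m⊔n N (s ℕ.+ e)) r≅r′)
      ... | inj₂ refl = diff (subst (_∈p^ s)
        (solve 3 (λ c x y → c :* (x :- y) := c :* x :- c :* y) refl (c k) (r ^ (n ∸ k)) (r′ ^ (n ∸ k)))
        (ball (ball-*ˡ s e {c k} {r ^ (n ∸ k) - r′ ^ (n ∸ k)} hc
          (unball (undiff (≅-^ (n ∸ k) hr hr′ (≅-weaken (ℕ.m≤n⊔m N (s ℕ.+ e)) r≅r′)))))))

-- Integrality of the summands, and continuity of both sums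

module Sums (p : ℕ) (pr : Prime p) (3<p : 3 < p) where

  open Rationals
  open import Data.Rational.Base using (_+_; _*_; -_; _-_)
  open +-*-Solver

  open Congruence p pr

  q : ℕ
  q = ℕ.pred p

  1+q≡p : suc q ≡ p
  1+q≡p = ℕ.suc-pred p

  <q⇒<p : ∀ {k} → k < q → suc k < p
  <q⇒<p {k} k<q = subst (suc k <_) 1+q≡p (ℕ.s<s k<q)

  p∤2 : p ∤ 2
  p∤2 = p∤< (ℕ.<-trans (ℕ.n<1+n 2) 3<p)

  int-½ : Int ½
  int-½ = int-inv 2 p∤2

  int-1/k² : ∀ k → p ∤ suc k → Int (1/k² k)
  int-1/k² k p∤ = ∈p^-* (int-inv (suc k) p∤) (int-inv (suc k) p∤)

  int-- : ∀ {x y} → Int x → Int y → Int (x - y)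
  int-- hx hy = ∈p^-+ hx (∈p^-neg hy)

  int-H : ∀ k → k < p → Int (H⁽²⁾ k)
  int-H k k<p = ∈p^-Σ k 1/k² (λ j j<k → int-1/k² j (p∤< (ℕ.≤-<-trans j<k k<p)))

  -- With x + y = p, the difference 1/x² - 1/y² = (x + y)(y - x)/(x²y²) contains the factor p.
  1/k²-reflect : ∀ j k → suc j ℕ.+ suc k ≡ p → 1/k² j ≅ 1/k² k [ 1 ]
  1/k²-reflect j k eq = diff (subst (_∈p^ 1) identity
    (∈p^-*ˡ (∈p^-* (int-1/k² j (p∤< j<)) (int-1/k² k (p∤< k<)))
      (∈p^-*ʳ (subst (_∈p^ 1) (trans (cong nat (sym eq)) (nat-+ (suc j) (suc k))) p∈p^1)
              (int-- (int-nat (suc k)) (int-nat (suc j))))))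
    where
    open ≡-Reasoning
    j< : suc j < p
    j< = subst (suc j <_) eq (ℕ.m<m+n (suc j) ℕ.z<s)
    k< : suc k < p
    k< = subst (suc k <_) eq (ℕ.m<n+m (suc k) ℕ.z<s)
    x = nat (suc j)
    y = nat (suc k)
    identity : 1/k² j * 1/k² k * ((x + y) * (y - x)) ≡ 1/k² j - 1/k² k
    identity = begin
      1/k² j * 1/k² k * ((x + y) * (y - x))
        ≡⟨ solve 4 (λ a b x y → a :* b :* ((x :+ y) :* (y :- x)) := a :* (b :* (y :* y)) :- b :* (a :* (x :* x))) refl
             (1/k² j) (1/k² k) x y ⟩
      1/k² j * (1/k² k * (y * y)) - 1/k² k * (1/k² j * (x * x))
        ≡⟨ cong₂ (λ v w → 1/k² j * v - 1/k² k * w) (1/k²-* k) (1/k²-* j) ⟩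
      1/k² j * 1ℚ - 1/k² k * 1ℚ
        ≡⟨ cong₂ _-_ (ℚ.*-identityʳ (1/k² j)) (ℚ.*-identityʳ (1/k² k)) ⟩
      1/k² j - 1/k² k ∎

  -- With p = 2n + 1, reflecting k ↦ p - k in the upper half gives H (2n) ≡ 2 H n, and reflecting
  -- the odd k gives H (2n) ≡ H n / 2.
  H-half : ∀ n → suc (2 ℕ.* n) ≡ p → H⁽²⁾ n ∈p^ 1
  H-half n eq = subst (_∈p^ 1)
    -- The two evaluations 2H and H/2 differ by 3H/2, so 2/3 of the difference is H. Here p > 3
    -- makes 3 invertible.
    (solve 1 (λ x → con (inv 3) :* con 2ℚ :* ((x :+ x) :- (con ½ :* con ½ :* x :+ con ½ :* con ½ :* x)) := x) refl H)
    (∈p^-*ˡ (∈p^-* (int-inv 3 (p∤< 3<p)) (int-nat 2)) (undiff (≅-trans (≅-sym halves) parities)))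
    where
    open ≅-Reasoning 1
    H = H⁽²⁾ n
    2n≡ : 2 ℕ.* n ≡ n ℕ.+ n
    2n≡ = cong (n ℕ.+_) (ℕ.+-identityʳ n)
    ¼ = ½ * ½
    partner : ∀ k → k < n → suc k ℕ.+ (n ∸ suc k) ≡ n
    partner k k<n = ℕ.m+[n∸m]≡n k<n
    upper : ∀ k → k < n → suc k ℕ.+ suc (n ℕ.+ (n ∸ suc k)) ≡ p
    upper k k<n = trans (ℕ.+-suc (suc k) _) (trans (cong suc (trans (sym (ℕ.+-assoc (suc k) n _))
      (trans (cong (ℕ._+ (n ∸ suc k)) (ℕ.+-comm (suc k) n)) (trans (ℕ.+-assoc n (suc k) _)
        (trans (cong (n ℕ.+_) (partner k k<n)) (sym 2n≡)))))) eq)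
    -- The odd number 2k+1 is reflected to the even number 2(n-k), so odd and even terms each
    -- contribute H/4.
    odd : ∀ k → k < n → suc (2 ℕ.* k) ℕ.+ suc (suc (2 ℕ.* (n ∸ suc k))) ≡ p
    odd k k<n = trans (cong suc (trans (cong (2 ℕ.* k ℕ.+_) (sym (ℕ.*-suc 2 (n ∸ suc k))))
      (trans (sym (ℕ.*-distribˡ-+ 2 k (suc (n ∸ suc k)))) (cong (2 ℕ.*_) (trans (ℕ.+-suc k _) (partner k k<n)))))) eq
    halves : H⁽²⁾ (2 ℕ.* n) ≅ H + H [ 1 ]
    halves = begin
      Σ< (2 ℕ.* n) 1/k²                               ≡⟨ cong (λ j → Σ< j 1/k²) 2n≡ ⟩
      Σ< (n ℕ.+ n) 1/k²                               ≡⟨ Σ<-++ n n 1/k² ⟩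
      H + Σ< n (λ k → 1/k² (n ℕ.+ k))                 ≡⟨ cong (λ z → H + z) (Σ<-reverse n (λ k → 1/k² (n ℕ.+ k))) ⟨
      H + Σ< n (λ k → 1/k² (n ℕ.+ (n ∸ suc k)))       ≈⟨ ≅-+ˡ H (≅-Σ n (λ k → 1/k² (n ℕ.+ (n ∸ suc k))) 1/k²
                                                           (λ k k<n → ≅-sym (1/k²-reflect k (n ℕ.+ (n ∸ suc k))
                                                               (upper k k<n)))) ⟩
      H + H                                           ∎
    1/k²-even : ∀ k → 1/k² (suc (2 ℕ.* k)) ≡ ¼ * 1/k² k
    1/k²-even k = trans (cong (λ i → i * i) inv-2*) (solve 2 (λ y i → y :* i :* (y :* i) := y :* y :* (i :* i)) refl ½
        (inv (suc k)))
      where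
      inv-2* : inv (2 ℕ.+ 2 ℕ.* k) ≡ ½ * inv (suc k)
      inv-2* = trans (inv-cong (sym (ℕ.*-suc 2 k))) (inv-*-homo 2 (suc k))
        where
        inv-cong : ∀ {i j} .{{_ : NonZero i}} .{{_ : NonZero j}} → i ≡ j → inv i ≡ inv j
        inv-cong refl = refl
    Σ-pairs : ∀ m → Σ< (2 ℕ.* m) 1/k² ≡ Σ< m (λ k → 1/k² (2 ℕ.* k) + 1/k² (suc (2 ℕ.* k)))
    Σ-pairs zero    = refl
    Σ-pairs (suc m) = trans (cong (λ j → Σ< j 1/k²) (ℕ.*-suc 2 m))
      (trans (Σ<-snoc (suc (2 ℕ.* m)) 1/k²) (trans (cong (_+ 1/k² (suc (2 ℕ.* m))) (Σ<-snoc (2 ℕ.* m) 1/k²))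
        (trans (ℚ.+-assoc (Σ< (2 ℕ.* m) 1/k²) (1/k² (2 ℕ.* m)) (1/k² (suc (2 ℕ.* m))))
          (trans (cong (_+ (1/k² (2 ℕ.* m) + 1/k² (suc (2 ℕ.* m)))) (Σ-pairs m))
            (sym (Σ<-snoc m (λ k → 1/k² (2 ℕ.* k) + 1/k² (suc (2 ℕ.* k)))))))))
    parities : H⁽²⁾ (2 ℕ.* n) ≅ ¼ * H + ¼ * H [ 1 ]
    parities = begin
      Σ< (2 ℕ.* n) 1/k²
        ≡⟨ Σ-pairs n ⟩
      Σ< n (λ k → 1/k² (2 ℕ.* k) + 1/k² (suc (2 ℕ.* k)))
        ≈⟨ ≅-Σ n _ (λ k → ¼ * 1/k² (n ∸ suc k) + ¼ * 1/k² k) (λ k k<n → ≅-+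
             (≅-trans (1/k²-reflect (2 ℕ.* k) (suc (2 ℕ.* (n ∸ suc k))) (odd k k<n))
                 (≅-reflexive (1/k²-even (n ∸ suc k))))
             (≅-reflexive (1/k²-even k))) ⟩
      Σ< n (λ k → ¼ * 1/k² (n ∸ suc k) + ¼ * 1/k² k)
        ≡⟨ Σ<-+ n (λ k → ¼ * 1/k² (n ∸ suc k)) (λ k → ¼ * 1/k² k) ⟩
      Σ< n (λ k → ¼ * 1/k² (n ∸ suc k)) + Σ< n (λ k → ¼ * 1/k² k)
        ≡⟨ cong₂ _+_ (trans (Σ<-*ˡ ¼ n (λ k → 1/k² (n ∸ suc k))) (cong (¼ *_) (Σ<-reverse n 1/k²))) (Σ<-*ˡ ¼ n 1/k²) ⟩
      ¼ * H + ¼ * H ∎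

  ∣2k+1⇒≡ : ∀ k → k < p → p ∣ suc (2 ℕ.* k) → suc (2 ℕ.* k) ≡ p
  ∣2k+1⇒≡ k k<p (divides zero ())
  ∣2k+1⇒≡ k k<p (divides (suc zero) e) = trans e (ℕ.+-identityʳ p)
  ∣2k+1⇒≡ k k<p (divides (suc (suc c)) e) = contradiction <2p (ℕ.≤⇒≯ (subst (2 ℕ.* p ≤_) (sym e)
    (ℕ.*-monoˡ-≤ p {2} {suc (suc c)} (ℕ.s≤s (ℕ.s≤s ℕ.z≤n)))))
    where
    <2p : suc (2 ℕ.* k) < 2 ℕ.* p
    <2p = ℕ.<-≤-trans (ℕ.n<1+n _) (ℕ.≤-trans (ℕ.≤-reflexive (sym (ℕ.*-suc 2 k))) (ℕ.*-monoʳ-≤ 2 k<p))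

  -- Since 2k+1 < 2p, the denominator is divisible by p only if it equals p. Then k = (p-1)/2, and
  -- `H-half` provides the factor p that cancels it.
  int-H/ : ∀ k → k < p → Int (H⁽²⁾ k * inv (suc (2 ℕ.* k)))
  int-H/ k k<p with p ∣? suc (2 ℕ.* k)
  ... | no p∤  = ∈p^-* (int-H k k<p) (int-inv (suc (2 ℕ.* k)) p∤)
  ... | yes p∣ = cancel (H⁽²⁾ k) (suc (2 ℕ.* k)) (∣2k+1⇒≡ k k<p p∣) (H-half k (∣2k+1⇒≡ k k<p p∣))
    where
    cancel : ∀ x n .{{_ : NonZero n}} → n ≡ p → x ∈p^ 1 → Int (x * inv n)
    cancel x n refl (ball (z , hz , refl)) = subst Int
        (trans (sym (ℚ.*-identityˡ z)) (trans (cong (_* z) (sym (inv-* n)))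
      (solve 3 (λ i n z → i :* n :* z := n :* con 1ℚ :* z :* i) refl (inv n) (nat n) z))) (int hz)

  -- For k < p the denominator k! is prime to p, so `binomℚ` is a polynomial with p-integral
  -- coefficients; this also gives `≅-binomℚ`.
  int-binomℚ : ∀ {x} k → k < p → Int x → Int (binomℚ x k)
  int-binomℚ     zero    _   hx = int-nat 1
  int-binomℚ {x} (suc k) k<p hx = subst Int (sym (binomℚ-suc x k))
    (∈p^-* (∈p^-* (int-binomℚ k (ℕ.<-trans (ℕ.n<1+n k) k<p) hx) (int-- hx (int-nat k))) (int-inv (suc k) (p∤< k<p)))

  ≅-binomℚ : ∀ {s x y} k → k < p → Int x → Int y → x ≅ y [ s ] → binomℚ x k ≅ binomℚ y k [ s ]
  ≅-binomℚ         zero    _   hx hy x≅y = ≅-refl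
  ≅-binomℚ {s} {x} {y} (suc k) k<p hx hy x≅y = subst₂ (_≅_[ s ]) (sym (binomℚ-suc x k)) (sym (binomℚ-suc y k))
    (≅-*ʳ (int-inv (suc k) (p∤< k<p))
      (≅-* (int-binomℚ k k′ hy) (int-- hx (int-nat k)) (≅-binomℚ k k′ hx hy x≅y) (≅-+ʳ (- nat k) x≅y)))
    where
    k′ = ℕ.<-trans (ℕ.n<1+n k) k<p

  ≅-u : ∀ {s x y} k → k < p → Int x → Int y → x ≅ y [ s ] → u k x ≅ u k y [ s ]
  ≅-u k k<p hx hy x≅y = ≅-* (int-binomℚ k k<p (∈p^-neg hy)) (int-binomℚ k k<p (int-- hx (int-nat 1)))
    (≅-binomℚ k k<p (∈p^-neg hx) (∈p^-neg hy) (≅-neg x≅y))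
    (≅-binomℚ k k<p (int-- hx (int-nat 1)) (int-- hy (int-nat 1)) (≅-+ʳ (- 1ℚ) x≅y))

  int-u : ∀ {x} k → k < p → Int x → Int (u k x)
  int-u k k<p hx = ∈p^-* (int-binomℚ k k<p (∈p^-neg hx)) (int-binomℚ k k<p (int-- hx (int-nat 1)))

  int-Φ : ∀ {x} → Int x → Int (Φ p x)
  int-Φ hx = ∈p^-Σ p _ (λ k k<p → ∈p^-* (int-u k k<p hx) (int-H k k<p))

  int-Σ-H/ : ∀ {x} → Int x → Int (Σ< p (λ k → u k x * (H⁽²⁾ k * inv (suc (2 ℕ.* k)))))
  int-Σ-H/ hx = ∈p^-Σ p _ (λ k k<p → ∈p^-* (int-u k k<p hx) (int-H/ k k<p))

  int-Ψ : ∀ {x} → Int x → Int (Ψ p x)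
  int-Ψ hx = ∈p^-* (int-- (∈p^-* (int-nat 2) hx) (int-nat 1)) (int-Σ-H/ hx)

  Φ-cong : ∀ {s x y} → Int x → Int y → x ≅ y [ s ] → Φ p x ≅ Φ p y [ s ]
  Φ-cong {s} {x} {y} hx hy x≅y = ≅-Σ p (λ k → u k x * H⁽²⁾ k) (λ k → u k y * H⁽²⁾ k)
    (λ k k<p → ≅-*ʳ (int-H k k<p) (≅-u k k<p hx hy x≅y))

  Ψ-cong : ∀ {s x y} → Int x → Int y → x ≅ y [ s ] → Ψ p x ≅ Ψ p y [ s ]
  Ψ-cong {s} {x} {y} hx hy x≅y = ≅-*
    (int-- (∈p^-* (int-nat 2) hy) (int-nat 1))
    (int-Σ-H/ hx)
    (≅-+ʳ (- 1ℚ) (≅-*ˡ (int-nat 2) x≅y))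
    (≅-Σ p (λ k → u k x * (H⁽²⁾ k * inv (suc (2 ℕ.* k)))) (λ k → u k y * (H⁽²⁾ k * inv (suc (2 ℕ.* k))))
      (λ k k<p → ≅-*ʳ (int-H/ k k<p) (≅-u k k<p hx hy x≅y)))

  -- Divisibility of the product `G` by p²

  factor : ℚ → ℕ → ℚ
  factor a k = 1ℚ - a * a * 1/k² k

  int-factor : ∀ {a} k → suc k < p → Int a → Int (factor a k)
  int-factor k k<p ha = int-- (int-nat 1) (∈p^-* (∈p^-* ha ha) (int-1/k² k (p∤< k<p)))

  int-G : ∀ {a} n → n < p → Int a → Int (G n a)
  int-G zero    _   ha = int-nat 1
  int-G (suc n) n<p ha = ∈p^-* (int-G n (ℕ.<-trans (ℕ.n<1+n n) n<p) ha) (int-factor n n<p ha)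

  -- 1 - a²/n² = (n - a)(n + a)/n² with n = k+1 prime to p.
  factor∈ : ∀ {a} k → suc k < p → Int a → (nat (suc k) - a) * (nat (suc k) + a) ∈p^ 1 → factor a k ∈p^ 1
  factor∈ {a} k k<p ha hyp = subst (_∈p^ 1)
    (trans (solve 3 (λ n a i → (n :- a) :* (n :+ a) :* i := i :* (n :* n) :- a :* a :* i) refl (nat (suc k)) a
        (1/k² k))
           (cong (_- a * a * 1/k² k) (1/k²-* k)))
    (∈p^-*ʳ hyp (int-1/k² k (p∤< k<p)))

  G∈p^1 : ∀ {a} i n → i < n → n < p → Int a → factor a i ∈p^ 1 → G n a ∈p^ 1
  G∈p^1 i (suc n) i<1+n n<p ha hi with ℕ.m<1+n⇒m<n∨m≡n i<1+n
  ... | inj₁ i<n  = ∈p^-*ʳ (G∈p^1 i n i<n (ℕ.<-trans (ℕ.n<1+n n) n<p) ha hi) (int-factor n n<p ha)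
  ... | inj₂ refl = ∈p^-*ˡ (int-G n (ℕ.<-trans (ℕ.n<1+n n) n<p) ha) hi

  G∈p^2 : ∀ {a} i j n → i < j → j < n → n < p → Int a → factor a i ∈p^ 1 → factor a j ∈p^ 1 → G n a ∈p^ 2
  G∈p^2 i j (suc n) i<j j<1+n n<p ha hi hj with ℕ.m<1+n⇒m<n∨m≡n j<1+n
  ... | inj₁ j<n  = ∈p^-*ʳ (G∈p^2 i j n i<j j<n (ℕ.<-trans (ℕ.n<1+n n) n<p) ha hi hj) (int-factor n n<p ha)
  ... | inj₂ refl = ∈p^-* (G∈p^1 i n i<j (ℕ.<-trans (ℕ.n<1+n n) n<p) ha hi) hj

  q<p : q < p
  q<p = subst (q <_) 1+q≡p (ℕ.n<1+n q)

  -- The factors of G q a at the residues of ±a are both divisible by p.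
  Gq∈p^2 : ∀ m → p ∤ m → G q (nat m) ∈p^ 2
  Gq∈p^2 m p∤m with m ℕ.% p in eqc | ℕ.m%n<n m p | ℕ.m≡m%n+[m/n]*n m p
  ... | zero  | _   | _ = contradiction (m%n≡0⇒n∣m m p eqc) p∤m
  ... | suc i | i<p | m≡ with p ∸ suc i in eqd | ℕ.m+[n∸m]≡n (ℕ.<⇒≤ i<p)
  ...   | zero  | sum≡ = contradiction (trans (sym (ℕ.+-identityʳ (suc i))) sum≡) (ℕ.<⇒≢ i<p)
  ...   | suc j | sum≡ = split (ℕ.<-cmp i j)
    where
    ha = int-nat m
    j<p : suc j < p
    j<p = subst (suc j <_) sum≡ (ℕ.m<n+m (suc j) ℕ.z<s)
    kp = (m ℕ./ p) ℕ.* p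
    hkp : nat kp ∈p^ 1
    hkp = ∣⇒∈p^1 (n∣m*n (m ℕ./ p))
    a≡ : nat m ≡ nat (suc i) + nat kp
    a≡ = trans (cong nat m≡) (nat-+ (suc i) kp)
    hi : factor (nat m) i ∈p^ 1
    hi = factor∈ i i<p ha (∈p^-*ʳ (subst (_∈p^ 1)
      (trans (solve 2 (λ c k → :- k := c :- (c :+ k)) refl (nat (suc i)) (nat kp))
          (cong (λ z → nat (suc i) - z) (sym a≡)))
      (∈p^-neg hkp)) (∈p^-+ (int-nat (suc i)) ha))
    hj : factor (nat m) j ∈p^ 1
    hj = factor∈ j j<p ha (∈p^-*ˡ (int-- (int-nat (suc j)) ha) (subst (_∈p^ 1)
      (trans (cong (_+ nat kp) (trans (cong nat (sym sum≡)) (nat-+ (suc i) (suc j))))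
        (trans (solve 3 (λ c d k → c :+ d :+ k := d :+ (c :+ k)) refl (nat (suc i)) (nat (suc j)) (nat kp))
               (cong (λ z → nat (suc j) + z) (sym a≡))))
      (∈p^-+ p∈p^1 hkp)))
    <q : ∀ {k} → suc k < p → k < q
    <q {k} k<p = ℕ.s<s⁻¹ (subst (suc k <_) (sym 1+q≡p) k<p)
    split : _ → G q (nat m) ∈p^ 2
    split (tri< i<j _ _)  = G∈p^2 i j q i<j (<q j<p) q<p ha hi hj
    split (tri> _ _ j<i)  = G∈p^2 j i q j<i (<q i<p) q<p ha hj hi
    -- Equal indices would give p = 2(i+1), but p divides neither 2 nor i+1. So the two factors of
    -- `G` are distinct.
    split (tri≈ _ refl _) = contradiction
      (subst (p ∣_) (trans (sym sum≡) (cong (suc i ℕ.+_) (sym (ℕ.+-identityʳ (suc i))))) ∣-refl)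
      (p∤* {2} {suc i} p∤2 (p∤< i<p))

  -- Both sums at positive integers, modulo p²

  term : (ℕ → ℤ) → ℕ → ℚ
  term c k = if does (p ∣? suc k) then 0ℚ else (c (suc k) / 1) * 1/k² k

  term-∣ : ∀ c k → p ∣ suc k → term c k ≡ 0ℚ
  term-∣ c k p∣ = cong (if_then 0ℚ else (c (suc k) / 1) * 1/k² k) (dec-true (p ∣? suc k) p∣)

  term-∤ : ∀ c k → p ∤ suc k → term c k ≡ (c (suc k) / 1) * 1/k² k
  term-∤ c k p∤ = cong (if_then 0ℚ else (c (suc k) / 1) * 1/k² k) (dec-false (p ∣? suc k) p∤)

  term-neg : ∀ c c′ k → c (suc k) ≡ ℤ.- c′ (suc k) → term c k ≡ - term c′ k
  term-neg c c′ k eq with does (p ∣? suc k)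
  ... | true  = refl
  ... | false = trans (cong (λ z → (z / 1) * 1/k² k) eq) (trans (cong (_* 1/k² k) (/1-neg (c′ (suc k))))
                  (sym (ℚ.neg-distribˡ-* (c′ (suc k) / 1) (1/k² k))))

  int-term : ∀ c k → Int (term c k)
  int-term c k with p ∣? suc k
  ... | yes p∣ = int-nat 0
  ... | no p∤  = ∈p^-* (int-/1 (c (suc k))) (int-1/k² k p∤)

  one : ℕ → ℤ
  one _ = 1ℤ

  sgn : ℕ → ℕ → ℤ
  sgn m k = -1ℤ ℤ.^ (m ∸ k)

  -- The bound is shifted by one: `T m` and `S m` belong to the positive integer m+1, and both are
  -- empty sums at m = 0.
  T S : ℕ → ℚ
  T m = sumPrimeTo p (suc m) one
  S m = sumPrimeTo p (suc m) (sgn (suc m))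

  T-suc : ∀ m → T (suc m) ≡ T m + term one m
  T-suc m = Σ<-snoc m (term one)

  -- Raising the bound flips every sign (-1)^(m-k), and the new last term has exponent 1.
  S-suc : ∀ m → S (suc m) ≡ - S m - term one m
  S-suc m = begin
    Σ< (suc m) (term (sgn (2 ℕ.+ m)))
      ≡⟨ Σ<-snoc m (term (sgn (2 ℕ.+ m))) ⟩
    Σ< m (term (sgn (2 ℕ.+ m))) + term (sgn (2 ℕ.+ m)) m
      ≡⟨ cong₂ _+_ (Σ<-cong m (λ k k<m → trans (term-neg (sgn (2 ℕ.+ m)) (sgn (suc m)) k (flip k k<m))
                     (solve 1 (λ x → :- x := con -1ℚ :* x) refl (term (sgn (suc m)) k))))
                   (term-neg (sgn (2 ℕ.+ m)) one m last) ⟩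
    Σ< m (λ k → -1ℚ * term (sgn (suc m)) k) - term one m
      ≡⟨ cong (_- term one m) (Σ<-*ˡ -1ℚ m (term (sgn (suc m)))) ⟩
    -1ℚ * S m - term one m
      ≡⟨ cong (_- term one m) (solve 1 (λ x → con -1ℚ :* x := :- x) refl (S m)) ⟩
    - S m - term one m ∎
    where
    open ≡-Reasoning
    flip : ∀ k → k < m → sgn (2 ℕ.+ m) (suc k) ≡ ℤ.- sgn (suc m) (suc k)
    flip k k<m = trans (cong (-1ℤ ℤ.^_) (ℕ.+-∸-assoc 1 (ℕ.<⇒≤ k<m))) (ℤ.-1*i≡-i (sgn (suc m) (suc k)))
    last : sgn (2 ℕ.+ m) (suc m) ≡ ℤ.- 1ℤ
    last = cong (-1ℤ ℤ.^_) (trans (ℕ.+-∸-assoc 1 {m} ℕ.≤-refl) (cong suc (ℕ.n∸n≡0 m)))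

  int-T : ∀ m → Int (T m)
  int-T m = ∈p^-Σ m (term one) (λ k _ → int-term one k)

  ΔΦ≅ : ∀ m → ΔΦ q (nat (suc m)) ≅ - (2ℚ * term one m) [ 2 ]
  ΔΦ≅ m with toSum (p ∣? suc m)
  ... | inj₁ p∣ = subst (λ z → ΔΦ q a ≅ - (2ℚ * z) [ 2 ]) (sym (term-∣ one m p∣))
    (∈p^⇒≅0 (∈p^-Σ q (λ k → ΔG k a * H⁽²⁾ (suc k))
        (λ k k<q → ∈p^-*ʳ (ΔG∈ k (<q⇒<p k<q)) (int-H (suc k) (<q⇒<p k<q)))))
    where
    a = nat (suc m)
    ha = int-nat (suc m)
    -- Each increment of `G` contains the factor a², which is divisible by p² when p divides a.
    ΔG∈ : ∀ k → suc k < p → ΔG k a ∈p^ 2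
    ΔG∈ k k<p = subst (_∈p^ 2)
      (solve 3 (λ a g i → a :* a :* (con 2ℚ :* (:- (g :* i))) := con 2ℚ :* (g :* (con 1ℚ :- a :* a :* i) :- g)) refl a
          (G k a) (1/k² k))
      (∈p^-*ʳ (∈p^-* (∣⇒∈p^1 p∣) (∣⇒∈p^1 p∣))
        (∈p^-* (int-nat 2) (∈p^-neg (∈p^-* (int-G k (ℕ.<-trans (ℕ.n<1+n k) k<p) ha) (int-1/k² k (p∤< k<p))))))
  ... | inj₂ p∤ = begin
    ΔΦ q a                                  ≡⟨ ℚ.*-identityˡ (ΔΦ q a) ⟨
    1ℚ * ΔΦ q a                             ≡⟨ cong (_* ΔΦ q a) (1/k²-* m) ⟨
    i * (a * a) * ΔΦ q a                    ≡⟨ ℚ.*-assoc i (a * a) (ΔΦ q a) ⟩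
    i * (a * a * ΔΦ q a)                    ≡⟨ cong (i *_) (ΔΦ-abel q a) ⟩
    i * (2ℚ * (a * a * H⁽²⁾ q * g + g - 1ℚ))
      ≡⟨ cong (λ z → i * (2ℚ * (z - 1ℚ))) (solve 2 (λ x g → x :* g :+ g := (x :+ con 1ℚ) :* g) refl
           (a * a * H⁽²⁾ q) g) ⟩
    i * (2ℚ * ((a * a * H⁽²⁾ q + 1ℚ) * g - 1ℚ)) ≈⟨ ≅-*ˡ (int-1/k² m p∤) (≅-*ˡ (int-nat 2) (≅-+ʳ (- 1ℚ) (∈p^⇒≅0
                                                  (∈p^-*ˡ (∈p^-+ (∈p^-* (∈p^-* ha ha) (int-H q q<p)) (int-nat 1))
                                                      (Gq∈p^2 (suc m) p∤))))) ⟩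
    i * (2ℚ * (0ℚ - 1ℚ))
      ≡⟨ solve 1 (λ i → i :* (con 2ℚ :* (con 0ℚ :- con 1ℚ)) := :- (con 2ℚ :* (con 1ℚ :* i))) refl i ⟩
    - (2ℚ * (1ℚ * i))                      ≡⟨ cong (λ z → - (2ℚ * z)) (term-∤ one m p∤) ⟨
    - (2ℚ * term one m)                    ∎
    where
    open ≅-Reasoning 2
    a = nat (suc m)
    ha = int-nat (suc m)
    i = 1/k² m
    g = G q a

  Φ≅S : ∀ m → Φ (suc q) (nat (suc m)) ≅ 2ℚ * S m [ 2 ]
  Φ≅S zero    = ≅-reflexive (Φ-1 (suc q))
  Φ≅S (suc m) = begin
    Φ (suc q) (nat (2 ℕ.+ m))                  ≡⟨ cong (Φ (suc q)) (nat-suc (suc m)) ⟩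
    Φ (suc q) (a + 1ℚ)
      ≡⟨ solve 2 (λ x y → x := (x :+ y) :- y) refl (Φ (suc q) (a + 1ℚ)) (Φ (suc q) a) ⟩
    Φ (suc q) (a + 1ℚ) + Φ (suc q) a - Φ (suc q) a  ≡⟨ cong (_- Φ (suc q) a) (Φ+Φ q a) ⟩
    ΔΦ q a - Φ (suc q) a                        ≈⟨ ≅-- (ΔΦ≅ m) (Φ≅S m) ⟩
    - (2ℚ * term one m) - 2ℚ * S m
      ≡⟨ solve 2 (λ t s → :- (con 2ℚ :* t) :- con 2ℚ :* s := con 2ℚ :* (:- s :- t)) refl (term one m) (S m) ⟩
    2ℚ * (- S m - term one m)                  ≡⟨ cong (2ℚ *_) (S-suc m) ⟨
    2ℚ * S (suc m)                             ∎
    where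
    open ≅-Reasoning 2
    a = nat (suc m)

  Ψ≅T : ∀ m → Ψ (suc q) (nat (suc m)) ≅ - (2ℚ * T m) [ 2 ]
  Ψ≅T zero    = ≅-reflexive (Ψ-1 (suc q))
  Ψ≅T (suc m) = begin
    Ψ (suc q) (nat (2 ℕ.+ m))                  ≡⟨ cong (Ψ (suc q)) (nat-suc (suc m)) ⟩
    Ψ (suc q) (a + 1ℚ)                         ≡⟨ Ψ-Ψ q a ⟩
    Ψ (suc q) a + ΔΦ q a                        ≈⟨ ≅-+ (Ψ≅T m) (ΔΦ≅ m) ⟩
    - (2ℚ * T m) - 2ℚ * term one m
      ≡⟨ solve 2 (λ t s → :- (con 2ℚ :* t) :- con 2ℚ :* s := :- (con 2ℚ :* (t :+ s))) refl (T m) (term one m) ⟩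
    - (2ℚ * (T m + term one m))                ≡⟨ cong (λ z → - (2ℚ * z)) (T-suc m) ⟨
    - (2ℚ * T (suc m))                         ∎
    where
    open ≅-Reasoning 2
    a = nat (suc m)

  Φ≅2S : ∀ {r} m → Int r → r ≅ nat (suc m) [ 2 ] → Φ p r ≅ 2ℚ * S m [ 2 ]
  Φ≅2S {r} m hr r≅m = ≅-trans (Φ-cong hr (int-nat (suc m)) r≅m)
    (subst (λ k → Φ k (nat (suc m)) ≅ 2ℚ * S m [ 2 ]) 1+q≡p (Φ≅S m))

  Ψ≅-2T : ∀ {r} m → Int r → r ≅ nat (suc m) [ 2 ] → Ψ p r ≅ - (2ℚ * T m) [ 2 ]
  Ψ≅-2T {r} m hr r≅m = ≅-trans (Ψ-cong hr (int-nat (suc m)) r≅m)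
    (subst (λ k → Ψ k (nat (suc m)) ≅ - (2ℚ * T m) [ 2 ]) 1+q≡p (Ψ≅T m))

  -- Euler and Bernoulli polynomials as power sums

  -1^q : -1ℚ ^ q ≡ 1ℚ
  -1^q with parity q
  ... | inj₁ (eq , _)    = eq
  ... | inj₂ (eq , 2∤q) with parity (suc q)
  ...   | inj₁ (_ , 2∣p) = contradiction 2∣p (λ 2∣p → 2∤p (subst (2 ∣_) 1+q≡p 2∣p))
    where
    2∤p : 2 ∤ p
    2∤p 2∣p with prime⇒irreducible pr 2∣p
    ... | inj₂ refl = contradiction 3<p (ℕ.≤⇒≯ (ℕ.s≤s (ℕ.s≤s ℕ.z≤n)))
  ...   | inj₂ (eq′ , _) = contradiction (trans (sym eq′) (cong (-1ℚ *_) eq)) (λ ())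

  -- What is used of n = φ(pˢ) - 2.
  record Exponent (s n : ℕ) : Set where
    field
      s≤n   : s ≤ n
      0<n   : 0 < n
      even  : -1ℚ ^ n ≡ 1ℚ
      unit^ : ∀ m → p ∤ m → nat m ^ (2 ℕ.+ n) ≅ 1ℚ [ s ]

  -- n is even because n + 2 is a multiple of the even number q = p - 1; the last field is Euler's
  -- theorem.
  exponent : ∀ s n → suc s ≤ n → 2 ℕ.+ n ≡ q ℕ.* p ℕ.^ s → Exponent (suc s) n
  exponent s n s<n eq = record
    { s≤n   = s<n
    ; 0<n   = ℕ.<-≤-trans ℕ.z<s s<n
    ; even  = trans (solve 1 (λ x → x := con -1ℚ :* (con -1ℚ :* x)) refl (-1ℚ ^ n)) (trans (cong (-1ℚ ^_) eq)
        (trans (sym (^-assocʳ -1ℚ q (p ℕ.^ s))) (trans (cong (_^ (p ℕ.^ s)) -1^q) (1^ (p ℕ.^ s)))))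
    ; unit^ = λ m p∤m → subst (λ e → nat m ^ e ≅ 1ℚ [ suc s ]) (trans (cong (ℕ._* p ℕ.^ s) p∸1≡q) (sym eq))
        (totient s m p∤m)
    }
    where
    p∸1≡q : p ∸ 1 ≡ q
    p∸1≡q = cong (_∸ 1) (sym 1+q≡p)

  module _ {s n : ℕ} (exp : Exponent s n) where
    open Exponent exp

    -- If p divides the base, its n-th power is divisible by p^n and s ≤ n, which matches the
    -- omitted term. Otherwise the (n+2)-th power is 1, so the n-th is the inverse square.
    power≅ : ∀ m → nat (suc m) ^ n ≅ term one m [ s ]
    power≅ m with toSum (p ∣? suc m)
    ... | inj₁ p∣ = subst (λ z → nat (suc m) ^ n ≅ z [ s ]) (sym (term-∣ one m p∣))
      (∈p^⇒≅0 (∈p^-weaken (ℕ.≤-trans s≤n (ℕ.≤-reflexive (sym (ℕ.*-identityʳ n)))) (∈p^-^ n (∣⇒∈p^1 p∣))))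
    ... | inj₂ p∤ = begin
      y                       ≡⟨ ℚ.*-identityˡ y ⟨
      1ℚ * y                  ≡⟨ cong (_* y) (1/k²-* m) ⟨
      i * (a * a) * y         ≡⟨ solve 3 (λ i a y → i :* (a :* a) :* y := i :* (a :* (a :* y))) refl i a y ⟩
      i * a ^ (2 ℕ.+ n)       ≈⟨ ≅-*ˡ (int-1/k² m p∤) (unit^ (suc m) p∤) ⟩
      i * 1ℚ                  ≡⟨ ℚ.*-comm i 1ℚ ⟩
      1ℚ * i                  ≡⟨ term-∤ one m p∤ ⟨
      term one m              ∎
      where
      open ≅-Reasoning s
      a = nat (suc m)
      y = a ^ n
      i = 1/k² m

    0^n : 0ℚ ^ n ≡ 0ℚ
    0^n = subst (λ k → 0ℚ ^ k ≡ 0ℚ) (ℕ.suc-pred n {{ℕ.>-nonZero 0<n}}) (ℚ.*-zeroˡ (0ℚ ^ ℕ.pred n))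

    -- The induction starts at B_{n+1}(1) = B_{n+1}(0), a Bernoulli number of odd index greater than
    -- 1, hence 0.
    B≅T : ∀ m → bernoulliPolyℚ (suc n) (nat (suc m)) ≅ nat (suc n) * T m [ s ]
    B≅T zero    = ≅-reflexive (begin
      bernoulliPolyℚ (suc n) (0ℚ + 1ℚ)                     ≡⟨ bernoulliPolyℚ-step n 0ℚ ⟩
      bernoulliPolyℚ (suc n) 0ℚ + nat (suc n) * 0ℚ ^ n
        ≡⟨ cong₂ (λ x y → x + nat (suc n) * y) (trans (bernoulliPolyℚ-0 (suc n)) (bernoulli-odd n 0<n even)) 0^n ⟩
      0ℚ + nat (suc n) * 0ℚ                    ≡⟨ ℚ.+-identityˡ (nat (suc n) * 0ℚ) ⟩
      nat (suc n) * 0ℚ                         ∎)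
      where open ≡-Reasoning
    B≅T (suc m) = begin
      bernoulliPolyℚ (suc n) (nat (2 ℕ.+ m))
        ≡⟨ cong (bernoulliPolyℚ (suc n)) (nat-suc (suc m)) ⟩
      bernoulliPolyℚ (suc n) (a + 1ℚ)                               ≡⟨ bernoulliPolyℚ-step n a ⟩
      bernoulliPolyℚ (suc n) a + nat (suc n) * a ^ n
        ≈⟨ ≅-+ (B≅T m) (≅-*ˡ (int-nat (suc n)) (power≅ m)) ⟩
      nat (suc n) * T m + nat (suc n) * term one m      ≡⟨ ℚ.*-distribˡ-+ (nat (suc n)) (T m) (term one m) ⟨
      nat (suc n) * (T m + term one m)                  ≡⟨ cong (nat (suc n) *_) (T-suc m) ⟨
      nat (suc n) * T (suc m)                           ∎
      where
      open ≅-Reasoning s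
      a = nat (suc m)

    -- The induction starts at E_n(1) = 2 · 0^n - E_n(0), which is 0 because n is even and positive.
    E≅S : ∀ m → - eulerPolyℚ n (nat (suc m)) ≅ 2ℚ * S m [ s ]
    E≅S zero    = ≅-reflexive (begin
      - eulerPolyℚ n (0ℚ + 1ℚ)
        ≡⟨ solve 2 (λ x y → :- x := y :- (x :+ y)) refl (eulerPolyℚ n (0ℚ + 1ℚ)) (eulerPolyℚ n 0ℚ) ⟩
      eulerPolyℚ n 0ℚ - (eulerPolyℚ n (0ℚ + 1ℚ) + eulerPolyℚ n 0ℚ)
        ≡⟨ cong₂ _-_ (eulerPolyℚ-0 n 0<n even) (trans (eulerPolyℚ-step n 0ℚ) (cong (2ℚ *_) 0^n)) ⟩
      0ℚ - 2ℚ * 0ℚ                             ∎)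
      where open ≡-Reasoning
    E≅S (suc m) = begin
      - eulerPolyℚ n (nat (2 ℕ.+ m))                   ≡⟨ cong (λ z → - eulerPolyℚ n z) (nat-suc (suc m)) ⟩
      - eulerPolyℚ n (a + 1ℚ)
        ≡⟨ solve 2 (λ x y → :- x := :- (x :+ y) :- (:- y)) refl (eulerPolyℚ n (a + 1ℚ)) (eulerPolyℚ n a) ⟩
      - (eulerPolyℚ n (a + 1ℚ) + eulerPolyℚ n a) - (- eulerPolyℚ n a)
        ≡⟨ cong (λ z → - z - (- eulerPolyℚ n a)) (eulerPolyℚ-step n a) ⟩
      - (2ℚ * a ^ n) - (- eulerPolyℚ n a)              ≈⟨ ≅-- (≅-neg (≅-*ˡ (int-nat 2) (power≅ m))) (E≅S m) ⟩
      - (2ℚ * term one m) - 2ℚ * S m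
        ≡⟨ solve 2 (λ t s → :- (con 2ℚ :* t) :- con 2ℚ :* s := con 2ℚ :* (:- s :- t)) refl (term one m) (S m) ⟩
      2ℚ * (- S m - term one m)                ≡⟨ cong (2ℚ *_) (S-suc m) ⟨
      2ℚ * S (suc m)                           ∎
      where
      open ≅-Reasoning s
      a = nat (suc m)

    -- r is replaced by a positive integer that is close enough for both sides: modulo p² for
    -- `Φ≅2S`, and modulo p^N for the continuity of the Euler polynomial. The bound s ≤ 2 reflects
    -- that `Φ≅2S` holds modulo p².
    Φ≅E : ∀ {r} → s ≤ 2 → Int r → Φ p r ≅ - eulerPolyℚ n r [ s ]
    Φ≅E {r} s≤2 hr = begin
      Φ p r                          ≈⟨ ≅-weaken s≤2 (Φ≅2S m hr (≅-weaken 2≤1+M r≅m)) ⟩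
      2ℚ * S m                       ≈⟨ E≅S m ⟨
      - eulerPolyℚ n (nat (suc m))           ≈⟨ ≅-neg (cont (int-- hr int-½) (int-- (int-nat (suc m)) int-½)
                                          (≅-+ʳ (- ½) (≅-weaken N≤1+M r≅m))) ⟨
      - eulerPolyℚ n r                       ∎
      where
      open ≅-Reasoning s
      continuity = ⋆-^-continuous ε n s
      N = proj₁ continuity
      cont = proj₂ continuity
      M = N ⊔ 2
      approximation = approx r hr M
      m = proj₁ approximation
      r≅m = proj₂ approximation
      N≤1+M : N ≤ suc M
      N≤1+M = ℕ.m≤n⇒m≤1+n (ℕ.m≤m⊔n N 2)
      2≤1+M : 2 ≤ suc M
      2≤1+M = ℕ.m≤n⇒m≤1+n (ℕ.m≤n⊔m N 2)

    -- At a nearby positive integer the left side is -2T and the Bernoulli polynomial is (n+1)T, so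
    -- the condition on c is exactly what makes the two agree.
    Ψ≅B : ∀ {r c} → s ≤ 2 → Int r → Int c → c * nat (suc n) ≅ - 2ℚ [ s ] → Ψ p r ≅ c * bernoulliPolyℚ (suc n) r [ s ]
    Ψ≅B {r} {c} s≤2 hr hc c≅ = begin
      Ψ p r                          ≈⟨ ≅-weaken s≤2 (Ψ≅-2T m hr (≅-weaken 2≤1+M r≅m)) ⟩
      - (2ℚ * T m)                   ≡⟨ ℚ.neg-distribˡ-* 2ℚ (T m) ⟩
      - 2ℚ * T m                     ≈⟨ ≅-*ʳ (int-T m) c≅ ⟨
      c * nat (suc n) * T m          ≡⟨ ℚ.*-assoc c (nat (suc n)) (T m) ⟩
      c * (nat (suc n) * T m)        ≈⟨ ≅-*ˡ hc (B≅T m) ⟨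
      c * bernoulliPolyℚ (suc n) (nat (suc m))   ≈⟨ ≅-*ˡ hc (cont hr (int-nat (suc m)) (≅-weaken N≤1+M r≅m)) ⟨
      c * bernoulliPolyℚ (suc n) r               ∎
      where
      open ≅-Reasoning s
      continuity = ⋆-^-continuous bernoulli (suc n) s
      N = proj₁ continuity
      cont = proj₂ continuity
      M = N ⊔ 2
      approximation = approx r hr M
      m = proj₁ approximation
      r≅m = proj₂ approximation
      N≤1+M : N ≤ suc M
      N≤1+M = ℕ.m≤n⇒m≤1+n (ℕ.m≤m⊔n N 2)
      2≤1+M : 2 ≤ suc M
      2≤1+M = ℕ.m≤n⇒m≤1+n (ℕ.m≤n⊔m N 2)

-- Passage from rational to p-adic arguments

module Transfer (p : ℕ) (pr : Prime p) (3<p : 3 < p) where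

  private module R = Rationals
  open Rationals using
    ( nat; inv; inv-*; nat-suc; nat-*; Σ<; ^-distrib-*; 1^; ⋆-binomial; 2ℚ; bernoulliPolyℚ; eulerPolyℚ; ε; ε≡
    ; binomℚ; u; Φ; Ψ; module ℚ* )
  open +-*-Solver

  open PAdic p pr
  open Congruence p pr using
    ( Int; int; unint; int-nat; p≢0; _∈p^_; ball; unball; _≅_[_]; diff; undiff; ∈p^-*; ∈p^-*ʳ; ∈p^-+;
      ∈p^-neg; p^∈p^; p∈p^1; ≅-sym; ≅-trans; ≅⇒int; ≅-reflexive )
  open Sums p pr 3<p

  seq-sum : ∀ n (t : Fin n → ℚₚ) i → seq (sum t) i ≡ R.sum (λ j → seq (t j) i)
  seq-sum zero    t i = refl
  seq-sum (suc n) t i = cong (seq (t zero) i ℚ.+_) (seq-sum n (λ j → t (suc j)) i)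

  seq-product : ∀ n (t : Fin n → ℚₚ) i → seq (product t) i ≡ ℚ*.sum (λ j → seq (t j) i)
  seq-product zero    t i = refl
  seq-product (suc n) t i = cong (seq (t zero) i ℚ.*_) (seq-product n (λ j → t (suc j)) i)

  seq-^ : ∀ x n i → seq (x ^ n) i ≡ seq x i R.^ n
  seq-^ x zero    i = refl
  seq-^ x (suc n) i = cong (seq x i ℚ.*_) (seq-^ x n i)

  seq-Σ : ∀ n {t : Fin n → ℚₚ} (g : ℕ → ℚ) i → (∀ j → seq (t j) i ≡ g (toℕ j)) → seq (sum t) i ≡ Σ< n g
  seq-Σ zero        g i eq = refl
  seq-Σ (suc n) {t} g i eq = cong₂ ℚ._+_ (eq zero) (seq-Σ n {λ j → t (suc j)} (λ k → g (suc k)) i (λ j → eq (suc j)))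

  -- The factors enter as an arbitrary family `t` known only through its i-th terms, so that
  -- matching it with `binom` involves rational values alone. `seq-u`, `sum≡S₁` and `*sum≡S₂` have
  -- this form for the same reason.
  seq-binom : ∀ k {t : Fin k → ℚₚ} x i → (∀ j → seq (t j) i ≡ x ℚ.- nat (toℕ j)) →
              seq (product t) i ℚ.* (1ℤ / k ℕ.!) {{k ℕ.!≢0}} ≡ binomℚ x k
  seq-binom k {t} x i eq = cong (ℚ._* inv (k ℕ.!) {{k ℕ.!≢0}}) (trans (seq-product k t i) (ℚ*.sum-cong-≗ {k} eq))

  seq-u : ∀ k {t t′ : Fin k → ℚₚ} x i →
          (∀ j → seq (t j) i ≡ (ℚ.- x) ℚ.- nat (toℕ j)) → (∀ j → seq (t′ j) i ≡ (x ℚ.- 1ℚ) ℚ.- nat (toℕ j)) →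
          (seq (product t) i ℚ.* (1ℤ / k ℕ.!) {{k ℕ.!≢0}}) ℚ.*
            (seq (product t′) i ℚ.* (1ℤ / k ℕ.!) {{k ℕ.!≢0}}) ≡ u k x
  seq-u k x i eq eq′ = cong₂ ℚ._*_ (seq-binom k (ℚ.- x) i eq) (seq-binom k (x ℚ.- 1ℚ) i eq′)

  S₁ S₂ : ℚₚ → ℚₚ
  S₁ a = sum {p} (λ i → let k = toℕ i in binom (- a) k * binom (a - 1#) k * ι (H⁽²⁾ k))
  S₂ a = (fromℤ (+ 2) * a - 1#) * sum {p} (λ i → let k = toℕ i in
           binom (- a) k * binom (a - 1#) k * ι (H⁽²⁾ k ℚ.* (1ℤ / suc (2 ℕ.* k))))

  H/ : ℕ → ℚ
  H/ k = H⁽²⁾ k ℚ.* (1ℤ / suc (2 ℕ.* k))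

  seq-S₁ : ∀ a i → seq (S₁ a) i ≡ Φ p (seq a i)
  seq-S₁ a i = seq-Σ p (λ k → u k (seq a i) ℚ.* H⁽²⁾ k) i (λ j → cong (ℚ._* H⁽²⁾ (toℕ j))
    (seq-u (toℕ j) (seq a i) i (λ _ → refl) (λ _ → refl)))

  seq-S₂ : ∀ a i → seq (S₂ a) i ≡ Ψ p (seq a i)
  seq-S₂ a i = cong ((2ℚ ℚ.* seq a i ℚ.- 1ℚ) ℚ.*_)
    (seq-Σ p (λ k → u k (seq a i) ℚ.* H/ k) i (λ j → cong (ℚ._* H/ (toℕ j))
      (seq-u (toℕ j) (seq a i) i (λ _ → refl) (λ _ → refl))))

  sum≡S₁ : ∀ {t : Fin p → ℚₚ} a i → (∀ j → seq (t j) i ≡ u (toℕ j) (seq a i) ℚ.* H⁽²⁾ (toℕ j)) →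
           seq (sum t) i ≡ seq (S₁ a) i
  sum≡S₁ a i eq = trans (seq-Σ p (λ k → u k (seq a i) ℚ.* H⁽²⁾ k) i eq) (sym (seq-S₁ a i))

  *sum≡S₂ : ∀ {t : Fin p → ℚₚ} a i → (∀ j → seq (t j) i ≡ u (toℕ j) (seq a i) ℚ.* H/ (toℕ j)) →
            (2ℚ ℚ.* seq a i ℚ.- 1ℚ) ℚ.* seq (sum t) i ≡ seq (S₂ a) i
  *sum≡S₂ a i eq = trans (cong ((2ℚ ℚ.* seq a i ℚ.- 1ℚ) ℚ.*_) (seq-Σ p (λ k → u k (seq a i) ℚ.* H/ k) i eq))
      (sym (seq-S₂ a i))

  seq-bernoulliPoly : ∀ n x i → seq (bernoulliPoly n x) i ≡ bernoulliPolyℚ n (seq x i)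
  seq-bernoulliPoly n x i = trans
    (seq-Σ (suc n) {λ j → let k = toℕ j in fromℤ (+ (n C k)) * ι (bernoulli k) * x ^ (n ∸ k)}
      (λ k → nat (n C k) ℚ.* (bernoulli k ℚ.* seq x i R.^ (n ∸ k))) i (λ j → let k = toℕ j in trans
      (cong ((nat (n C k) ℚ.* bernoulli k) ℚ.*_) (seq-^ x (n ∸ k) i))
          (ℚ.*-assoc (nat (n C k)) (bernoulli k) (seq x i R.^ (n ∸ k)))))
    (sym (⋆-binomial bernoulli (seq x i R.^_) n))

  seq-eulerPoly : ∀ n x i → seq (eulerPoly n x) i ≡ eulerPolyℚ n (seq x i)
  seq-eulerPoly n x i = trans
    (seq-Σ (suc n) {λ j → let k = toℕ j in
        fromℤ (+ (n C k)) * ι ((euler k / 2 ℕ.^ k) {{ℕ.m^n≢0 2 k}}) * (x - ι ℚ.½) ^ (n ∸ k)}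
      (λ k → nat (n C k) ℚ.* (ε k ℚ.* (seq x i ℚ.- ℚ.½) R.^ (n ∸ k))) i (λ j → let k = toℕ j in trans
      (cong₂ (λ e y → nat (n C k) ℚ.* e ℚ.* y) (ε≡ k) (seq-^ (x - ι ℚ.½) (n ∸ k) i))
      (ℚ.*-assoc (nat (n C k)) (ε k) ((seq x i ℚ.- ℚ.½) R.^ (n ∸ k)))))
    (sym (⋆-binomial ε ((seq x i ℚ.- ℚ.½) R.^_) n))

  -- The unfolding of x ≡ y [modp^ n ] in terms of the sequences of x and y.  With seq x and seq y as
  -- indices instead of x and y, unification never compares the Cauchy proofs stored in x and y.
  Modp^ : (ℕ → ℚ) → (ℕ → ℚ) → ℕ → Set
  Modp^ x y n =
    (∃ λ N → ∀ i → N ≤ i → x i ∈ ℤ₍ₚ₎) × (∃ λ N → ∀ i → N ≤ i → y i ∈ ℤ₍ₚ₎) ×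
    ∃ λ z → z ∈ ℤₚ × ∀ m → ∃ λ N → ∀ i → N ≤ i → Ball m ((x i ℚ.- y i) ℚ.- p^ n ℚ.* seq z i)

  modp^-resp : ∀ x y n {x′ y′} → x ≡ y [modp^ n ] → (∀ i → x′ i ≡ seq x i) → (∀ i → y′ i ≡ seq y i) → Modp^ x′ y′ n
  modp^-resp x y n ((M , hM) , (N , hN) , z , hz , eq) x≡ y≡ =
    (M , λ i M≤i → subst ℤ₍ₚ₎ (sym (x≡ i)) (hM i M≤i)) ,
    (N , λ i N≤i → subst ℤ₍ₚ₎ (sym (y≡ i)) (hN i N≤i)) ,
    z , hz , λ m → let K , hK = eq m in K , λ i K≤i →
      subst (Ball m) (cong₂ (λ v w → (v ℚ.- w) ℚ.- p^ n ℚ.* seq z i) (sym (x≡ i)) (sym (y≡ i))) (hK i K≤i)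

  -- The quotient z is (x - y) p⁻ⁿ formed in ℚₚ, hence Cauchy as a product; the hypothesis makes its
  -- late terms integral. Integrality of y follows from that of x.
  modp^-intro : ∀ {x y n} N → (∀ i → N ≤ i → Int (seq x i)) → (∀ i → N ≤ i → seq x i ≅ seq y i [ n ]) →
                x ≡ y [modp^ n ]
  modp^-intro {x} {y} {n} N hx x≅y =
    (N , λ i N≤i → unint (hx i N≤i)) ,
    (N , λ i N≤i → unint (≅⇒int (≅-sym (x≅y i N≤i)) (hx i N≤i))) ,
    z , (N , λ i N≤i → unint (divide (undiff (x≅y i N≤i)))) ,
    λ m → 0 , λ i _ → unball (undiff (≅-reflexive {m} (sym (p^*p⁻ⁿ (seq x i ℚ.- seq y i)))))
    where
    p⁻ⁿ = inv p R.^ n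
    z = (x - y) * ι p⁻ⁿ
    p^*inv : p^ n ℚ.* p⁻ⁿ ≡ 1ℚ
    p^*inv = trans (sym (^-distrib-* (nat p) (inv p) n))
      (trans (cong (R._^ n) (trans (ℚ.*-comm (nat p) (inv p)) (inv-* p))) (1^ n))
    p^*p⁻ⁿ : ∀ d → p^ n ℚ.* (d ℚ.* p⁻ⁿ) ≡ d
    p^*p⁻ⁿ d = trans (solve 3 (λ P d Q → P :* (d :* Q) := d :* (P :* Q)) refl (p^ n) d p⁻ⁿ)
      (trans (cong (d ℚ.*_) p^*inv) (ℚ.*-identityʳ d))
    divide : ∀ {d} → d ∈p^ n → Int (d ℚ.* p⁻ⁿ)
    divide (ball (w , hw , refl)) = subst Int
        (sym (trans (solve 3 (λ P d Q → P :* d :* Q := P :* (d :* Q)) refl (p^ n) w p⁻ⁿ) (p^*p⁻ⁿ w))) (int hw)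

  -- Taking precision n in x - y ≈ pⁿ z puts the error itself into the ball of pⁿ, along with pⁿ z.
  modp^-elim : ∀ {x y n} → x ≡ y [modp^ n ] → ∃ λ N → ∀ i → N ≤ i → seq x i ≅ seq y i [ n ]
  modp^-elim {x} {y} {n} (_ , _ , z , (N , hz) , eq) = let M , hM = eq n in N ⊔ M , λ i N⊔M≤i →
    diff (subst (_∈p^ n) (solve 2 (λ d e → (d :- e) :+ e := d) refl (seq x i ℚ.- seq y i) (p^ n ℚ.* seq z i))
      (∈p^-+ (ball (hM i (ℕ.m⊔n≤o⇒n≤o N M N⊔M≤i)))
             (∈p^-*ʳ (p^∈p^ n) (int (hz i (ℕ.m⊔n≤o⇒m≤o N M N⊔M≤i))))))

  modp^-sym : ∀ {n} x y → x ≡ y [modp^ n ] → y ≡ x [modp^ n ]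
  modp^-sym {n} x y x≡y@(_ , (M , hy) , _) = let N , hN = modp^-elim {x} {y} {n} x≡y in
    modp^-intro {y} {x} {n} (M ⊔ N)
      (λ i M⊔N≤i → int (hy i (ℕ.m⊔n≤o⇒m≤o M N M⊔N≤i)))
      (λ i M⊔N≤i → ≅-sym (hN i (ℕ.m⊔n≤o⇒n≤o M N M⊔N≤i)))

  modp^-trans : ∀ {n} x y z → x ≡ y [modp^ n ] → y ≡ z [modp^ n ] → x ≡ z [modp^ n ]
  modp^-trans {n} x y z x≡y@((K , hx) , _) y≡z =
    let M , hM = modp^-elim {x} {y} {n} x≡y
        N , hN = modp^-elim {y} {z} {n} y≡z
    in modp^-intro {x} {z} {n} (K ⊔ (M ⊔ N))
      (λ i hi → int (hx i (ℕ.m⊔n≤o⇒m≤o K (M ⊔ N) hi)))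
      (λ i hi → let hi′ = ℕ.m⊔n≤o⇒n≤o K (M ⊔ N) hi in
        ≅-trans (hM i (ℕ.m⊔n≤o⇒m≤o M N hi′)) (hN i (ℕ.m⊔n≤o⇒n≤o M N hi′)))

  -- The exponents φ(p) - 2 and φ(p²) - 2, and the Bernoulli coefficients

  n₁ n₂ : ℕ
  n₁ = p ∸ 3
  n₂ = p ℕ.^ 2 ∸ p ∸ 2

  3+n₁≡p : 3 ℕ.+ n₁ ≡ p
  3+n₁≡p = ℕ.m+[n∸m]≡n (ℕ.<⇒≤ 3<p)

  1+n₁≡ : p ∸ 2 ≡ suc n₁
  1+n₁≡ = cong (_∸ 2) (sym 3+n₁≡p)

  p²∸p≡ : p ℕ.^ 2 ∸ p ≡ q ℕ.* p ℕ.^ 1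
  p²∸p≡ = trans (cong (λ k → k ℕ.* p ℕ.^ 1 ∸ p) (sym 1+q≡p))
      (trans (cong (λ k → k ℕ.+ q ℕ.* p ℕ.^ 1 ∸ p) (ℕ.*-identityʳ p)) (ℕ.m+n∸m≡n p (q ℕ.* p ℕ.^ 1)))

  2<q : 2 < q
  2<q = ℕ.s<s⁻¹ (subst (3 <_) (sym 1+q≡p) 3<p)

  4≤ : 4 ≤ q ℕ.* p ℕ.^ 1
  4≤ = ℕ.≤-trans (ℕ.≤-trans 3<p (ℕ.≤-reflexive (sym (ℕ.*-identityʳ p))))
      (ℕ.m≤n*m (p ℕ.^ 1) q {{ℕ.>-nonZero (ℕ.<-trans ℕ.z<s 2<q)}})

  2+n₂≡ : 2 ℕ.+ n₂ ≡ q ℕ.* p ℕ.^ 1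
  2+n₂≡ = trans (cong (λ k → 2 ℕ.+ (k ∸ 2)) p²∸p≡) (ℕ.m+[n∸m]≡n (ℕ.≤-trans (ℕ.s≤s (ℕ.s≤s ℕ.z≤n)) 4≤))

  1+n₂≡ : p ℕ.^ 2 ∸ p ∸ 1 ≡ suc n₂
  1+n₂≡ = trans (cong (_∸ 1) p²∸p≡) (cong (_∸ 1) (sym 2+n₂≡))

  exponent₁ : Exponent 1 n₁
  exponent₁ = exponent 0 n₁ (ℕ.s≤s⁻¹ (ℕ.s≤s⁻¹ (ℕ.s≤s⁻¹ (subst (3 <_) (sym 3+n₁≡p) 3<p))))
    (trans (cong ℕ.pred 3+n₁≡p) (sym (ℕ.*-identityʳ q)))

  exponent₂ : Exponent 2 n₂
  exponent₂ = exponent 1 n₂ (ℕ.s≤s⁻¹ (ℕ.s≤s⁻¹ (subst (4 ≤_) (sym 2+n₂≡) 4≤))) 2+n₂≡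

  P : ℚ
  P = nat p

  1+n₁≅-2 : nat (suc n₁) ≅ ℚ.- 2ℚ [ 1 ]
  1+n₁≅-2 = diff (subst (_∈p^ 1) (trans
    (trans (cong nat (sym 3+n₁≡p)) (trans (nat-suc (2 ℕ.+ n₁)) (cong (ℚ._+ 1ℚ) (nat-suc (suc n₁)))))
    (solve 1 (λ x → x :+ con 1ℚ :+ con 1ℚ := x :- (:- con 2ℚ)) refl (nat (suc n₁)))) p∈p^1)

  -- Modulo p² the coefficient is -2/(p² - p - 1) ≡ 2/(1 + p) ≡ 2 - 2p. Exactly, (2 - 2p)(p² - p -
  -- 1) + 2 = p²(4 - 2p).
  coefficient₂ : (2ℚ ℚ.- 2ℚ ℚ.* P) ℚ.* nat (suc n₂) ≅ ℚ.- 2ℚ [ 2 ]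
  coefficient₂ = diff (subst (_∈p^ 2) (begin
    P ℚ.* P ℚ.* (2ℚ ℚ.+ 2ℚ ℚ.- 2ℚ ℚ.* P)
      ≡⟨ solve 1 (λ P → P :* P :* (con 2ℚ :+ con 2ℚ :- con 2ℚ :* P) := (con 2ℚ :- con 2ℚ :* P)
           :* ((P :- con 1ℚ) :* P :- con 1ℚ) :- (:- con 2ℚ)) refl P ⟩
    (2ℚ ℚ.- 2ℚ ℚ.* P) ℚ.* ((P ℚ.- 1ℚ) ℚ.* P ℚ.- 1ℚ) ℚ.- (ℚ.- 2ℚ)
      ≡⟨ cong (λ x → (2ℚ ℚ.- 2ℚ ℚ.* P) ℚ.* x ℚ.- (ℚ.- 2ℚ)) eq ⟩
    (2ℚ ℚ.- 2ℚ ℚ.* P) ℚ.* nat (suc n₂) ℚ.- (ℚ.- 2ℚ) ∎)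
    (∈p^-*ʳ (∈p^-* p∈p^1 p∈p^1) (∈p^-+ (∈p^-+ (int-nat 2) (int-nat 2)) (∈p^-neg (∈p^-* (int-nat 2) (int-nat p))))))
    where
    open ≡-Reasoning
    P-1 : P ℚ.- 1ℚ ≡ nat q
    P-1 = trans (cong (ℚ._- 1ℚ) (trans (cong nat (sym 1+q≡p)) (nat-suc q)))
        (solve 1 (λ x → x :+ con 1ℚ :- con 1ℚ := x) refl (nat q))
    eq : (P ℚ.- 1ℚ) ℚ.* P ℚ.- 1ℚ ≡ nat (suc n₂)
    eq = begin
      (P ℚ.- 1ℚ) ℚ.* P ℚ.- 1ℚ   ≡⟨ cong (λ x → x ℚ.* P ℚ.- 1ℚ) P-1 ⟩
      nat q ℚ.* P ℚ.- 1ℚ        ≡⟨ cong (ℚ._- 1ℚ) (nat-* q p) ⟨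
      nat (q ℕ.* p) ℚ.- 1ℚ
        ≡⟨ cong (λ k → nat k ℚ.- 1ℚ) (trans (cong (q ℕ.*_) (sym (ℕ.*-identityʳ p))) (sym 2+n₂≡)) ⟩
      nat (2 ℕ.+ n₂) ℚ.- 1ℚ     ≡⟨ cong (ℚ._- 1ℚ) (nat-suc (suc n₂)) ⟩
      nat (suc n₂) ℚ.+ 1ℚ ℚ.- 1ℚ ≡⟨ solve 1 (λ x → x :+ con 1ℚ :- con 1ℚ := x) refl (nat (suc n₂)) ⟩
      nat (suc n₂)              ∎

  2-2p : ℚₚ
  2-2p = fromℤ (+ 2) - fromℤ (+ 2) * fromℤ (+ p)

  2S 2T : ℕ → ℚₚ
  2S m = fromℤ (+ 2) * ι (sumPrimeTo p m (λ k → -1ℤ ℤ.^ (m ∸ k)))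
  2T m = fromℤ (+ 2) * ι (sumPrimeTo p m (λ _ → 1ℤ))

  -- The congruences for a p-adic integer

  module _ (a : ℚₚ) (a∈ℤₚ : a ∈ ℤₚ) where

    private
      N = proj₁ a∈ℤₚ

      int-a : ∀ i → N ≤ i → Int (seq a i)
      int-a i N≤i = int (proj₂ a∈ℤₚ i N≤i)

    S₁-modp^ : ∀ y {n} M → (∀ i → M ≤ i → Int (seq a i) → Φ p (seq a i) ≅ seq y i [ n ]) → S₁ a ≡ y [modp^ n ]
    S₁-modp^ y {n} M hyp = modp^-intro {S₁ a} {y} {n} (N ⊔ M)
      (λ i hi → subst Int (sym (seq-S₁ a i)) (int-Φ (int-a i (ℕ.m⊔n≤o⇒m≤o N M hi))))
      (λ i hi → subst (_≅ seq y i [ n ]) (sym (seq-S₁ a i))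
          (hyp i (ℕ.m⊔n≤o⇒n≤o N M hi) (int-a i (ℕ.m⊔n≤o⇒m≤o N M hi))))

    S₂-modp^ : ∀ y {n} M → (∀ i → M ≤ i → Int (seq a i) → Ψ p (seq a i) ≅ seq y i [ n ]) → S₂ a ≡ y [modp^ n ]
    S₂-modp^ y {n} M hyp = modp^-intro {S₂ a} {y} {n} (N ⊔ M)
      (λ i hi → subst Int (sym (seq-S₂ a i)) (int-Ψ (int-a i (ℕ.m⊔n≤o⇒m≤o N M hi))))
      (λ i hi → subst (_≅ seq y i [ n ]) (sym (seq-S₂ a i))
          (hyp i (ℕ.m⊔n≤o⇒n≤o N M hi) (int-a i (ℕ.m⊔n≤o⇒m≤o N M hi))))

    S₁≡2S : ∀ m → a ≡ fromℤ (+ suc m) [modp^ 2 ] → S₁ a ≡ 2S (suc m) [modp^ 2 ]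
    S₁≡2S m a≡m = let M , hM = modp^-elim {a} {fromℤ (+ suc m)} {2} a≡m in
      S₁-modp^ (2S (suc m)) M (λ i M≤i ha → Φ≅2S m ha (hM i M≤i))

    S₂≡-2T : ∀ m → a ≡ fromℤ (+ suc m) [modp^ 2 ] → S₂ a ≡ - 2T (suc m) [modp^ 2 ]
    S₂≡-2T m a≡m = let M , hM = modp^-elim {a} {fromℤ (+ suc m)} {2} a≡m in
      S₂-modp^ (- 2T (suc m)) M (λ i M≤i ha → Ψ≅-2T m ha (hM i M≤i))

    S₁≡-E : ∀ {s n} → Exponent s n → s ≤ 2 → S₁ a ≡ - eulerPoly n a [modp^ s ]
    S₁≡-E {s} {n} exp s≤2 = S₁-modp^ (- eulerPoly n a) 0 (λ i _ ha →
      ≅-trans (Φ≅E exp s≤2 ha) (≅-reflexive (cong ℚ.-_ (sym (seq-eulerPoly n a i)))))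

    S₂≡B : ∀ {s n} → Exponent s n → s ≤ 2 → nat (suc n) ≅ ℚ.- 2ℚ [ s ] → S₂ a ≡ bernoulliPoly (suc n) a [modp^ s ]
    S₂≡B {s} {n} exp s≤2 n≅ = S₂-modp^ (bernoulliPoly (suc n) a) 0 (λ i _ ha →
      ≅-trans (Ψ≅B exp s≤2 ha (int-nat 1) (subst (_≅ ℚ.- 2ℚ [ s ]) (sym (ℚ.*-identityˡ (nat (suc n)))) n≅))
        (≅-reflexive (trans (ℚ.*-identityˡ (bernoulliPolyℚ (suc n) (seq a i)))
            (sym (seq-bernoulliPoly (suc n) a i)))))

    S₂≡cB : ∀ {s n} c x → (∀ i → seq x i ≡ c) → Exponent s n → s ≤ 2 → Int c → c ℚ.* nat (suc n) ≅ ℚ.- 2ℚ [ s ] →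
            S₂ a ≡ x * bernoulliPoly (suc n) a [modp^ s ]
    S₂≡cB {s} {n} c x x≡c exp s≤2 hc c≅ = S₂-modp^ (x * bernoulliPoly (suc n) a) 0 (λ i _ ha →
      ≅-trans (Ψ≅B exp s≤2 ha hc c≅) (≅-reflexive (sym (cong₂ ℚ._*_ (x≡c i) (seq-bernoulliPoly (suc n) a i)))))

    S₁≡-E₁ : S₁ a ≡ - eulerPoly (p ∸ 3) a [modp^ 1 ]
    S₁≡-E₁ = S₁≡-E exponent₁ (ℕ.n≤1+n 1)

    S₂≡B₁ : S₂ a ≡ bernoulliPoly (p ∸ 2) a [modp^ 1 ]
    S₂≡B₁ = subst (λ n → S₂ a ≡ bernoulliPoly n a [modp^ 1 ]) (sym 1+n₁≡) (S₂≡B exponent₁ (ℕ.n≤1+n 1) 1+n₁≅-2)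

    S₂≡B₂ : S₂ a ≡ 2-2p * bernoulliPoly (p ℕ.^ 2 ∸ p ∸ 1) a [modp^ 2 ]
    S₂≡B₂ = subst (λ n → S₂ a ≡ 2-2p * bernoulliPoly n a [modp^ 2 ]) (sym 1+n₂≡)
      (S₂≡cB (2ℚ ℚ.- 2ℚ ℚ.* nat p) 2-2p (λ _ → refl) exponent₂ ℕ.≤-refl
        (∈p^-+ (int-nat 2) (∈p^-neg (∈p^-* (int-nat 2) (int-nat p)))) coefficient₂)

    -- The second congruence of each chain passes through the sum over k < p, to which both of its
    -- sides are congruent.
    part-i : (m : ℕ) → 0 < m → a ≡ fromℤ (+ m) [modp^ 2 ] →
      (S₁ a ≡ 2S m [modp^ 2 ] × 2S m ≡ - eulerPoly (p ℕ.^ 2 ∸ p ∸ 2) a [modp^ 2 ]) ×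
      (S₂ a ≡ - 2T m [modp^ 2 ] × - 2T m ≡ 2-2p * bernoulliPoly (p ℕ.^ 2 ∸ p ∸ 1) a [modp^ 2 ])
    part-i (suc m) _ a≡m =
      ( S₁≡2S m a≡m
      , modp^-trans {2} (2S (suc m)) (S₁ a) (- eulerPoly n₂ a)
          (modp^-sym {2} (S₁ a) (2S (suc m)) (S₁≡2S m a≡m)) (S₁≡-E exponent₂ ℕ.≤-refl)) ,
      ( S₂≡-2T m a≡m
      , modp^-trans {2} (- 2T (suc m)) (S₂ a) (2-2p * bernoulliPoly (p ℕ.^ 2 ∸ p ∸ 1) a)
          (modp^-sym {2} (S₂ a) (- 2T (suc m)) (S₂≡-2T m a≡m)) S₂≡B₂)

theorem1p2 : (p : ℕ) (p-prime : Prime p) → 3 < p →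
  let open PAdic p p-prime in
  (a : ℚₚ) → a ∈ ℤₚ →
  let S₁ = sum {p} (λ i → let k = toℕ i in
             binom (- a) k * binom (a - 1#) k * ι (H⁽²⁾ k))
      S₂ = (fromℤ (+ 2) * a - 1#) * sum {p} (λ i → let k = toℕ i in
             binom (- a) k * binom (a - 1#) k * ι (H⁽²⁾ k ℚ.* (1ℤ / suc (2 ℕ.* k))))
  in
  ((m : ℕ) → 0 < m → a ≡ fromℤ (+ m) [modp^ 2 ] →
    (S₁ ≡ fromℤ (+ 2) * ι (sumPrimeTo p m (λ k → -1ℤ ℤ.^ (m ∸ k))) [modp^ 2 ]
      × fromℤ (+ 2) * ι (sumPrimeTo p m (λ k → -1ℤ ℤ.^ (m ∸ k)))
          ≡ - eulerPoly (p ℕ.^ 2 ∸ p ∸ 2) a [modp^ 2 ])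
    × (S₂ ≡ - (fromℤ (+ 2) * ι (sumPrimeTo p m (λ _ → 1ℤ))) [modp^ 2 ]
      × - (fromℤ (+ 2) * ι (sumPrimeTo p m (λ _ → 1ℤ)))
          ≡ (fromℤ (+ 2) - fromℤ (+ 2) * fromℤ (+ p)) * bernoulliPoly (p ℕ.^ 2 ∸ p ∸ 1) a [modp^ 2 ]))
  × (S₁ ≡ - eulerPoly (p ∸ 3) a [modp^ 1 ]
    × S₂ ≡ bernoulliPoly (p ∸ 2) a [modp^ 1 ])
theorem1p2 p pr 3<p a a∈ℤₚ =
  (λ m 0<m a≡m → let (S₁≡ , ≡E) , (S₂≡ , ≡B) = part-i a a∈ℤₚ m 0<m a≡m in
      (modp^-resp (S₁ a) (2S m) 2 S₁≡
          (λ i → sum≡S₁ a i (λ j → cong (ℚ._* H⁽²⁾ (toℕ j)) (seq-u (toℕ j) (seq a i) i (λ _ → refl) (λ _ → refl))))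
              (λ _ → refl) , ≡E)
    , (modp^-resp (S₂ a) (- 2T m) 2 S₂≡
          (λ i → *sum≡S₂ a i (λ j → cong (ℚ._* H/ (toℕ j)) (seq-u (toℕ j) (seq a i) i (λ _ → refl) (λ _ → refl))))
              (λ _ → refl) , ≡B)) ,
  modp^-resp (S₁ a) (- eulerPoly (p ∸ 3) a) 1 (S₁≡-E₁ a a∈ℤₚ)
          (λ i → sum≡S₁ a i (λ j → cong (ℚ._* H⁽²⁾ (toℕ j)) (seq-u (toℕ j) (seq a i) i (λ _ → refl) (λ _ → refl))))
              (λ _ → refl) ,
  modp^-resp (S₂ a) (bernoulliPoly (p ∸ 2) a) 1 (S₂≡B₁ a a∈ℤₚ)
          (λ i → *sum≡S₂ a i (λ j → cong (ℚ._* H/ (toℕ j)) (seq-u (toℕ j) (seq a i) i (λ _ → refl) (λ _ → refl))))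
              (λ _ → refl)
  where
  open PAdic p pr
  open Transfer p pr 3<p
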